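{- Let $q$ be a prime power and let $A=(a_{ij})\in\mathbb{F}_q^{m\times k}$ be the coefficient matrix of a linear system $(\star)$: $\sum_{j=1}^k a_{ij}x_j=0$ for all $i\in[m]$, in unknowns $x_1,\dots,x_k\in\mathbb{F}_q^n$. Assume $(\star)$ is a type (RC) linear system that is non-degenerate and irreducible, and let $\ell$ be its number of column equivalence classes. Suppose that at least one of the following holds: (i) none of the column equivalence classes sums to zero, and $\ell=m+1$; (ii) every column equivalence class sums to zero. Then $(\star)$ is temperate.
   Context: The system $(\star)$ is balanced if every row of $A$ sums to zero. Two indices $j,j'\in[k]$ are equivalent if the $j$-th and $j'$-th columns of $A$ are nonzero scalar multiples of one another; the classes are the column equivalence classes. A column equivalence class sums to zero if the columns indexed by it add up to the zero vector. $(\star)$ is of type (RC) if it is balanced and has at most one column equivalence class of size $1$. $(\star)$ is non-degenerate if the rows of $A$ are linearly independent and every column of $A$ is nonzero. Two linear systems are equivalent if each equation of either is a linear combination of the equations of the other. $(\star)$ is reducible if it is equivalent to a system for which the variables can be partitioned into two or more classes such that every equation only uses variables from one class; otherwise irreducible. A solution $(x_1,\dots,x_k)$ of $(\star)$ is generic if for every $b\in\mathbb{F}_q^k$ with $b_1+\dots+b_k=0$ and $b_1x_1+\dots+b_kx_k=0$, the vector $b$ lies in the row space of $A$. $(\star)$ is temperate if there exist constants $\beta,\gamma>0$ with $\gamma<q$ such that for every $n$, every $S\subseteq\mathbb{F}_q^n$ with $|S|\ge\beta\gamma^n$ contains a generic solution $(x_1,\dots,x_k)\in S^k$ of $(\star)$.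 -}

module Defs where

open import Level using (0ℓ)
open import Data.Nat as ℕ using (ℕ; zero; suc)
open import Data.Fin using (Fin; zero; suc)
open import Data.Vec using (Vec; lookup)
open import Data.List using (List; length)
open import Data.List.Membership.Propositional using (_∈_)
open import Data.List.Relation.Unary.Unique.Propositional using (Unique)
open import Data.Product using (Σ; ∃; ∃-syntax; _×_; _,_)
open import Data.Sum using (_⊎_)
open import Data.Integer using (+_)
open import Data.Rational as ℚ using (ℚ; 0ℚ; 1ℚ)
open import Relation.Nullary using (¬_)
open import Relation.Binary.PropositionalEquality using (_≡_)
open import Algebra.Structures using (IsCommutativeRing)
open import Function.Bundles using (_↔_)

-- Finite fields: a commutative ring (with propositional equality) in
-- which 0 ≠ 1 and every nonzero element has a multiplicative inverse,
-- together with an explicit bijection with Fin q.  (Then q = |F| is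
-- automatically a prime power, and every F_q arises this way.)

record FiniteField : Set₁ where
  infixl 7 _*_
  infixl 6 _+_
  field
    Carrier   : Set
    _+_ _*_   : Carrier → Carrier → Carrier
    -_        : Carrier → Carrier
    0# 1#     : Carrier
    isCommutativeRing : IsCommutativeRing _≡_ _+_ _*_ -_ 0# 1#
    0≢1       : ¬ (0# ≡ 1#)
    _⁻¹       : Carrier → Carrier
    inverse   : ∀ x → ¬ (x ≡ 0#) → x * (x ⁻¹) ≡ 1#
    size      : ℕ
    enum      : Fin size ↔ Carrier

module _ (F : FiniteField) where
  open FiniteField F

  sum : ∀ {k} → (Fin k → Carrier) → Carrier
  sum {zero}  f = 0#
  sum {suc k} f = f zero + sum (λ j → f (suc j))

  Matrix : ℕ → ℕ → Set
  Matrix m k = Fin m → Fin k → Carrier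

  InRowSpace : ∀ {m k} → Matrix m k → (Fin k → Carrier) → Set
  InRowSpace {m} A b = Σ (Fin m → Carrier) λ c → (∀ j → b j ≡ sum (λ (i : Fin m) → c i * A i j))

  Balanced : ∀ {m k} → Matrix m k → Set
  Balanced A = ∀ i → sum (A i) ≡ 0#

  ColEquiv : ∀ {m k} → Matrix m k → Fin k → Fin k → Set
  ColEquiv A j j' = ∃[ c ] (¬ (c ≡ 0#) × (∀ i → A i j' ≡ c * A i j))

  SingletonClass : ∀ {m k} → Matrix m k → Fin k → Set
  SingletonClass A j = ∀ j' → ColEquiv A j j' → j' ≡ j

  TypeRC : ∀ {m k} → Matrix m k → Set
  TypeRC A = Balanced A ×
    (∀ j j' → SingletonClass A j → SingletonClass A j' → j ≡ j')

  NonDegenerate : ∀ {m k} → Matrix m k → Set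
  NonDegenerate {m} A =
    (∀ (c : Fin m → Carrier) → (∀ j → sum (λ i → c i * A i j) ≡ 0#) → ∀ i → c i ≡ 0#)
    × (∀ j → ¬ (∀ i → A i j ≡ 0#))

  EquivSystems : ∀ {m m' k} → Matrix m k → Matrix m' k → Set
  EquivSystems A B = (∀ i → InRowSpace A (B i)) × (∀ i → InRowSpace B (A i))

  Splits : ∀ {m' k} → Matrix m' k → Set
  Splits {m'} {k} B = ∃[ r ] Σ (Fin k → Fin r) λ p →
    (2 ℕ.≤ r) × (∀ t → ∃[ j ] p j ≡ t) ×
    (∀ i → ∃[ t ] (∀ j → ¬ (B i j ≡ 0#) → p j ≡ t))

  Reducible : ∀ {m k} → Matrix m k → Set
  Reducible {m} {k} A = ∃[ m' ] Σ (Matrix m' k) λ B → EquivSystems A B × Splits B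

  Irreducible : ∀ {m k} → Matrix m k → Set
  Irreducible A = ¬ Reducible A

  -- cls labels the column equivalence classes bijectively by Fin ℓ;
  -- hence ℓ is the number of column equivalence classes.
  ClassLabelling : ∀ {m k} → Matrix m k → (ℓ : ℕ) → (Fin k → Fin ℓ) → Set
  ClassLabelling {k = k} A ℓ cls =
    (∀ j j' → cls j ≡ cls j' → ColEquiv A j j') ×
    (∀ j j' → ColEquiv A j j' → cls j ≡ cls j') ×
    (∀ t → ∃[ j ] cls j ≡ t)

  ClassSumsToZero : ∀ {m k ℓ} → Matrix m k → (Fin k → Fin ℓ) → Fin ℓ → Set
  ClassSumsToZero A cls t =
    ∀ i → sum (λ j → indicator (cls j) t (A i j)) ≡ 0#
    where
      indicator : ∀ {ℓ} → Fin ℓ → Fin ℓ → Carrier → Carrier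
      indicator zero    zero    a = a
      indicator zero    (suc _) a = 0#
      indicator (suc _) zero    a = 0#
      indicator (suc s) (suc t) a = indicator s t a

  IsSolution : ∀ {m k n} → Matrix m k → (Fin k → Vec Carrier n) → Set
  IsSolution A x = ∀ i t → sum (λ j → A i j * lookup (x j) t) ≡ 0#

  IsGeneric : ∀ {m k n} → Matrix m k → (Fin k → Vec Carrier n) → Set
  IsGeneric A x = ∀ (b : Fin _ → Carrier) → sum b ≡ 0# →
    (∀ t → sum (λ j → b j * lookup (x j) t) ≡ 0#) → InRowSpace A b

  IsGenericSolution : ∀ {m k n} → Matrix m k → (Fin k → Vec Carrier n) → Set
  IsGenericSolution A x = IsSolution A x × IsGeneric A x

_^ℚ_ : ℚ → ℕ → ℚ
x ^ℚ zero  = 1ℚ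
x ^ℚ suc n = x ℚ.* (x ^ℚ n)

toℚ : ℕ → ℚ
toℚ n = (+ n) ℚ./ 1

Temperate : (F : FiniteField) → ∀ {m k} → Matrix F m k → Set
Temperate F {k = k} A =
  ∃[ β ] ∃[ γ ] (0ℚ ℚ.< β) × (0ℚ ℚ.< γ) × (γ ℚ.< toℚ (FiniteField.size F)) ×
    (∀ n (S : List (Vec (FiniteField.Carrier F) n)) → Unique S →
      β ℚ.* (γ ^ℚ n) ℚ.≤ toℚ (length S) →
      ∃[ x ] ((∀ (j : Fin k) → x j ∈ S) × IsGenericSolution F A x))

{-# OPTIONS --safe #-}
module Submission where

-- Write N = q^n. The system satisfies polynomial supersaturation: if |S| ≥ N / D, then the
-- number X of its solutions in S satisfies N^k ≤ D^e N^m X, with e depending only on the system.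
-- A solution that is not generic is killed by some b outside the row space, and each such b
-- kills at most N^(k−m−1) solutions. Hence a generic one exists as soon as D^e q^k < N.
--
-- For c x + c′ y = (c + c′) z, sets without nontrivial solutions in F^r are exponentially small
-- by the slice-rank method; averaging over affine images of F^r with r of order log D
-- (Varnavides) gives supersaturation. For Σ c_j x_j = (Σ c_j) z with Σ c_j ≠ 0 one adds
-- variables one at a time, restricting to the popular z; when the remaining coefficients sum to
-- zero, Cauchy–Schwarz takes the place of the three-term equation.
--
-- After scaling, the columns of class t are multiples c_j v_t of one vector, and the system
-- becomes Σ_t v_t Y_t = 0 in the class values Y_t = Σ_{j ∈ t} c_j x_j. In case (i) the values
-- Y_t = σ_t z, with σ_t = Σ_{j ∈ t} c_j, solve it because it is balanced, and ℓ = m + 1 makes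
-- their number large enough. In case (ii) each Y_t is taken of the form c_t (x_t − x′_t), and
-- Cauchy–Schwarz provides many pairs (x , x′) with Σ_t v_t c_t x_t = Σ_t v_t c_t x′_t.

-- Polynomial dependence on D is the crux. For a set of size about γ^n the parameter D is about
-- (q/γ)^n, exponential in n, so D^e q^k < q^n is reachable only because e is known before γ is
-- chosen close to q; a loss growing faster than every power of D would be fatal. A power is
-- attainable because the slice-rank bound saves a factor exponential in r: a dimension r of order
-- log D suffices, and passing through copies of F^r loses only powers of q^r.
--
-- Supersaturation counts solutions in total, whereas joining equations needs many representations
-- at one and the same point. Popular elements provide this: the unpopular ones cannot be dense, so
-- restricting to popular ones merely squares D.
--
-- A representation Σ c_j x_j = σ y can replace a variable y only if σ ≠ 0. This is why the
-- induction on the coefficients splits on the sum of the tail, and why in case (ii) one column is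
-- detached from every class: the rest then has a nonzero sum.
--
-- The class values solving the reduced system form a space of N^(ℓ-m) elements. The values σ_t z
-- supply N of them, which is the full order exactly when ℓ = m + 1.

open import Defs
open import Data.Nat using (ℕ; zero; suc; _+_; _*_; _∸_; _^_; _≤_; _<_; z≤n; s≤s; NonZero; >-nonZero; >-nonZero⁻¹; _≤?_; pred)
open import Data.Nat.Properties
open import Data.Nat.DivMod using (_/_; _%_; m/n*n≤m; m≡m%n+[m/n]*n; m%n<n)
open import Data.Nat.Tactic.RingSolver using (solve-∀)
open import Data.Integer as ℤ using () renaming (+_ to pos)
import Data.Integer.Properties as ℤ
open import Data.Rational as ℚ using (ℚ)
import Data.Rational.Properties as ℚ
open import Data.Rational.Unnormalised as ℚᵘ using (mkℚᵘ; *≡*; *<*)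
import Data.Rational.Unnormalised.Properties as ℚᵘ
open import Data.Bool using (Bool; T)
open import Data.Bool.Properties using (T?)
open import Data.Empty using (⊥; ⊥-elim)
open import Data.Unit using (⊤; tt)
open import Data.Maybe using (Maybe; just; nothing)
open import Data.Product using (Σ; ∃; _×_; _,_; proj₁; proj₂; uncurry)
open import Data.Sum using (_⊎_; inj₁; inj₂)
open import Data.Fin using (Fin; zero; suc; toℕ; fromℕ<; opposite)
import Data.Fin.Properties as Fin
open import Data.List using (List; []; _∷_; _++_; map; length; cartesianProduct; allFin; filter; tabulate)
open import Data.List.Properties using (length-map; length-tabulate; length-++)
open import Data.List.Membership.Propositional using (_∈_; _∉_; lose)
open import Data.List.Membership.Propositional.Properties
open import Data.List.Relation.Unary.Any as Any using (here; there; any?)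
open import Data.List.Relation.Unary.All as All using (All; []; _∷_)
open import Data.List.Relation.Unary.AllPairs using ([]; _∷_)
open import Data.List.Relation.Unary.Unique.Propositional using (Unique)
import Data.List.Relation.Unary.Unique.Propositional.Properties as Uniq
open import Data.Vec as Vec using (Vec; []; _∷_; lookup)
import Data.Vec.Properties as Vec
open import Data.Vec.Relation.Unary.All as VAll using ([]; _∷_)
import Data.Vec.Relation.Unary.All.Properties as VAllₚ
open import Algebra.Bundles using (CommutativeRing; CommutativeMonoid; RawRing)
open import Algebra.Structures using (IsCommutativeSemiring; IsCommutativeRing)
open import Algebra.Solver.Ring.AlmostCommutativeRing using (fromCommutativeRing; _-Raw-AlmostCommutative⟶_)
import Algebra.Properties.AbelianGroup
import Algebra.Properties.CommutativeSemigroup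
import Algebra.Properties.Ring
import Algebra.Solver.Ring
open import Function using (_∘_; id; it)
open import Function.Bundles using (Inverse)
open import Relation.Binary.Definitions using (DecidableEquality)
open import Relation.Binary.PropositionalEquality
open import Relation.Nullary using (¬_; Dec; yes; no; contradiction)
open import Relation.Nullary.Decidable using (map′; ¬?; _×-dec_; ⌊_⌋; toWitness; fromWitness)

-- Finite sums and counting

record Finite (A : Set) : Set where
  field
    elems    : List A
    complete : ∀ a → a ∈ elems
    unique   : Unique elems

open Finite {{...}} public

instance
  Finite-Fin : ∀ {n} → Finite (Fin n)
  Finite-Fin {n} = record
    { elems = allFin n ; complete = ∈-allFin ; unique = Uniq.allFin⁺ n }

  Finite-× : ∀ {A B} → {{Finite A}} → {{Finite B}} → Finite (A × B)
  Finite-× = record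
    { elems    = cartesianProduct elems elems
    ; complete = λ (a , b) → ∈-cartesianProduct⁺ (complete a) (complete b)
    ; unique   = Uniq.cartesianProduct⁺ unique unique
    }

  Finite-Vec : ∀ {A n} → {{Finite A}} → Finite (Vec A n)
  Finite-Vec {n = zero} = record
    { elems = [] ∷ [] ; complete = λ { [] → here refl } ; unique = [] ∷ [] }
  Finite-Vec {n = suc n} = record
    { elems    = map (uncurry _∷_) elems
    ; complete = λ { (x ∷ xs) → ∈-map⁺ (uncurry _∷_) (complete (x , xs)) }
    ; unique   = Uniq.map⁺ (λ { {_ , _} {_ , _} refl → refl }) unique
    }

∃? : ∀ {A : Set} {{_ : Finite A}} {P : A → Set} → (∀ a → Dec (P a)) → Dec (∃ P)
∃? P? = map′ Any.satisfied (λ (a , pa) → lose (complete a) pa) (any? P? elems)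

∀? : ∀ {A : Set} {{_ : Finite A}} {P : A → Set} → (∀ a → Dec (P a)) → Dec (∀ a → P a)
∀? P? = map′ (λ all a → All.lookup all (complete a)) (λ f → All.universal f elems) (All.all? P? elems)

module Sum {R : Set} {_⊕_ _⊗_ : R → R → R} {0# 1# : R}
  (isCS : IsCommutativeSemiring _≡_ _⊕_ _⊗_ 0# 1#) where

  open IsCommutativeSemiring isCS using () renaming
    ( +-assoc to ⊕-assoc; +-comm to ⊕-comm; +-identityˡ to ⊕-identityˡ; +-identityʳ to ⊕-identityʳ
    ; zeroʳ to ⊗-zeroʳ; distribˡ to ⊗-distribˡ; *-comm to ⊗-comm )

  sumOver : ∀ {A : Set} → List A → (A → R) → R
  sumOver []       f = 0#
  sumOver (x ∷ xs) f = f x ⊕ sumOver xs f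

  opaque
    ∑ : ∀ {A : Set} {{_ : Finite A}} → (A → R) → R
    ∑ = sumOver elems

    ∑-def : ∀ {A : Set} {{_ : Finite A}} (f : A → R) → ∑ f ≡ sumOver elems f
    ∑-def f = refl

  sumOver-cong : ∀ {A : Set} (xs : List A) {f g : A → R} → (∀ x → f x ≡ g x) → sumOver xs f ≡ sumOver xs g
  sumOver-cong []       f≗g = refl
  sumOver-cong (x ∷ xs) f≗g = cong₂ _⊕_ (f≗g x) (sumOver-cong xs f≗g)

  sumOver-0 : ∀ {A : Set} (xs : List A) {f : A → R} → (∀ x → x ∈ xs → f x ≡ 0#) → sumOver xs f ≡ 0#
  sumOver-0 []       f≗0 = refl
  sumOver-0 (x ∷ xs) f≗0 =
    trans (cong₂ _⊕_ (f≗0 x (here refl)) (sumOver-0 xs λ y → f≗0 y ∘ there)) (⊕-identityˡ 0#)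

  interchange : ∀ a b c d → (a ⊕ b) ⊕ (c ⊕ d) ≡ (a ⊕ c) ⊕ (b ⊕ d)
  interchange a b c d = begin
    (a ⊕ b) ⊕ (c ⊕ d)  ≡⟨ ⊕-assoc a b _ ⟩
    a ⊕ (b ⊕ (c ⊕ d))  ≡⟨ cong (a ⊕_) (sym (⊕-assoc b c d)) ⟩
    a ⊕ ((b ⊕ c) ⊕ d)  ≡⟨ cong (λ e → a ⊕ (e ⊕ d)) (⊕-comm b c) ⟩
    a ⊕ ((c ⊕ b) ⊕ d)  ≡⟨ cong (a ⊕_) (⊕-assoc c b d) ⟩
    a ⊕ (c ⊕ (b ⊕ d))  ≡⟨ ⊕-assoc a c _ ⟨
    (a ⊕ c) ⊕ (b ⊕ d)  ∎
    where open ≡-Reasoning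

  sumOver-⊕ : ∀ {A : Set} (xs : List A) (f g : A → R) → sumOver xs (λ x → f x ⊕ g x) ≡ sumOver xs f ⊕ sumOver xs g
  sumOver-⊕ []       f g = sym (⊕-identityˡ 0#)
  sumOver-⊕ (x ∷ xs) f g =
    trans (cong ((f x ⊕ g x) ⊕_) (sumOver-⊕ xs f g)) (interchange (f x) (g x) _ _)

  sumOver-*ˡ : ∀ {A : Set} (xs : List A) c (f : A → R) → sumOver xs (λ x → c ⊗ f x) ≡ c ⊗ sumOver xs f
  sumOver-*ˡ []       c f = sym (⊗-zeroʳ c)
  sumOver-*ˡ (x ∷ xs) c f = trans (cong ((c ⊗ f x) ⊕_) (sumOver-*ˡ xs c f)) (sym (⊗-distribˡ c _ _))

  sumOver-*ʳ : ∀ {A : Set} (xs : List A) c (f : A → R) → sumOver xs (λ x → f x ⊗ c) ≡ sumOver xs f ⊗ c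
  sumOver-*ʳ xs c f = trans (sumOver-cong xs λ x → ⊗-comm (f x) c)
    (trans (sumOver-*ˡ xs c f) (⊗-comm c _))

  sumOver-swap : ∀ {A B : Set} (xs : List A) (ys : List B) (f : A → B → R) →
    sumOver xs (λ x → sumOver ys (f x)) ≡ sumOver ys (λ y → sumOver xs (λ x → f x y))
  sumOver-swap []       ys f = sym (sumOver-0 ys λ _ _ → refl)
  sumOver-swap (x ∷ xs) ys f =
    trans (cong (sumOver ys (f x) ⊕_) (sumOver-swap xs ys f)) (sym (sumOver-⊕ ys (f x) _))

  sumOver-++ : ∀ {A : Set} (xs ys : List A) (f : A → R) → sumOver (xs ++ ys) f ≡ sumOver xs f ⊕ sumOver ys f
  sumOver-++ []       ys f = sym (⊕-identityˡ _)
  sumOver-++ (x ∷ xs) ys f = trans (cong (f x ⊕_) (sumOver-++ xs ys f)) (sym (⊕-assoc (f x) _ _))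

  sumOver-map : ∀ {A B : Set} (xs : List A) (g : A → B) (f : B → R) → sumOver (map g xs) f ≡ sumOver xs (f ∘ g)
  sumOver-map []       g f = refl
  sumOver-map (x ∷ xs) g f = cong (f (g x) ⊕_) (sumOver-map xs g f)

  sumOver-× : ∀ {A B : Set} (xs : List A) (ys : List B) (f : A × B → R) →
    sumOver (cartesianProduct xs ys) f ≡ sumOver xs (λ x → sumOver ys (λ y → f (x , y)))
  sumOver-× []       ys f = refl
  sumOver-× (x ∷ xs) ys f = trans (sumOver-++ (map (x ,_) ys) _ f)
    (cong₂ _⊕_ (sumOver-map ys (x ,_) f) (sumOver-× xs ys f))

  sumOver-single : ∀ {A : Set} {xs : List A} {a} {f : A → R} → Unique xs → a ∈ xs →
    (∀ x → x ≢ a → f x ≡ 0#) → sumOver xs f ≡ f a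
  sumOver-single {xs = _ ∷ xs} {f = f} (x∉ ∷ u) (here refl) z =
    trans (cong (f _ ⊕_) (sumOver-0 xs λ y y∈ → z y λ { refl → All.lookup x∉ y∈ refl })) (⊕-identityʳ _)
  sumOver-single {f = f} (x∉ ∷ u) (there a∈) z =
    trans (cong₂ _⊕_ (z _ λ { refl → All.lookup x∉ a∈ refl }) (sumOver-single u a∈ z)) (⊕-identityˡ _)

  opaque
    unfolding ∑

    ∑-cong : ∀ {A : Set} {{_ : Finite A}} {f g : A → R} → (∀ x → f x ≡ g x) → ∑ f ≡ ∑ g
    ∑-cong = sumOver-cong elems

    ∑-⊕ : ∀ {A : Set} {{_ : Finite A}} (f g : A → R) → ∑ (λ x → f x ⊕ g x) ≡ ∑ f ⊕ ∑ g
    ∑-⊕ = sumOver-⊕ elems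

    ∑-*ˡ : ∀ {A : Set} {{_ : Finite A}} c (f : A → R) → ∑ (λ x → c ⊗ f x) ≡ c ⊗ ∑ f
    ∑-*ˡ = sumOver-*ˡ elems

    ∑-*ʳ : ∀ {A : Set} {{_ : Finite A}} c (f : A → R) → ∑ (λ x → f x ⊗ c) ≡ ∑ f ⊗ c
    ∑-*ʳ = sumOver-*ʳ elems

    ∑-swap : ∀ {A B : Set} {{_ : Finite A}} {{_ : Finite B}} (f : A → B → R) →
      ∑ (λ x → ∑ (f x)) ≡ ∑ (λ y → ∑ (λ x → f x y))
    ∑-swap = sumOver-swap elems elems

    ∑-× : ∀ {A B : Set} {{_ : Finite A}} {{_ : Finite B}} (f : A × B → R) →
      ∑ f ≡ ∑ (λ x → ∑ (λ y → f (x , y)))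
    ∑-× = sumOver-× elems elems

    ∑-∷ : ∀ {A : Set} {n} {{_ : Finite A}} (f : Vec A (suc n) → R) →
      ∑ f ≡ ∑ (λ x → ∑ (λ xs → f (x ∷ xs)))
    ∑-∷ f = trans (sumOver-map elems (uncurry _∷_) f) (sumOver-× elems elems (f ∘ uncurry _∷_))

    ∑-[] : ∀ {A : Set} {{_ : Finite A}} (f : Vec A 0 → R) → ∑ f ≡ f []
    ∑-[] f = ⊕-identityʳ (f [])

    ∑-single : ∀ {A : Set} {{_ : Finite A}} (a : A) {f : A → R} → (∀ x → x ≢ a → f x ≡ 0#) → ∑ f ≡ f a
    ∑-single a = sumOver-single unique (complete a)

  opaque
    ∏ : ∀ {n} → (Fin n → R) → R
    ∏ {zero}  f = 1#
    ∏ {suc n} f = f zero ⊗ ∏ (f ∘ suc)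

    ∏-cong : ∀ {n} {f g : Fin n → R} → (∀ i → f i ≡ g i) → ∏ f ≡ ∏ g
    ∏-cong {zero}  f≗g = refl
    ∏-cong {suc n} f≗g = cong₂ _⊗_ (f≗g zero) (∏-cong (f≗g ∘ suc))

    ∏-zero : (f : Fin 0 → R) → ∏ f ≡ 1#
    ∏-zero f = refl

    ∏-suc : ∀ {n} (f : Fin (suc n) → R) → ∏ f ≡ f zero ⊗ ∏ (f ∘ suc)
    ∏-suc f = refl

  -- Distributivity, used in two ways: it counts the points of a box as a product of side counts,
  -- and it factors a weighted count of exponent vectors over the coordinates.
  ∏-∑ : ∀ {A : Set} {n} {{_ : Finite A}} (f : Fin n → A → R) →
    ∑ (λ (x : Vec A n) → ∏ (λ t → f t (lookup x t))) ≡ ∏ (λ t → ∑ (f t))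
  ∏-∑ {n = zero}  f = trans (∑-[] _) (trans (∏-zero _) (sym (∏-zero _)))
  ∏-∑ {n = suc n} f = begin
    ∑ (λ x → ∏ (λ t → f t (lookup x t)))  ≡⟨ trans (∑-∷ _) (∑-cong λ a → ∑-cong λ x → ∏-suc _) ⟩
    ∑ (λ a → ∑ (λ x → f zero a ⊗ ∏ (λ t → f (suc t) (lookup x t))))  ≡⟨ ∑-cong (λ a → ∑-*ˡ (f zero a) _) ⟩
    ∑ (λ a → f zero a ⊗ ∑ (λ x → ∏ (λ t → f (suc t) (lookup x t))))  ≡⟨ ∑-*ʳ _ (f zero) ⟩
    ∑ (f zero) ⊗ ∑ (λ x → ∏ (λ t → f (suc t) (lookup x t)))  ≡⟨ cong (∑ (f zero) ⊗_) (∏-∑ (f ∘ suc)) ⟩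
    ∑ (f zero) ⊗ ∏ (λ t → ∑ (f (suc t)))  ≡⟨ ∏-suc _ ⟨
    ∏ (λ t → ∑ (f t))  ∎
    where open ≡-Reasoning

open Sum +-*-isCommutativeSemiring public
  renaming (∑-⊕ to ∑-+)

sumOver-mono : ∀ {A : Set} (xs : List A) {f g : A → ℕ} → (∀ x → f x ≤ g x) → sumOver xs f ≤ sumOver xs g
sumOver-mono []       f≤g = z≤n
sumOver-mono (x ∷ xs) f≤g = +-mono-≤ (f≤g x) (sumOver-mono xs f≤g)

opaque
  unfolding ∑

  ∑-mono : ∀ {A : Set} {{_ : Finite A}} {f g : A → ℕ} → (∀ x → f x ≤ g x) → ∑ f ≤ ∑ g
  ∑-mono = sumOver-mono elems

-- Only the first list has to be free of repetitions: each of its elements is matched with one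
-- occurrence in `ys`, which is then removed. Injective reindexing and the pigeonhole arguments
-- reduce to this.
sumOver-⊆ : ∀ {A : Set} {xs ys : List A} (f : A → ℕ) → Unique xs → (∀ {x} → x ∈ xs → x ∈ ys) →
  sumOver xs f ≤ sumOver ys f
sumOver-⊆ {xs = []} f u s = z≤n
sumOver-⊆ {xs = x ∷ xs} {ys} f (x∉ ∷ u) s with ∈-∃++ (s (here refl))
... | us , vs , refl = begin
  f x + sumOver xs f  ≤⟨ +-monoʳ-≤ (f x) (sumOver-⊆ f u s′) ⟩
  f x + sumOver (us ++ vs) f  ≡⟨ cong (f x +_) (sumOver-++ us vs f) ⟩
  f x + (sumOver us f + sumOver vs f) ≡⟨ +-assoc (f x) _ _ ⟨
  f x + sumOver us f + sumOver vs f ≡⟨ cong (_+ sumOver vs f) (+-comm (f x) _) ⟩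
  sumOver us f + f x + sumOver vs f ≡⟨ +-assoc (sumOver us f) _ _ ⟩
  sumOver us f + (f x + sumOver vs f) ≡⟨ sumOver-++ us (x ∷ vs) f ⟨
  sumOver (us ++ x ∷ vs) f  ∎
  where
  open ≤-Reasoning
  s′ : ∀ {y} → y ∈ xs → y ∈ us ++ vs
  s′ y∈ with ∈-++⁻ us (s (there y∈))
  ... | inj₁ p           = ∈-++⁺ˡ p
  ... | inj₂ (here refl) = contradiction refl (All.lookup x∉ y∈)
  ... | inj₂ (there p)   = ∈-++⁺ʳ us p

∑-injective : ∀ {A B : Set} {{_ : Finite A}} {{_ : Finite B}} (h : A → B) → (∀ {x y} → h x ≡ h y → x ≡ y) →
  (g : B → ℕ) → ∑ (g ∘ h) ≤ ∑ g
∑-injective h inj g = begin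
  ∑ (g ∘ h)  ≡⟨ ∑-def _ ⟩
  sumOver elems (g ∘ h)  ≡⟨ sumOver-map elems h g ⟨
  sumOver (map h elems) g  ≤⟨ sumOver-⊆ g (Uniq.map⁺ inj unique) (λ _ → complete _) ⟩
  sumOver elems g  ≡⟨ ∑-def g ⟨
  ∑ g  ∎
  where open ≤-Reasoning

∑-≥ : ∀ {A : Set} {{_ : Finite A}} (a : A) (f : A → ℕ) → f a ≤ ∑ f
∑-≥ a f = begin
  f a  ≡⟨ +-identityʳ _ ⟨
  sumOver (a ∷ []) f  ≤⟨ sumOver-⊆ f ([] ∷ []) (λ _ → complete _) ⟩
  sumOver elems f  ≡⟨ ∑-def f ⟨
  ∑ f  ∎
  where open ≤-Reasoning

opaque
  unfolding ∑ ∏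

  ∣_∣ : (A : Set) {{_ : Finite A}} → ℕ
  ∣ A ∣ = length (elems {A})

  ∣∣-def : (A : Set) {{_ : Finite A}} → ∣ A ∣ ≡ length (elems {A})
  ∣∣-def A = refl

  ∑-const : ∀ {A : Set} {{_ : Finite A}} c → ∑ (λ (_ : A) → c) ≡ ∣ A ∣ * c
  ∑-const {A} c = go elems
    where
    go : ∀ xs → sumOver {A} xs (λ _ → c) ≡ length xs * c
    go []       = refl
    go (x ∷ xs) = cong (c +_) (go xs)

  ∏-mono : ∀ {n} {f g : Fin n → ℕ} → (∀ i → f i ≤ g i) → ∏ f ≤ ∏ g
  ∏-mono {zero}  f≤g = ≤-refl
  ∏-mono {suc n} f≤g = *-mono-≤ (f≤g zero) (∏-mono (f≤g ∘ suc))

  ∏-const : ∀ {n} c → ∏ {n} (λ _ → c) ≡ c ^ n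
  ∏-const {zero}  c = refl
  ∏-const {suc n} c = cong (c *_) (∏-const {n} c)

  ∏-* : ∀ {n} (f g : Fin n → ℕ) → ∏ (λ i → f i * g i) ≡ ∏ f * ∏ g
  ∏-* {zero}  f g = refl
  ∏-* {suc n} f g = trans (cong (f zero * g zero *_) (∏-* (f ∘ suc) (g ∘ suc)))
    ([m*n]*[o*p]≡[m*o]*[n*p] (f zero) (g zero) _ _)

∣Vec∣ : ∀ {A n} {{_ : Finite A}} → ∣ Vec A n ∣ ≡ ∣ A ∣ ^ n
∣Vec∣ {A} {n} = begin
  ∣ Vec A n ∣  ≡⟨ *-identityʳ _ ⟨
  ∣ Vec A n ∣ * 1  ≡⟨ ∑-const 1 ⟨
  ∑ (λ (_ : Vec A n) → 1)  ≡⟨ ∑-cong (λ _ → trans (∏-const 1) (^-zeroˡ n)) ⟨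
  ∑ (λ (x : Vec A n) → ∏ {n} (λ _ → 1))  ≡⟨ ∏-∑ (λ _ _ → 1) ⟩
  ∏ {n} (λ _ → ∑ (λ (_ : A) → 1))  ≡⟨ ∏-const _ ⟩
  ∑ (λ (_ : A) → 1) ^ n  ≡⟨ cong (_^ n) (trans (∑-const 1) (*-identityʳ _)) ⟩
  ∣ A ∣ ^ n  ∎
  where open ≡-Reasoning

-- Indicators, subsets and collision counts

𝟙 : ∀ {P : Set} → Dec P → ℕ
𝟙 (yes _) = 1
𝟙 (no  _) = 0

𝟙-yes : ∀ {P : Set} (P? : Dec P) → P → 𝟙 P? ≡ 1
𝟙-yes (yes _) p = refl
𝟙-yes (no ¬p) p = contradiction p ¬p

𝟙-no : ∀ {P : Set} (P? : Dec P) → ¬ P → 𝟙 P? ≡ 0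
𝟙-no (yes p) ¬p = contradiction p ¬p
𝟙-no (no _)  ¬p = refl

𝟙≤1 : ∀ {P : Set} (P? : Dec P) → 𝟙 P? ≤ 1
𝟙≤1 (yes _) = ≤-refl
𝟙≤1 (no _)  = z≤n

𝟙*≤ : ∀ {P : Set} (P? : Dec P) {m n} → (P → m ≤ n) → 𝟙 P? * m ≤ n
𝟙*≤ (yes p) {m} h = ≤-trans (≤-reflexive (*-identityˡ m)) (h p)
𝟙*≤ (no _)  h = z≤n

𝟙-mono : ∀ {P Q : Set} (P? : Dec P) (Q? : Dec Q) → (P → Q) → 𝟙 P? ≤ 𝟙 Q?
𝟙-mono (yes p) Q? f = ≤-reflexive (sym (𝟙-yes Q? (f p)))
𝟙-mono (no _)  Q? f = z≤n

𝟙-*-mono : ∀ {P Q : Set} (P? : Dec P) (Q? : Dec Q) {m n} → (P → Q) → (P → m ≤ n) → 𝟙 P? * m ≤ 𝟙 Q? * n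
𝟙-*-mono (yes p) Q? {m} {n} f h rewrite 𝟙-yes Q? (f p) = +-monoˡ-≤ 0 (h p)
𝟙-*-mono (no _)  Q? f h = z≤n

𝟙-cong : ∀ {P Q : Set} (P? : Dec P) (Q? : Dec Q) → (P → Q) → (Q → P) → 𝟙 P? ≡ 𝟙 Q?
𝟙-cong P? Q? f g = ≤-antisym (𝟙-mono P? Q? f) (𝟙-mono Q? P? g)

𝟙-× : ∀ {P Q : Set} (P? : Dec P) (Q? : Dec Q) → 𝟙 P? * 𝟙 Q? ≡ 𝟙 (P? ×-dec Q?)
𝟙-× (yes _) (yes _) = refl
𝟙-× (yes _) (no _)  = refl
𝟙-× (no _)  Q?      = refl

Subset : Set → Set
Subset A = A → Bool

_∈?_ : ∀ {A : Set} (a : A) (S : Subset A) → Dec (T (S a))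
a ∈? S = T? (S a)

# : ∀ {A : Set} {{_ : Finite A}} → Subset A → ℕ
# S = ∑ λ a → 𝟙 (a ∈? S)

#≤ : ∀ {A : Set} {{_ : Finite A}} (S : Subset A) → # S ≤ ∣ A ∣
#≤ {A} S = ≤-trans (∑-mono λ a → 𝟙≤1 (a ∈? S)) (≤-reflexive (trans (∑-const 1) (*-identityʳ _)))

2mn≤m²+n² : ∀ a b → 2 * (a * b) ≤ a * a + b * b
2mn≤m²+n² a b with ≤-total a b
... | inj₁ a≤b = subst (λ b → 2 * (a * b) ≤ a * a + b * b) (m+[n∸m]≡n a≤b) (lem a (b ∸ a))
  where
  lem : ∀ a d → 2 * (a * (a + d)) ≤ a * a + (a + d) * (a + d)
  lem a d = ≤-trans (m≤m+n _ (d * d)) (≤-reflexive (eq a d))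
    where
    eq : ∀ a d → 2 * (a * (a + d)) + d * d ≡ a * a + (a + d) * (a + d)
    eq = solve-∀
... | inj₂ b≤a = subst (λ a → 2 * (a * b) ≤ a * a + b * b) (m+[n∸m]≡n b≤a) (lem b (a ∸ b))
  where
  lem : ∀ a d → 2 * ((a + d) * a) ≤ (a + d) * (a + d) + a * a
  lem a d = ≤-trans (m≤m+n _ (d * d)) (≤-reflexive (eq a d))
    where
    eq : ∀ a d → 2 * ((a + d) * a) + d * d ≡ (a + d) * (a + d) + a * a
    eq = solve-∀

-- After doubling, this is the sum of `2mn≤m²+n²` over all pairs (b , c), so the argument stays
-- inside ℕ.
Cauchy-Schwarz : ∀ {B : Set} {{_ : Finite B}} (g : B → ℕ) → ∑ g * ∑ g ≤ ∣ B ∣ * ∑ λ b → g b * g b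
Cauchy-Schwarz {B} g = *-cancelˡ-≤ 2 (begin
  2 * (∑ g * ∑ g)  ≡⟨ cong (2 *_) (trans (sym (∑-*ʳ (∑ g) g)) (∑-cong λ b → sym (∑-*ˡ (g b) g))) ⟩
  2 * ∑ (λ b → ∑ (λ c → g b * g c))  ≡⟨ trans (sym (∑-*ˡ 2 _)) (∑-cong λ b → sym (∑-*ˡ 2 _)) ⟩
  ∑ (λ b → ∑ (λ c → 2 * (g b * g c)))  ≤⟨ ∑-mono (λ b → ∑-mono λ c → 2mn≤m²+n² (g b) (g c)) ⟩
  ∑ (λ b → ∑ (λ c → g b * g b + g c * g c))  ≡⟨ ∑-cong (λ b → trans (∑-+ (λ _ → g b * g b) _) (cong (_+ ∑ (λ c → g c * g c)) (∑-const _))) ⟩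
  ∑ (λ b → ∣ B ∣ * (g b * g b) + ∑ (λ c → g c * g c))  ≡⟨ ∑-+ (λ b → ∣ B ∣ * (g b * g b)) _ ⟩
  ∑ (λ b → ∣ B ∣ * (g b * g b)) + ∑ (λ (_ : B) → ∑ (λ c → g c * g c)) ≡⟨ cong₂ _+_ (∑-*ˡ ∣ B ∣ _) (∑-const _) ⟩
  X + X  ≡⟨ cong (X +_) (+-identityʳ X) ⟨
  2 * (∣ B ∣ * ∑ (λ b → g b * g b))  ∎)
  where
  open ≤-Reasoning
  X = ∣ B ∣ * ∑ (λ b → g b * g b)

∑-pick : ∀ {A : Set} {{_ : Finite A}} (_≟_ : (a b : A) → Dec (a ≡ b)) (a : A) (f : A → ℕ) →
  ∑ (λ b → 𝟙 (a ≟ b) * f b) ≡ f a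
∑-pick _≟_ a f = trans (∑-single a λ b b≢a → cong (_* f b) (𝟙-no (a ≟ b) (b≢a ∘ sym)))
  (trans (cong (_* f a) (𝟙-yes (a ≟ a) refl)) (*-identityˡ _))

-- Cauchy-Schwarz applied to the fibre sums `g b` of f over h a = b; expanding the squares of the
-- fibre sums produces the pairs with equal image.
collisions : ∀ {A B : Set} {{_ : Finite A}} {{_ : Finite B}} (_≟_ : (b c : B) → Dec (b ≡ c)) (h : A → B) (f : A → ℕ) →
  ∑ f * ∑ f ≤ ∣ B ∣ * ∑ λ a → ∑ λ a′ → f a * (f a′ * 𝟙 (h a ≟ h a′))
collisions {A} {B} _≟_ h f = begin
  ∑ f * ∑ f  ≡⟨ cong₂ _*_ ∑f ∑f ⟩
  ∑ g * ∑ g  ≤⟨ Cauchy-Schwarz g ⟩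
  ∣ B ∣ * ∑ (λ b → g b * g b)  ≡⟨ cong (∣ B ∣ *_) expand ⟩
  ∣ B ∣ * ∑ (λ a → ∑ λ a′ → f a * (f a′ * 𝟙 (h a ≟ h a′))) ∎
  where
  open ≤-Reasoning
  g : B → ℕ
  g b = ∑ λ a → f a * 𝟙 (h a ≟ b)
  ∑f : ∑ f ≡ ∑ g
  ∑f = begin-equality
    ∑ f  ≡⟨ ∑-cong (λ a → ∑-pick _≟_ (h a) (λ _ → f a)) ⟨
    ∑ (λ a → ∑ λ b → 𝟙 (h a ≟ b) * f a)  ≡⟨ ∑-swap _ ⟩
    ∑ (λ b → ∑ λ a → 𝟙 (h a ≟ b) * f a)  ≡⟨ ∑-cong (λ b → ∑-cong λ a → *-comm (𝟙 (h a ≟ b)) (f a)) ⟩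
    ∑ g  ∎
  expand : ∑ (λ b → g b * g b) ≡ ∑ λ a → ∑ λ a′ → f a * (f a′ * 𝟙 (h a ≟ h a′))
  expand = begin-equality
    ∑ (λ b → g b * g b)  ≡⟨ ∑-cong (λ b → ∑-*ʳ (g b) _) ⟨
    ∑ (λ b → ∑ λ a → f a * 𝟙 (h a ≟ b) * g b)  ≡⟨ ∑-swap (λ b a → f a * 𝟙 (h a ≟ b) * g b) ⟩
    ∑ (λ a → ∑ λ b → f a * 𝟙 (h a ≟ b) * g b)  ≡⟨ ∑-cong (λ a → trans (∑-cong λ b → *-assoc (f a) _ _)
                    (trans (∑-*ˡ (f a) _) (cong (f a *_) (∑-pick _≟_ (h a) g)))) ⟩
    ∑ (λ a → f a * g (h a))  ≡⟨ ∑-cong (λ a → ∑-*ˡ (f a) _) ⟨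
    ∑ (λ a → ∑ λ a′ → f a * (f a′ * 𝟙 (h a′ ≟ h a)))  ≡⟨ ∑-cong (λ a → ∑-cong λ a′ → cong (λ e → f a * (f a′ * e)) (𝟙-cong (h a′ ≟ h a) (h a ≟ h a′) sym sym)) ⟩
    ∑ (λ a → ∑ λ a′ → f a * (f a′ * 𝟙 (h a ≟ h a′)))  ∎

-- Rational bounds

fraction-< : ∀ {a b c d} → a * suc d < c * suc b → (pos a) ℚ./ suc b ℚ.< (pos c) ℚ./ suc d
fraction-< {a} {b} {c} {d} lt = ℚ.toℚᵘ-cancel-< (ℚᵘ.<-respˡ-≃ (ℚᵘ.≃-sym (ℚ.toℚᵘ-fromℚᵘ (mkℚᵘ (pos a) b)))
  (ℚᵘ.<-respʳ-≃ (ℚᵘ.≃-sym (ℚ.toℚᵘ-fromℚᵘ (mkℚᵘ (pos c) d))) (*<* (subst₂ ℤ._<_ (ℤ.pos-* a (suc d)) (ℤ.pos-* c (suc b)) (ℤ.+<+ lt)))))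

toℚ-cancel-≤ : ∀ {a b} → toℚ a ℚ.≤ toℚ b → a ≤ b
toℚ-cancel-≤ {a} {b} le with a ≤? b
... | yes a≤b = a≤b
... | no a≰b = contradiction (ℚ.<-≤-trans (fraction-< {b} {0} {a} {0} (*-monoˡ-< 1 (≰⇒> a≰b))) le) (ℚ.<-irrefl refl)

fraction-*-toℚ : ∀ a b c d → a * c ≡ d * suc b → ((pos a) ℚ./ suc b) ℚ.* toℚ c ≡ toℚ d
fraction-*-toℚ a b c d eq = ℚ.toℚᵘ-injective (begin
  ℚ.toℚᵘ (((pos a) ℚ./ suc b) ℚ.* toℚ c)  ≈⟨ ℚ.toℚᵘ-homo-* ((pos a) ℚ./ suc b) (toℚ c) ⟩
  ℚ.toℚᵘ ((pos a) ℚ./ suc b) ℚᵘ.* ℚ.toℚᵘ (toℚ c)  ≈⟨ ℚᵘ.*-cong (ℚ.toℚᵘ-fromℚᵘ (mkℚᵘ (pos a) b)) (ℚ.toℚᵘ-fromℚᵘ (mkℚᵘ (pos c) 0)) ⟩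
  mkℚᵘ (pos a) b ℚᵘ.* mkℚᵘ (pos c) 0  ≈⟨ *≡* integers ⟩
  mkℚᵘ (pos d) 0  ≈⟨ ℚ.toℚᵘ-fromℚᵘ (mkℚᵘ (pos d) 0) ⟨
  ℚ.toℚᵘ (toℚ d)  ∎)
  where
  open import Relation.Binary.Reasoning.Setoid ℚᵘ.≃-setoid
  integers : (pos a ℤ.* pos c) ℤ.* pos 1 ≡ pos d ℤ.* pos (suc b * 1)
  integers = trans (ℤ.*-identityʳ _) (trans (sym (ℤ.pos-* a c)) (trans (cong pos eq)
    (trans (ℤ.pos-* d (suc b)) (cong (λ e → pos d ℤ.* (pos e)) (sym (*-identityʳ (suc b)))))))

toℚ-* : ∀ a b → toℚ a ℚ.* toℚ b ≡ toℚ (a * b)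
toℚ-* a b = fraction-*-toℚ a 0 b (a * b) (sym (*-identityʳ _))

fraction-^ : ∀ a b n → (((pos a) ℚ./ suc b) ^ℚ n) ℚ.* toℚ (suc b ^ n) ≡ toℚ (a ^ n)
fraction-^ a b zero = ℚ.*-identityˡ (toℚ 1)
fraction-^ a b (suc n) = begin
  (γ ℚ.* (γ ^ℚ n)) ℚ.* toℚ (suc b * suc b ^ n)  ≡⟨ cong ((γ ℚ.* (γ ^ℚ n)) ℚ.*_) (toℚ-* (suc b) (suc b ^ n)) ⟨
  (γ ℚ.* (γ ^ℚ n)) ℚ.* (toℚ (suc b) ℚ.* toℚ (suc b ^ n))  ≡⟨ ℚ-interchange γ (γ ^ℚ n) (toℚ (suc b)) (toℚ (suc b ^ n)) ⟩
  (γ ℚ.* toℚ (suc b)) ℚ.* ((γ ^ℚ n) ℚ.* toℚ (suc b ^ n))  ≡⟨ cong₂ ℚ._*_ (fraction-*-toℚ a b (suc b) a refl) (fraction-^ a b n) ⟩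
  toℚ a ℚ.* toℚ (a ^ n)  ≡⟨ toℚ-* a (a ^ n) ⟩
  toℚ (a * a ^ n)  ∎
  where
  open ≡-Reasoning
  open import Algebra.Properties.CommutativeSemigroup (CommutativeMonoid.commutativeSemigroup ℚ.*-1-commutativeMonoid) using () renaming (interchange to ℚ-interchange)
  γ = (pos a) ℚ./ suc b

-- With γ = a / (b + 1) this turns the density hypothesis of temperance into an inequality of
-- naturals, so that the counting can take place in ℕ.
clear-denominators : ∀ B a b n L → toℚ B ℚ.* (((pos a) ℚ./ suc b) ^ℚ n) ℚ.≤ toℚ L → B * a ^ n ≤ L * suc b ^ n
clear-denominators B a b n L le = toℚ-cancel-≤ (subst₂ ℚ._≤_
  (trans (ℚ.*-assoc (toℚ B) _ _) (trans (cong (toℚ B ℚ.*_) (fraction-^ a b n)) (toℚ-* B (a ^ n))))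
  (toℚ-* L (suc b ^ n))
  (ℚ.*-monoʳ-≤-nonNeg (toℚ (suc b ^ n)) {{ℚ.normalize-nonNeg (suc b ^ n) 1}} le))

-- The field

module OverField (F : FiniteField) where

  open FiniteField F public
    renaming (Carrier to 𝔽; _+_ to _+ᶠ_; _*_ to _*ᶠ_; -_ to -ᶠ_; size to q; 0≢1 to 0ᶠ≢1ᶠ)

  open IsCommutativeRing isCommutativeRing public using () renaming
    ( +-assoc to +ᶠ-assoc; +-comm to +ᶠ-comm; +-identityˡ to +ᶠ-identityˡ; +-identityʳ to +ᶠ-identityʳ
    ; -‿inverseˡ to +ᶠ-inverseˡ; -‿inverseʳ to +ᶠ-inverseʳ
    ; *-assoc to *ᶠ-assoc; *-comm to *ᶠ-comm; *-identityˡ to *ᶠ-identityˡ; *-identityʳ to *ᶠ-identityʳ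
    ; zeroˡ to *ᶠ-zeroˡ; zeroʳ to *ᶠ-zeroʳ; distribˡ to *ᶠ-distribˡ; distribʳ to *ᶠ-distribʳ
    ; isCommutativeSemiring to 𝔽-isCommutativeSemiring )

  𝔽-commutativeRing : CommutativeRing _ _
  𝔽-commutativeRing = record { isCommutativeRing = isCommutativeRing }

  open Algebra.Properties.Ring (CommutativeRing.ring 𝔽-commutativeRing)
    using (-‿distribˡ-*; -‿distribʳ-*; -0#≈0#; -‿involutive)
  open Algebra.Properties.AbelianGroup (CommutativeRing.+-abelianGroup 𝔽-commutativeRing)
    using () renaming (⁻¹-∙-comm to -‿+-comm)

  open Sum 𝔽-isCommutativeSemiring public using () renaming
    ( interchange to +ᶠ-interchange; ∑ to ∑ᶠ; ∑-cong to ∑ᶠ-cong; ∑-⊕ to ∑ᶠ-+; ∑-*ˡ to ∑ᶠ-*ˡ; ∑-*ʳ to ∑ᶠ-*ʳ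
    ; ∑-× to ∑ᶠ-×; ∑-single to ∑ᶠ-single )

  *ᶠ-0ˡ : ∀ {a b} → a ≡ 0# → a *ᶠ b ≡ 0#
  *ᶠ-0ˡ {b = b} refl = *ᶠ-zeroˡ b

  *ᶠ-0ʳ : ∀ {a b} → b ≡ 0# → a *ᶠ b ≡ 0#
  *ᶠ-0ʳ {a} refl = *ᶠ-zeroʳ a

  -- Coefficients for the ring solver: (a , b) stands for the integer a − b.
  module IntegerCoefficients where

    -- The separate clause for 1 here, and the one for b = 0 in `diff`, make the solver constants
    -- `:0` and `:1` evaluate to `0#` and `1#` by computation, so that solved equations match the
    -- goals literally.
    nat : ℕ → 𝔽
    nat zero          = 0#
    nat (suc zero)    = 1#
    nat (suc (suc n)) = 1# +ᶠ nat (suc n)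

    nat-suc : ∀ n → nat (suc n) ≡ 1# +ᶠ nat n
    nat-suc zero    = sym (+ᶠ-identityʳ 1#)
    nat-suc (suc n) = refl

    nat-+ : ∀ m n → nat (m + n) ≡ nat m +ᶠ nat n
    nat-+ zero    n = sym (+ᶠ-identityˡ _)
    nat-+ (suc m) n = begin
      nat (suc (m + n))  ≡⟨ nat-suc (m + n) ⟩
      1# +ᶠ nat (m + n)  ≡⟨ cong (1# +ᶠ_) (nat-+ m n) ⟩
      1# +ᶠ (nat m +ᶠ nat n)  ≡⟨ +ᶠ-assoc 1# _ _ ⟨
      (1# +ᶠ nat m) +ᶠ nat n  ≡⟨ cong (_+ᶠ nat n) (nat-suc m) ⟨
      nat (suc m) +ᶠ nat n  ∎
      where open ≡-Reasoning

    nat-* : ∀ m n → nat (m * n) ≡ nat m *ᶠ nat n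
    nat-* zero    n = sym (*ᶠ-zeroˡ _)
    nat-* (suc m) n = begin
      nat (n + m * n)  ≡⟨ nat-+ n (m * n) ⟩
      nat n +ᶠ nat (m * n)  ≡⟨ cong₂ _+ᶠ_ (sym (*ᶠ-identityˡ _)) (nat-* m n) ⟩
      1# *ᶠ nat n +ᶠ nat m *ᶠ nat n  ≡⟨ *ᶠ-distribʳ (nat n) 1# (nat m) ⟨
      (1# +ᶠ nat m) *ᶠ nat n  ≡⟨ cong (_*ᶠ nat n) (nat-suc m) ⟨
      nat (suc m) *ᶠ nat n  ∎
      where open ≡-Reasoning

    diff : ℕ × ℕ → 𝔽
    diff (a , zero)  = nat a
    diff (a , suc b) = nat a +ᶠ -ᶠ nat (suc b)

    diff-def : ∀ a b → diff (a , b) ≡ nat a +ᶠ -ᶠ nat b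
    diff-def a zero    = sym (trans (cong (nat a +ᶠ_) -0#≈0#) (+ᶠ-identityʳ _))
    diff-def a (suc b) = refl

    coefficients : RawRing _ _
    coefficients = record
      { Carrier = ℕ × ℕ
      ; _≈_ = _≡_
      ; _+_ = λ (a , b) (c , d) → (a + c , b + d)
      ; _*_ = λ (a , b) (c , d) → (a * c + b * d , a * d + b * c)
      ; -_  = λ (a , b) → (b , a)
      ; 0#  = (0 , 0)
      ; 1#  = (1 , 0)
      }

    diff-+ : ∀ x y → diff (RawRing._+_ coefficients x y) ≡ diff x +ᶠ diff y
    diff-+ (a , b) (c , d) = begin
      diff (a + c , b + d)  ≡⟨ diff-def (a + c) (b + d) ⟩
      nat (a + c) +ᶠ -ᶠ nat (b + d)  ≡⟨ cong₂ (λ u v → u +ᶠ -ᶠ v) (nat-+ a c) (nat-+ b d) ⟩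
      (nat a +ᶠ nat c) +ᶠ -ᶠ (nat b +ᶠ nat d)  ≡⟨ cong ((nat a +ᶠ nat c) +ᶠ_) (-‿+-comm (nat b) (nat d)) ⟨
      (nat a +ᶠ nat c) +ᶠ (-ᶠ nat b +ᶠ -ᶠ nat d)  ≡⟨ +ᶠ-interchange _ _ _ _ ⟩
      (nat a +ᶠ -ᶠ nat b) +ᶠ (nat c +ᶠ -ᶠ nat d)  ≡⟨ cong₂ _+ᶠ_ (diff-def a b) (diff-def c d) ⟨
      diff (a , b) +ᶠ diff (c , d)  ∎
      where open ≡-Reasoning

    diff-* : ∀ x y → diff (RawRing._*_ coefficients x y) ≡ diff x *ᶠ diff y
    diff-* (a , b) (c , d) = begin
      diff (a * c + b * d , a * d + b * c)  ≡⟨ diff-def (a * c + b * d) (a * d + b * c) ⟩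
      nat (a * c + b * d) +ᶠ -ᶠ nat (a * d + b * c)  ≡⟨ cong₂ (λ u v → u +ᶠ -ᶠ v) (split a c b d) (split a d b c) ⟩
      (A *ᶠ C +ᶠ B *ᶠ D) +ᶠ -ᶠ (A *ᶠ D +ᶠ B *ᶠ C)  ≡⟨ cong ((A *ᶠ C +ᶠ B *ᶠ D) +ᶠ_) (-‿+-comm _ _) ⟨
      (A *ᶠ C +ᶠ B *ᶠ D) +ᶠ (-ᶠ (A *ᶠ D) +ᶠ -ᶠ (B *ᶠ C))  ≡⟨ cong (λ e → (A *ᶠ C +ᶠ e) +ᶠ (-ᶠ (A *ᶠ D) +ᶠ -ᶠ (B *ᶠ C))) (neg*neg B D) ⟨
      (A *ᶠ C +ᶠ -ᶠ B *ᶠ -ᶠ D) +ᶠ (-ᶠ (A *ᶠ D) +ᶠ -ᶠ (B *ᶠ C))  ≡⟨ cong₂ (λ u v → (A *ᶠ C +ᶠ -ᶠ B *ᶠ -ᶠ D) +ᶠ (u +ᶠ v)) (-‿distribʳ-* A D) (-‿distribˡ-* B C) ⟩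
      (A *ᶠ C +ᶠ -ᶠ B *ᶠ -ᶠ D) +ᶠ (A *ᶠ -ᶠ D +ᶠ -ᶠ B *ᶠ C)  ≡⟨ cong ((A *ᶠ C +ᶠ -ᶠ B *ᶠ -ᶠ D) +ᶠ_) (+ᶠ-comm _ _) ⟩
      (A *ᶠ C +ᶠ -ᶠ B *ᶠ -ᶠ D) +ᶠ (-ᶠ B *ᶠ C +ᶠ A *ᶠ -ᶠ D)  ≡⟨ +ᶠ-interchange _ _ _ _ ⟩
      (A *ᶠ C +ᶠ -ᶠ B *ᶠ C) +ᶠ (-ᶠ B *ᶠ -ᶠ D +ᶠ A *ᶠ -ᶠ D)  ≡⟨ cong₂ _+ᶠ_ (*ᶠ-distribʳ C A _) (trans (*ᶠ-distribʳ (-ᶠ D) A _) (+ᶠ-comm _ _)) ⟨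
      (A +ᶠ -ᶠ B) *ᶠ C +ᶠ (A +ᶠ -ᶠ B) *ᶠ -ᶠ D  ≡⟨ *ᶠ-distribˡ (A +ᶠ -ᶠ B) C _ ⟨
      (A +ᶠ -ᶠ B) *ᶠ (C +ᶠ -ᶠ D)  ≡⟨ cong₂ _*ᶠ_ (diff-def a b) (diff-def c d) ⟨
      diff (a , b) *ᶠ diff (c , d)  ∎
      where
      open ≡-Reasoning
      A = nat a; B = nat b; C = nat c; D = nat d
      split : ∀ k l m n → nat (k * l + m * n) ≡ nat k *ᶠ nat l +ᶠ nat m *ᶠ nat n
      split k l m n = trans (nat-+ (k * l) _) (cong₂ _+ᶠ_ (nat-* k l) (nat-* m n))
      neg*neg : ∀ x y → -ᶠ x *ᶠ -ᶠ y ≡ x *ᶠ y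
      neg*neg x y = trans (sym (-‿distribˡ-* x _)) (trans (cong -ᶠ_ (sym (-‿distribʳ-* x y))) (-‿involutive _))

    diff-neg : ∀ x → diff (RawRing.-_ coefficients x) ≡ -ᶠ diff x
    diff-neg (a , b) = begin
      diff (b , a)  ≡⟨ diff-def b a ⟩
      nat b +ᶠ -ᶠ nat a  ≡⟨ +ᶠ-comm _ _ ⟩
      -ᶠ nat a +ᶠ nat b  ≡⟨ cong (-ᶠ nat a +ᶠ_) (-‿involutive _) ⟨
      -ᶠ nat a +ᶠ -ᶠ -ᶠ nat b  ≡⟨ -‿+-comm _ _ ⟩
      -ᶠ (nat a +ᶠ -ᶠ nat b)  ≡⟨ cong -ᶠ_ (diff-def a b) ⟨
      -ᶠ diff (a , b)  ∎
      where open ≡-Reasoning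

    homomorphism : coefficients -Raw-AlmostCommutative⟶ fromCommutativeRing 𝔽-commutativeRing
    homomorphism = record
      { ⟦_⟧ = diff ; +-homo = diff-+ ; *-homo = diff-* ; -‿homo = diff-neg ; 0-homo = refl ; 1-homo = refl }

    _coeff≟_ : ∀ x y → Maybe (diff x ≡ diff y)
    x@(a , b) coeff≟ y@(c , d) with a + d ≟ b + c
    ... | no _ = nothing
    ... | yes p = just (begin
      diff x  ≡⟨ +ᶠ-identityʳ _ ⟨
      diff x +ᶠ 0#  ≡⟨ cong (diff x +ᶠ_) (trans (diff-def (d + c) (c + d)) (trans (cong (λ e → nat e +ᶠ -ᶠ nat (c + d)) (+-comm d c)) (+ᶠ-inverseʳ _))) ⟨
      diff x +ᶠ diff (d + c , c + d)  ≡⟨ diff-+ x (d + c , c + d) ⟨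
      diff (a + (d + c) , b + (c + d))  ≡⟨ cong₂ (λ u v → diff (u , v)) (trans (sym (+-assoc a d c)) (trans (cong (_+ c) p) (+-comm _ c)))
                    (trans (sym (+-assoc b c d)) (+-comm _ d)) ⟩
      diff (c + (b + c) , d + (b + c))  ≡⟨ diff-+ y (b + c , b + c) ⟩
      diff y +ᶠ diff (b + c , b + c)  ≡⟨ cong (diff y +ᶠ_) (trans (diff-def (b + c) (b + c)) (+ᶠ-inverseʳ _)) ⟩
      diff y +ᶠ 0#  ≡⟨ +ᶠ-identityʳ _ ⟩
      diff y  ∎)
      where open ≡-Reasoning

  module 𝔽-Solver = Algebra.Solver.Ring IntegerCoefficients.coefficients
    (fromCommutativeRing 𝔽-commutativeRing) IntegerCoefficients.homomorphism IntegerCoefficients._coeff≟_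
  open 𝔽-Solver public using (solve; _:=_; _:+_; _:*_; :-_; con; Polynomial)

  :0 :1 : ∀ {n} → Polynomial n
  :0 = con (0 , 0)
  :1 = con (1 , 0)

  _≟ᶠ_ : DecidableEquality 𝔽
  x ≟ᶠ y = map′ (λ e → trans (sym (strictlyInverseˡ x)) (trans (cong to e) (strictlyInverseˡ y))) (cong from)
    (from x Fin.≟ from y)
    where open Inverse enum

  instance
    Finite-𝔽 : Finite 𝔽
    Finite-𝔽 = record
      { elems    = map to (allFin q)
      ; complete = λ a → subst (_∈ map to (allFin q)) (strictlyInverseˡ a) (∈-map⁺ to (∈-allFin (from a)))
      ; unique   = Uniq.map⁺ (λ {i} {j} e → trans (sym (strictlyInverseʳ i)) (trans (cong from e) (strictlyInverseʳ j))) (Uniq.allFin⁺ q)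
      }
      where open Inverse enum

  ∣𝔽∣ : ∣ 𝔽 ∣ ≡ q
  ∣𝔽∣ = trans (∣∣-def 𝔽) (trans (length-map _ (allFin q)) (length-tabulate id))
    where open import Data.List.Properties using (length-map; length-tabulate)

  -- Linear systems over F^n

  V : ℕ → Set
  V = Vec 𝔽

  infixl 6 _⊕_
  infixr 7 _·_

  _⊕_ : ∀ {n} → V n → V n → V n
  _⊕_ = Vec.zipWith _+ᶠ_

  _·_ : ∀ {n} → 𝔽 → V n → V n
  c · x = Vec.map (c *ᶠ_) x

  𝟎 : ∀ {n} → V n
  𝟎 = Vec.replicate _ 0#

  _≟ᵛ_ : ∀ {n} → DecidableEquality (V n)
  _≟ᵛ_ = Vec.≡-dec _≟ᶠ_

  ⊕-assoc : ∀ {n} (x y z : V n) → (x ⊕ y) ⊕ z ≡ x ⊕ (y ⊕ z)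
  ⊕-assoc = Vec.zipWith-assoc +ᶠ-assoc

  ⊕-comm : ∀ {n} (x y : V n) → x ⊕ y ≡ y ⊕ x
  ⊕-comm = Vec.zipWith-comm +ᶠ-comm

  ⊕-identityˡ : ∀ {n} (x : V n) → 𝟎 ⊕ x ≡ x
  ⊕-identityˡ = Vec.zipWith-identityˡ +ᶠ-identityˡ

  ⊕-identityʳ : ∀ {n} (x : V n) → x ⊕ 𝟎 ≡ x
  ⊕-identityʳ = Vec.zipWith-identityʳ +ᶠ-identityʳ

  ⊕-interchange : ∀ {n} (a b c d : V n) → (a ⊕ b) ⊕ (c ⊕ d) ≡ (a ⊕ c) ⊕ (b ⊕ d)
  ⊕-interchange []       []       []       []       = refl
  ⊕-interchange (a ∷ as) (b ∷ bs) (c ∷ cs) (d ∷ ds) = cong₂ _∷_ (+ᶠ-interchange a b c d) (⊕-interchange as bs cs ds)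

  ·-distribˡ : ∀ {n} c (x y : V n) → c · (x ⊕ y) ≡ c · x ⊕ c · y
  ·-distribˡ c []       []       = refl
  ·-distribˡ c (x ∷ xs) (y ∷ ys) = cong₂ _∷_ (*ᶠ-distribˡ c x y) (·-distribˡ c xs ys)

  ·-distribʳ : ∀ {n} a b (x : V n) → (a +ᶠ b) · x ≡ a · x ⊕ b · x
  ·-distribʳ a b []       = refl
  ·-distribʳ a b (x ∷ xs) = cong₂ _∷_ (*ᶠ-distribʳ x a b) (·-distribʳ a b xs)

  ·-assoc : ∀ {n} a b (x : V n) → (a *ᶠ b) · x ≡ a · b · x
  ·-assoc a b []       = refl
  ·-assoc a b (x ∷ xs) = cong₂ _∷_ (*ᶠ-assoc a b x) (·-assoc a b xs)

  ·-identity : ∀ {n} (x : V n) → 1# · x ≡ x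
  ·-identity []       = refl
  ·-identity (x ∷ xs) = cong₂ _∷_ (*ᶠ-identityˡ x) (·-identity xs)

  ·-zeroˡ : ∀ {n} (x : V n) → 0# · x ≡ 𝟎
  ·-zeroˡ []       = refl
  ·-zeroˡ (x ∷ xs) = cong₂ _∷_ (*ᶠ-zeroˡ x) (·-zeroˡ xs)

  ·-zeroʳ : ∀ {n} c → c · 𝟎 {n} ≡ 𝟎
  ·-zeroʳ {zero}  c = refl
  ·-zeroʳ {suc n} c = cong₂ _∷_ (*ᶠ-zeroʳ c) (·-zeroʳ c)

  ⊕-inverseʳ : ∀ {n} (x : V n) → x ⊕ (-ᶠ 1#) · x ≡ 𝟎
  ⊕-inverseʳ []       = refl
  ⊕-inverseʳ (x ∷ xs) = cong₂ _∷_ (solve 1 (λ x → x :+ (:- :1) :* x := :0) refl x) (⊕-inverseʳ xs)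

  ⊕-cancelʳ : ∀ {n} (z : V n) {x y} → x ⊕ z ≡ y ⊕ z → x ≡ y
  ⊕-cancelʳ z {x} {y} e = trans (sym (undo x)) (trans (cong (_⊕ (-ᶠ 1#) · z) e) (undo y))
    where
    undo : ∀ x → (x ⊕ z) ⊕ (-ᶠ 1#) · z ≡ x
    undo x = trans (⊕-assoc x z _) (trans (cong (x ⊕_) (⊕-inverseʳ z)) (⊕-identityʳ x))

  ⁻¹-· : ∀ {n} {c} → c ≢ 0# → (x : V n) → (c ⁻¹) · c · x ≡ x
  ⁻¹-· {c = c} c≢0 x = trans (sym (·-assoc _ c x))
    (trans (cong (_· x) (trans (*ᶠ-comm _ c) (inverse c c≢0))) (·-identity x))

  ·-cancel : ∀ {n} {c} → c ≢ 0# → {x y : V n} → c · x ≡ c · y → x ≡ y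
  ·-cancel {c = c} c≢0 {x} {y} e = trans (sym (⁻¹-· c≢0 x)) (trans (cong ((c ⁻¹) ·_) e) (⁻¹-· c≢0 y))

  dot : ∀ {k} → V k → V k → 𝔽
  dot []       []       = 0#
  dot (b ∷ bs) (e ∷ es) = b *ᶠ e +ᶠ dot bs es

  dot-comm : ∀ {k} (b e : V k) → dot b e ≡ dot e b
  dot-comm []       []       = refl
  dot-comm (b ∷ bs) (e ∷ es) = cong₂ _+ᶠ_ (*ᶠ-comm b e) (dot-comm bs es)

  dot-linear : ∀ {k} (b : V k) a c e → dot (b ⊕ a · c) e ≡ dot b e +ᶠ a *ᶠ dot c e
  dot-linear []       a []       []       = solve 1 (λ a → :0 := :0 :+ a :* :0) refl a
  dot-linear (b ∷ bs) a (c ∷ cs) (e ∷ es) = trans (cong ((b +ᶠ a *ᶠ c) *ᶠ e +ᶠ_) (dot-linear bs a cs es))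
    (solve 6 (λ b a c e x y → (b :+ a :* c) :* e :+ (x :+ a :* y) := (b :* e :+ x) :+ a :* (c :* e :+ y))
      refl b a c e (dot bs es) (dot cs es))

  dot-linearʳ : ∀ {k} (e b : V k) a c → dot e (b ⊕ a · c) ≡ dot e b +ᶠ a *ᶠ dot e c
  dot-linearʳ e b a c = trans (dot-comm e _) (trans (dot-linear b a c e)
    (cong₂ (λ x y → x +ᶠ a *ᶠ y) (dot-comm b e) (dot-comm c e)))

  dot-𝟎 : ∀ {k} (e : V k) → dot 𝟎 e ≡ 0#
  dot-𝟎 []       = refl
  dot-𝟎 (e ∷ es) = trans (cong₂ _+ᶠ_ (*ᶠ-zeroˡ e) (dot-𝟎 es)) (+ᶠ-identityˡ 0#)

  comb : ∀ {s n} → V s → Vec (V n) s → V n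
  comb []       []       = 𝟎
  comb (b ∷ bs) (x ∷ xs) = b · x ⊕ comb bs xs

  comb-⊕ : ∀ {s n} (b : V s) (x y : Vec (V n) s) → comb b (Vec.zipWith _⊕_ x y) ≡ comb b x ⊕ comb b y
  comb-⊕ []       []       []       = sym (⊕-identityˡ 𝟎)
  comb-⊕ (b ∷ bs) (x ∷ xs) (y ∷ ys) = trans (cong₂ _⊕_ (·-distribˡ b x y) (comb-⊕ bs xs ys)) (⊕-interchange _ _ _ _)

  comb-⊕ˡ : ∀ {s n} (b c : V s) (x : Vec (V n) s) → comb (b ⊕ c) x ≡ comb b x ⊕ comb c x
  comb-⊕ˡ []       []       []       = sym (⊕-identityˡ 𝟎)
  comb-⊕ˡ (b ∷ bs) (c ∷ cs) (x ∷ xs) = trans (cong₂ _⊕_ (·-distribʳ b c x) (comb-⊕ˡ bs cs xs)) (⊕-interchange _ _ _ _)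

  comb-·ˡ : ∀ {s n} a (b : V s) (x : Vec (V n) s) → comb (a · b) x ≡ a · comb b x
  comb-·ˡ a []       []       = sym (·-zeroʳ a)
  comb-·ˡ a (b ∷ bs) (x ∷ xs) = trans (cong₂ _⊕_ (·-assoc a b x) (comb-·ˡ a bs xs)) (sym (·-distribˡ a _ _))

  comb-spread : ∀ {s n} (b e : V s) (w : V n) → comb b (Vec.map (_· w) e) ≡ dot b e · w
  comb-spread []       []       w = sym (·-zeroˡ w)
  comb-spread (b ∷ bs) (e ∷ es) w = trans (cong₂ _⊕_ (sym (·-assoc b e w)) (comb-spread bs es w)) (sym (·-distribʳ _ _ w))

  InRow : ∀ {m k} → Vec (V k) m → V k → Set
  InRow {m} rows b = ∃ λ (c : V m) → b ≡ comb c rows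

  Annihilates : ∀ {m k} → V k → Vec (V k) m → Set
  Annihilates e = VAll.All (λ r → dot r e ≡ 0#)

  dot-InRow : ∀ {m k} (rows : Vec (V k) m) {b e} → InRow rows b → Annihilates e rows → dot b e ≡ 0#
  dot-InRow rows {e = e} (c , refl) ann = go rows c ann
    where
    go : ∀ {m} (rows : Vec (V _) m) c → Annihilates e rows → dot (comb c rows) e ≡ 0#
    go []          []       []        = dot-𝟎 e
    go (r ∷ rows) (c ∷ cs) (r0 ∷ ann) = begin
      dot (c · r ⊕ comb cs rows) e  ≡⟨ cong (λ x → dot x e) (⊕-comm (c · r) _) ⟩
      dot (comb cs rows ⊕ c · r) e  ≡⟨ dot-linear (comb cs rows) c r e ⟩
      dot (comb cs rows) e +ᶠ c *ᶠ dot r e  ≡⟨ cong₂ (λ x y → x +ᶠ c *ᶠ y) (go rows cs ann) r0 ⟩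
      0# +ᶠ c *ᶠ 0#  ≡⟨ solve 1 (λ c → :0 :+ c :* :0 := :0) refl c ⟩
      0#  ∎
      where open ≡-Reasoning

  -- The step adds a row r: if e₀ separates r from the other rows, then b − (b·e₀) r is
  -- separated from them by some e, which is corrected to annihilate r as well.
  separate : ∀ {m k} (rows : Vec (V k) m) b → InRow rows b ⊎ ∃ λ e → Annihilates e rows × dot b e ≡ 1#
  separate [] b = basis b
    where
    basis : ∀ {k} (b : V k) → InRow [] b ⊎ ∃ λ e → Annihilates e [] × dot b e ≡ 1#
    basis [] = inj₁ ([] , refl)
    basis (b ∷ bs) with b ≟ᶠ 0# | basis bs
    ... | no b≢0 | _ = inj₂ ((b ⁻¹) ∷ 𝟎 , [] , trans (cong₂ _+ᶠ_ (inverse b b≢0) (trans (dot-comm bs 𝟎) (dot-𝟎 bs))) (+ᶠ-identityʳ 1#))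
    ... | yes b≡0 | inj₁ ([] , bs≡0) = inj₁ ([] , cong₂ _∷_ b≡0 bs≡0)
    ... | yes b≡0 | inj₂ (e , [] , be≡1) = inj₂ (0# ∷ e , [] , trans (cong₂ _+ᶠ_ (*ᶠ-zeroʳ b) be≡1) (+ᶠ-identityˡ 1#))
  separate (r ∷ rows) b with separate rows r
  ... | inj₁ r∈ with separate rows b
  ...   | inj₁ (c , refl) = inj₁ (0# ∷ c , sym (trans (cong (_⊕ comb c rows) (·-zeroˡ r)) (⊕-identityˡ _)))
  ...   | inj₂ (e , ann , be≡1) = inj₂ (e , dot-InRow rows r∈ ann ∷ ann , be≡1)
  separate (r ∷ rows) b | inj₂ (e₀ , ann₀ , re₀≡1) with separate rows (b ⊕ (-ᶠ dot b e₀) · r)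
  ...   | inj₁ (c , b′≡) = inj₁ (dot b e₀ ∷ c , trans (sym (add-sub b (dot b e₀) r)) (cong (dot b e₀ · r ⊕_) b′≡))
    where
    add-sub : ∀ {k} (b : V k) d r → d · r ⊕ (b ⊕ (-ᶠ d) · r) ≡ b
    add-sub []       d []       = refl
    add-sub (b ∷ bs) d (r ∷ rs) = cong₂ _∷_ (solve 3 (λ b d r → d :* r :+ (b :+ (:- d) :* r) := b) refl b d r) (add-sub bs d rs)
  ...   | inj₂ (e , ann , b′e≡1) = inj₂ (e ⊕ (-ᶠ dot r e) · e₀ , re′≡0 ∷ rows-e′ ann ann₀ , be′≡1)
    where
    open ≡-Reasoning
    re′≡0 : dot r (e ⊕ (-ᶠ dot r e) · e₀) ≡ 0#
    re′≡0 = trans (dot-linearʳ r e _ e₀) (trans (cong (λ x → dot r e +ᶠ (-ᶠ dot r e) *ᶠ x) re₀≡1)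
      (solve 1 (λ x → x :+ (:- x) :* :1 := :0) refl (dot r e)))
    rows-e′ : ∀ {m} {rows : Vec (V _) m} → Annihilates e rows → Annihilates e₀ rows →
      Annihilates (e ⊕ (-ᶠ dot r e) · e₀) rows
    rows-e′ []        []          = []
    rows-e′ {rows = s ∷ _} (p ∷ ps) (p₀ ∷ ps₀) = trans (dot-linearʳ s e _ e₀) (trans (cong₂ (λ x y → x +ᶠ (-ᶠ dot r e) *ᶠ y) p p₀)
      (solve 1 (λ x → :0 :+ (:- x) :* :0 := :0) refl (dot r e))) ∷ rows-e′ ps ps₀
    be′≡1 : dot b (e ⊕ (-ᶠ dot r e) · e₀) ≡ 1#
    be′≡1 = begin
      dot b (e ⊕ (-ᶠ dot r e) · e₀)  ≡⟨ dot-linearʳ b e _ e₀ ⟩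
      dot b e +ᶠ (-ᶠ dot r e) *ᶠ dot b e₀  ≡⟨ solve 3 (λ x y z → x :+ (:- y) :* z := x :+ (:- z) :* y) refl (dot b e) (dot r e) (dot b e₀) ⟩
      dot b e +ᶠ (-ᶠ dot b e₀) *ᶠ dot r e  ≡⟨ dot-linear b (-ᶠ dot b e₀) r e ⟨
      dot (b ⊕ (-ᶠ dot b e₀) · r) e  ≡⟨ b′e≡1 ⟩
      1#  ∎

  -- Linear independence in stepwise form, no row lying in the span of the later ones. This is the
  -- form in which equations are added one at a time when solutions are counted.
  Independent : ∀ {m k} → Vec (V k) m → Set
  Independent []         = ⊤
  Independent (r ∷ rows) = ¬ InRow rows r × Independent rows

  Solves : ∀ {m k n} → Vec (V k) m → Vec (V n) k → Set
  Solves rows x = VAll.All (λ r → comb r x ≡ 𝟎) rows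

  solves? : ∀ {m k n} (rows : Vec (V k) m) (x : Vec (V n) k) → Dec (Solves rows x)
  solves? rows x = VAll.all? (λ r → comb r x ≟ᵛ 𝟎) rows

  kernel : ∀ {m k} n → Vec (V k) m → ℕ
  kernel {k = k} n rows = ∑ λ (x : Vec (V n) k) → 𝟙 (solves? rows x)

  -- Translating by e w, where e separates r from the other rows, moves the value of r from 0 to w.
  kernel-∷ : ∀ {m k} n (r : V k) (rows : Vec (V k) m) → ¬ InRow rows r →
    ∣ V n ∣ * kernel n (r ∷ rows) ≤ kernel n rows
  kernel-∷ {k = k} n r rows r∉ with separate rows r
  ... | inj₁ r∈ = contradiction r∈ r∉
  ... | inj₂ (e , ann , re≡1) = begin
    ∣ V n ∣ * kernel n (r ∷ rows)  ≡⟨ ∑-const _ ⟨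
    ∑ (λ (w : V n) → kernel n (r ∷ rows))  ≤⟨ ∑-mono (λ w → ≤-trans (∑-mono (moved w)) (∑-injective (shift w) (shift-injective w) (g w))) ⟩
    ∑ (λ w → ∑ (λ x → 𝟙 (comb r x ≟ᵛ w) * 𝟙 (solves? rows x)))  ≡⟨ ∑-swap _ ⟩
    ∑ (λ x → ∑ (λ w → 𝟙 (comb r x ≟ᵛ w) * 𝟙 (solves? rows x)))  ≡⟨ ∑-cong (λ x → ∑-pick _≟ᵛ_ (comb r x) _) ⟩
    kernel n rows  ∎
    where
    open ≤-Reasoning
    g : V n → Vec (V n) k → ℕ
    g w x = 𝟙 (comb r x ≟ᵛ w) * 𝟙 (solves? rows x)
    shift : V n → Vec (V n) k → Vec (V n) k
    shift w x = Vec.zipWith _⊕_ x (Vec.map (_· w) e)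
    shift-injective : ∀ w {x y} → shift w x ≡ shift w y → x ≡ y
    shift-injective w {x} {y} = go x y (Vec.map (_· w) e)
      where
      go : ∀ {k} (x y z : Vec (V n) k) → Vec.zipWith _⊕_ x z ≡ Vec.zipWith _⊕_ y z → x ≡ y
      go []       []       []       _  = refl
      go (x ∷ xs) (y ∷ ys) (z ∷ zs) eq = cong₂ _∷_ (⊕-cancelʳ z (Vec.∷-injectiveˡ eq)) (go xs ys zs (Vec.∷-injectiveʳ eq))
    comb-shift : ∀ s w x → comb s (shift w x) ≡ comb s x ⊕ dot s e · w
    comb-shift s w x = trans (comb-⊕ s x _) (cong (comb s x ⊕_) (comb-spread s e w))
    rest : ∀ {m} {rows : Vec (V k) m} w x → Annihilates e rows → Solves rows x → Solves rows (shift w x)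
    rest w x []       []       = []
    rest {rows = s ∷ _} w x (a ∷ as) (p ∷ ps) = trans (comb-shift s w x) (trans (cong₂ (λ u c → u ⊕ c · w) p a)
      (trans (⊕-identityˡ _) (·-zeroˡ w))) ∷ rest w x as ps
    moved : ∀ w x → 𝟙 (solves? (r ∷ rows) x) ≤ g w (shift w x)
    moved w x = ≤-trans (𝟙-mono (solves? (r ∷ rows) x) ((comb r (shift w x) ≟ᵛ w) ×-dec solves? rows (shift w x))
      (λ { (p ∷ ps) → trans (comb-shift r w x) (trans (cong₂ (λ u c → u ⊕ c · w) p re≡1)
        (trans (⊕-identityˡ _) (·-identity w))) , rest w x ann ps }))
      (≤-reflexive (sym (𝟙-× (comb r (shift w x) ≟ᵛ w) (solves? rows (shift w x)))))

  -- Each independent equation divides the number of solutions by N. The bound N^(k - m) is stated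
  -- with N^m on the left because no relation between m and k is at hand.
  kernel-count : ∀ {m k} n (rows : Vec (V k) m) → Independent rows → ∣ V n ∣ ^ m * kernel n rows ≤ ∣ V n ∣ ^ k
  kernel-count {k = k} n [] _ = begin
    1 * ∑ (λ (x : Vec (V n) k) → 𝟙 (solves? [] x))  ≡⟨ *-identityˡ _ ⟩
    ∑ (λ (x : Vec (V n) k) → 𝟙 (solves? [] x))  ≤⟨ ∑-mono (λ x → 𝟙≤1 (solves? [] x)) ⟩
    ∑ (λ (x : Vec (V n) k) → 1)  ≡⟨ trans (∑-const 1) (*-identityʳ _) ⟩
    ∣ Vec (V n) k ∣  ≡⟨ ∣Vec∣ ⟩
    ∣ V n ∣ ^ k  ∎
    where open ≤-Reasoning
  kernel-count {suc m} {k} n (r ∷ rows) (r∉ , ind) = begin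
    N * N ^ m * kernel n (r ∷ rows)  ≡⟨ cong (_* kernel n (r ∷ rows)) (*-comm N _) ⟩
    N ^ m * N * kernel n (r ∷ rows)  ≡⟨ *-assoc (N ^ m) N _ ⟩
    N ^ m * (N * kernel n (r ∷ rows))  ≤⟨ *-monoʳ-≤ (N ^ m) (kernel-∷ n r rows r∉) ⟩
    N ^ m * kernel n rows  ≤⟨ kernel-count n rows ind ⟩
    N ^ k  ∎
    where
    open ≤-Reasoning
    N = ∣ V n ∣

  -- Slice rank

  _∩_ : ∀ {A : Set} {P : A → Set} → Subset A → (∀ a → Dec (P a)) → Subset A
  (S ∩ P?) a = ⌊ (a ∈? S) ×-dec P? a ⌋

  ∈-∩⁻ : ∀ {A : Set} {P : A → Set} (S : Subset A) (P? : ∀ a → Dec (P a)) {a} → T ((S ∩ P?) a) → T (S a) × P a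
  ∈-∩⁻ S P? = toWitness

  ∈-∩⁺ : ∀ {A : Set} {P : A → Set} (S : Subset A) (P? : ∀ a → Dec (P a)) {a} → T (S a) → P a → T ((S ∩ P?) a)
  ∈-∩⁺ S P? s p = fromWitness (s , p)

  length-filter-∑ : ∀ {A : Set} {P : A → Set} (P? : ∀ a → Dec (P a)) xs → length (filter P? xs) ≡ sumOver xs (𝟙 ∘ P?)
  length-filter-∑ P? [] = refl
  length-filter-∑ P? (x ∷ xs) with P? x
  ... | yes _ = cong suc (length-filter-∑ P? xs)
  ... | no _  = length-filter-∑ P? xs

  sumOver-1 : ∀ {A : Set} (xs : List A) → sumOver xs (λ _ → 1) ≡ length xs
  sumOver-1 []       = refl
  sumOver-1 (x ∷ xs) = cong suc (sumOver-1 xs)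

  #-filter : ∀ {A : Set} {{_ : Finite A}} (S : Subset A) → # S ≡ length (filter (_∈? S) elems)
  #-filter S = trans (∑-def _) (sym (length-filter-∑ (_∈? S) elems))

  #-⊆-length : ∀ {A : Set} {{_ : Finite A}} (S : Subset A) (P : List A) → (∀ {a} → T (S a) → a ∈ P) → # S ≤ length P
  #-⊆-length S P S⊆P = begin
    # S  ≡⟨ #-filter S ⟩
    length (filter (_∈? S) elems)  ≡⟨ sumOver-1 (filter (_∈? S) elems) ⟨
    sumOver (filter (_∈? S) elems) (λ _ → 1)  ≤⟨ sumOver-⊆ _ (Uniq.filter⁺ (_∈? S) unique) (λ a∈ → S⊆P (proj₂ (∈-filter⁻ (_∈? S) {xs = elems} a∈))) ⟩
    sumOver P (λ _ → 1)  ≡⟨ sumOver-1 P ⟩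
    length P  ∎
    where open ≤-Reasoning

  -- Gaussian elimination on functionals

  module Pivot {X : Set} {{_ : Finite X}} (_≟ˣ_ : DecidableEquality X) where

    _∈ˡ?_ : (x : X) (P : List X) → Dec (x ∈ P)
    x ∈ˡ? P = any? (x ≟ˣ_) P

    escape : (S : Subset X) (P : List X) → length P < # S → ∃ λ j → T (S j) × j ∉ P
    escape S P P<S with ∃? (λ j → (j ∈? S) ×-dec ¬? (j ∈ˡ? P))
    ... | yes found = found
    ... | no none = contradiction (#-⊆-length S P S⊆P) (<⇒≱ P<S)
      where
      S⊆P : ∀ {j} → T (S j) → j ∈ P
      S⊆P {j} s with j ∈ˡ? P
      ... | yes j∈ = j∈
      ... | no j∉ = contradiction (j , s , j∉) none

    _⊥_ : (X → 𝔽) → (X → 𝔽) → Set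
    e ⊥ f = ∑ᶠ (λ x → e x *ᶠ f x) ≡ 0#

    -- Gaussian elimination on the functionals fs: P holds the pivot positions, and every other
    -- position j carries a weight that is 1 at j, lives on P besides, and kills fs.
    record Pivoted (P : List X) (fs : List (X → 𝔽)) (j : X) : Set where
      field
        weight  : X → 𝔽
        one     : weight j ≡ 1#
        support : ∀ x → weight x ≡ 0# ⊎ (x ≡ j ⊎ x ∈ P)
        kills   : All (weight ⊥_) fs
    open Pivoted

    -- Subtracting the multiple of d₀ that cancels the pairing of d with f. The value at j stays 1
    -- because the weight of j₀ lives on j₀ and P, and j is neither; the only new support is the
    -- pivot j₀.
    add-pivot : ∀ {P fs j j₀} f (d : Pivoted P fs j) (d₀ : Pivoted P fs j₀) →
      ∑ᶠ (λ x → weight d₀ x *ᶠ f x) ≢ 0# → j ∉ P → j ≢ j₀ → Pivoted (j₀ ∷ P) (f ∷ fs) j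
    add-pivot {P} {fs} {j} {j₀} f d d₀ f₀≢0 j∉ j≢j₀ = record
      { weight  = e
      ; one     = trans (cong₂ (λ u v → u +ᶠ k *ᶠ v) (one d) (vanishes (support d₀ j)))
                    (solve 1 (λ k → :1 :+ k :* :0 := :1) refl k)
      ; support = supp
      ; kills   = trans (pairing f) cancels ∷ both (kills d) (kills d₀)
      }
      where
      Σf₀ = ∑ᶠ (λ x → weight d₀ x *ᶠ f x)
      k = -ᶠ (∑ᶠ (λ x → weight d x *ᶠ f x) *ᶠ (Σf₀ ⁻¹))
      e : X → 𝔽
      e x = weight d x +ᶠ k *ᶠ weight d₀ x
      vanishes : weight d₀ j ≡ 0# ⊎ (j ≡ j₀ ⊎ j ∈ P) → weight d₀ j ≡ 0#
      vanishes (inj₁ z)           = z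
      vanishes (inj₂ (inj₁ j≡j₀)) = contradiction j≡j₀ j≢j₀
      vanishes (inj₂ (inj₂ j∈))   = contradiction j∈ j∉
      supp : ∀ x → e x ≡ 0# ⊎ (x ≡ j ⊎ x ∈ j₀ ∷ P)
      supp x with support d x | support d₀ x
      ... | inj₂ (inj₁ x≡j)  | _ = inj₂ (inj₁ x≡j)
      ... | inj₂ (inj₂ x∈)   | _ = inj₂ (inj₂ (there x∈))
      ... | inj₁ _ | inj₂ (inj₁ x≡j₀) = inj₂ (inj₂ (here x≡j₀))
      ... | inj₁ _ | inj₂ (inj₂ x∈)   = inj₂ (inj₂ (there x∈))
      ... | inj₁ z | inj₁ z₀ = inj₁ (trans (cong₂ (λ u v → u +ᶠ k *ᶠ v) z z₀) (solve 1 (λ k → :0 :+ k :* :0 := :0) refl k))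
      pairing : ∀ g → ∑ᶠ (λ x → e x *ᶠ g x) ≡ ∑ᶠ (λ x → weight d x *ᶠ g x) +ᶠ k *ᶠ ∑ᶠ (λ x → weight d₀ x *ᶠ g x)
      pairing g = trans (∑ᶠ-cong λ x → solve 4 (λ a k b c → (a :+ k :* b) :* c := a :* c :+ k :* (b :* c)) refl
          (weight d x) k (weight d₀ x) (g x))
        (trans (∑ᶠ-+ _ _) (cong (∑ᶠ (λ x → weight d x *ᶠ g x) +ᶠ_) (∑ᶠ-*ˡ k (λ x → weight d₀ x *ᶠ g x))))
      Σf = ∑ᶠ (λ x → weight d x *ᶠ f x)
      cancels : Σf +ᶠ k *ᶠ Σf₀ ≡ 0#
      cancels = trans (solve 3 (λ a i b → a :+ (:- (a :* i)) :* b := a :+ :- (a :* (b :* i))) refl Σf (Σf₀ ⁻¹) Σf₀)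
        (trans (cong (λ u → Σf +ᶠ -ᶠ (Σf *ᶠ u)) (inverse Σf₀ f₀≢0)) (solve 1 (λ a → a :+ :- (a :* :1) := :0) refl Σf))
      both : ∀ {fs} → All (weight d ⊥_) fs → All (weight d₀ ⊥_) fs → All (e ⊥_) fs
      both []       []         = []
      both {g ∷ _} (p ∷ ps) (p₀ ∷ ps₀) = trans (pairing g) (trans (cong₂ (λ u v → u +ᶠ k *ᶠ v) p p₀)
        (solve 1 (λ k → :0 :+ k :* :0 := :0) refl k)) ∷ both ps ps₀

    -- A new functional f costs at most one pivot. Either all current weights kill f already, or
    -- some j₀ outside P has a weight that does not, and then j₀ becomes a pivot and corrects all
    -- the other weights. Before any functional is imposed, the weights are point masses.
    pivot : (S : Subset X) (fs : List (X → 𝔽)) → ∃ λ P → length P ≤ length fs × (∀ {x} → x ∈ P → T (S x)) ×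
      (∀ j → T (S j) → j ∉ P → Pivoted P fs j)
    pivot S [] = [] , z≤n , (λ ()) , λ j _ _ → record
      { weight  = δ j
      ; one     = δ-same j
      ; support = δ-support j
      ; kills   = []
      }
      where
      δ : X → X → 𝔽
      δ j x with x ≟ˣ j
      ... | yes _ = 1#
      ... | no _  = 0#
      δ-same : ∀ j → δ j j ≡ 1#
      δ-same j with j ≟ˣ j
      ... | yes _  = refl
      ... | no j≢j = contradiction refl j≢j
      δ-support : ∀ j x → δ j x ≡ 0# ⊎ (x ≡ j ⊎ x ∈ [])
      δ-support j x with x ≟ˣ j
      ... | yes x≡j = inj₂ (inj₁ x≡j)
      ... | no _    = inj₁ refl
    pivot S (f ∷ fs) with pivot S fs
    ... | P , P≤ , P⊆S , piv with search elems
      where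
      search : ∀ xs → (∀ {j} → j ∈ xs → T (S j) → j ∉ P → Pivoted P (f ∷ fs) j)
        ⊎ ∃ λ j₀ → T (S j₀) × Σ (Pivoted P fs j₀) λ d → ∑ᶠ (λ x → weight d x *ᶠ f x) ≢ 0#
      search [] = inj₁ λ ()
      search (x ∷ xs) with search xs
      ... | inj₂ found = inj₂ found
      ... | inj₁ none with (x ∈? S) ×-dec ¬? (x ∈ˡ? P)
      ...   | no ¬ok = inj₁ λ { (here refl) s j∉ → contradiction (s , j∉) ¬ok ; (there j∈) → none j∈ }
      ...   | yes (s , x∉) with ∑ᶠ (λ y → weight (piv x s x∉) y *ᶠ f y) ≟ᶠ 0#
      ...     | no ≢0  = inj₂ (x , s , piv x s x∉ , ≢0)
      ...     | yes ≡0 = inj₁ λ { (here refl) _ _ → record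
        { weight = weight d ; one = one d ; support = support d ; kills = ≡0 ∷ kills d } ; (there j∈) → none j∈ }
        where d = piv x s x∉
    ...   | inj₁ done = P , m≤n⇒m≤1+n P≤ , P⊆S , λ j → done (complete j)
    ...   | inj₂ (j₀ , s₀ , d₀ , ≢0) = j₀ ∷ P , s≤s P≤ , (λ { (here refl) → s₀ ; (there x∈) → P⊆S x∈ }) ,
      λ j s j∉ → add-pivot f (piv j s (j∉ ∘ there)) d₀ ≢0 (j∉ ∘ there) (j∉ ∘ here)

  -- Low-degree monomials and the polynomial of an equation

  nonzeros : List 𝔽
  nonzeros = filter (λ a → ¬? (a ≟ᶠ 0#)) elems

  -- This is q - 1, not the characteristic: the degree in each coordinate of the polynomial that
  -- detects solutions.
  p : ℕ
  p = length nonzeros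

  q≡1+p : q ≡ suc p
  q≡1+p = begin
    q  ≡⟨ ∣𝔽∣ ⟨
    ∣ 𝔽 ∣  ≡⟨ trans (∑-const 1) (*-identityʳ _) ⟨
    ∑ (λ (a : 𝔽) → 1)  ≡⟨ ∑-cong split ⟩
    ∑ (λ a → 𝟙 (0# ≟ᶠ a) * 1 + 𝟙 (¬? (a ≟ᶠ 0#)))  ≡⟨ ∑-+ _ _ ⟩
    ∑ (λ a → 𝟙 (0# ≟ᶠ a) * 1) + ∑ (λ a → 𝟙 (¬? (a ≟ᶠ 0#)))  ≡⟨ cong₂ _+_ (∑-pick _≟ᶠ_ 0# (λ _ → 1)) (∑-def _) ⟩
    suc (sumOver elems (λ a → 𝟙 (¬? (a ≟ᶠ 0#))))  ≡⟨ cong suc (length-filter-∑ (λ a → ¬? (a ≟ᶠ 0#)) elems) ⟨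
    suc p  ∎
    where
    open ≡-Reasoning
    split : ∀ a → 1 ≡ 𝟙 (0# ≟ᶠ a) * 1 + 𝟙 (¬? (a ≟ᶠ 0#))
    split a with a ≟ᶠ 0#
    ... | yes refl = sym (cong (λ k → k * 1 + 0) (𝟙-yes (0# ≟ᶠ 0#) refl))
    ... | no a≢0 = sym (cong (λ k → k * 1 + 1) (𝟙-no (0# ≟ᶠ a) (a≢0 ∘ sym)))

  _^ᶠ_ : 𝔽 → ℕ → 𝔽
  x ^ᶠ zero  = 1#
  x ^ᶠ suc n = x *ᶠ x ^ᶠ n

  monomial : ∀ {r} → Vec ℕ r → V r → 𝔽
  monomial []       []       = 1#
  monomial (a ∷ α) (x ∷ xs) = x ^ᶠ a *ᶠ monomial α xs

  bump : ∀ {r} → Fin r → Vec ℕ r → Vec ℕ r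
  bump t α = Vec.updateAt α t suc

  monomial-bump : ∀ {r} t (α : Vec ℕ r) x → monomial (bump t α) x ≡ lookup x t *ᶠ monomial α x
  monomial-bump zero    (a ∷ α) (x ∷ xs) = *ᶠ-assoc x _ _
  monomial-bump (suc t) (a ∷ α) (x ∷ xs) = trans (cong (x ^ᶠ a *ᶠ_) (monomial-bump t α xs))
    (solve 3 (λ u v w → u :* (v :* w) := v :* (u :* w)) refl (x ^ᶠ a) (lookup xs t) _)

  monomial-0 : ∀ {r} (x : V r) → monomial (Vec.replicate r 0) x ≡ 1#
  monomial-0 []       = refl
  monomial-0 (x ∷ xs) = trans (*ᶠ-identityˡ _) (monomial-0 xs)

  sum-bump : ∀ {r} t (α : Vec ℕ r) → Vec.sum (bump t α) ≡ suc (Vec.sum α)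
  sum-bump zero    (a ∷ α) = refl
  sum-bump (suc t) (a ∷ α) = trans (cong (a +_) (sum-bump t α)) (+-suc a _)

  sum-0 : ∀ r → Vec.sum (Vec.replicate r 0) ≡ 0
  sum-0 zero    = refl
  sum-0 (suc r) = sum-0 r

  lookup-bump : ∀ {r} t t′ (α : Vec ℕ r) → lookup (bump t α) t′ ≡ 𝟙 (t Fin.≟ t′) + lookup α t′
  lookup-bump t t′ α with t Fin.≟ t′
  ... | yes refl = Vec.lookup∘updateAt t α
  ... | no t≢t′  = Vec.lookup∘updateAt′ t′ t (t≢t′ ∘ sym) α

  count : ∀ {r} → Fin r → List (Fin r × 𝔽) → ℕ
  count t L = sumOver L λ (t′ , _) → 𝟙 (t′ Fin.≟ t)

  opaque
    -- The threshold is a third of the degree p r of the detecting polynomial: each monomial in x, y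
    -- and z of total degree at most p r has degree at most p r / 3 in one of the three vectors.
    low : ∀ r → List (Vec (Fin (suc p)) r)
    low r = filter (λ α → 3 * Vec.sum (Vec.map toℕ α) ≤? p * r) elems

    low-def : ∀ r → low r ≡ filter (λ α → 3 * Vec.sum (Vec.map toℕ α) ≤? p * r) elems
    low-def r = refl

  low-monomials : ∀ r → List (V r → 𝔽)
  low-monomials r = map (λ α → monomial (Vec.map toℕ α)) (low r)

  low-complete : ∀ {r} (α : Vec ℕ r) → (∀ t → lookup α t ≤ p) → 3 * Vec.sum α ≤ p * r → monomial α ∈ low-monomials r
  low-complete {r} α α≤p 3α≤ with bounded α α≤p
    where
    bounded : ∀ {r} (α : Vec ℕ r) → (∀ t → lookup α t ≤ p) → ∃ λ (α′ : Vec (Fin (suc p)) r) → Vec.map toℕ α′ ≡ α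
    bounded []      _   = [] , refl
    bounded (a ∷ α) α≤p with bounded α (α≤p ∘ suc)
    ... | α′ , eq = fromℕ< (s≤s (α≤p zero)) ∷ α′ , cong₂ _∷_ (Fin.toℕ-fromℕ< (s≤s (α≤p zero))) eq
  ... | α′ , refl = ∈-map⁺ (λ α → monomial (Vec.map toℕ α))
    (subst (α′ ∈_) (sym (low-def r)) (∈-filter⁺ (λ α → 3 * Vec.sum (Vec.map toℕ α) ≤? p * r) (complete α′) 3α≤))

  module SliceRank {c c′ s : 𝔽} (c+c′≡s : c +ᶠ c′ ≡ s) (r : ℕ) where

    X³ : Set
    X³ = V r × V r × V r

    linear : Fin r × 𝔽 → X³ → 𝔽
    linear (t , a) (x , y , z) = (c *ᶠ lookup x t +ᶠ c′ *ᶠ lookup y t) +ᶠ ((-ᶠ s) *ᶠ lookup z t +ᶠ -ᶠ a)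

    product : List (Fin r × 𝔽) → X³ → 𝔽
    product []      _ = 1#
    product (l ∷ L) u = linear l u *ᶠ product L u

    product-0 : ∀ {L l u} → l ∈ L → linear l u ≡ 0# → product L u ≡ 0#
    product-0 (here refl) e = *ᶠ-0ˡ e
    product-0 (there l∈)  e = *ᶠ-0ʳ (product-0 l∈ e)

    product-≢0 : ∀ {L u} → (∀ {l} → l ∈ L → linear l u ≢ 0#) → product L u ≢ 0#
    product-≢0 {[]}    _  e = 0ᶠ≢1ᶠ (sym e)
    product-≢0 {l ∷ L} {u} ≢0 e = product-≢0 {L} (≢0 ∘ there) (begin
      product L u  ≡⟨ *ᶠ-identityˡ _ ⟨
      1# *ᶠ product L u  ≡⟨ cong (_*ᶠ product L u) (inverse (linear l u) (≢0 (here refl))) ⟨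
      linear l u *ᶠ (linear l u ⁻¹) *ᶠ product L u  ≡⟨ solve 3 (λ a i b → a :* i :* b := i :* (a :* b)) refl (linear l u) (linear l u ⁻¹) (product L u) ⟩
      (linear l u ⁻¹) *ᶠ (linear l u *ᶠ product L u)  ≡⟨ cong ((linear l u ⁻¹) *ᶠ_) e ⟩
      (linear l u ⁻¹) *ᶠ 0#  ≡⟨ *ᶠ-zeroʳ _ ⟩
      0#  ∎)
      where open ≡-Reasoning

    -- For a fixed coordinate t with value f_t = c x_t + c′ y_t - s z_t, the forms multiply to the
    -- product of f_t - a over a ≠ 0, that is f_t^(q-1) - 1. Over all t this is, up to sign, the
    -- polynomial indicator of c x + c′ y = s z.
    forms : List (Fin r × 𝔽)
    forms = cartesianProduct (allFin r) nonzeros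

    count-forms : ∀ t → count t forms ≡ p
    count-forms t = begin
      count t forms  ≡⟨ sumOver-× (allFin r) nonzeros _ ⟩
      sumOver (allFin r) (λ t′ → sumOver nonzeros (λ _ → 𝟙 (t′ Fin.≟ t))) ≡⟨ sumOver-single (Uniq.allFin⁺ r) (∈-allFin t)
                    (λ t′ t′≢t → sumOver-0 nonzeros λ _ _ → 𝟙-no (t′ Fin.≟ t) t′≢t) ⟩
      sumOver nonzeros (λ _ → 𝟙 (t Fin.≟ t))  ≡⟨ sumOver-cong nonzeros (λ _ → 𝟙-yes (t Fin.≟ t) refl) ⟩
      sumOver nonzeros (λ _ → 1)  ≡⟨ sumOver-1 nonzeros ⟩
      p  ∎
      where open ≡-Reasoning

    length-forms : length forms ≡ p * r
    length-forms = begin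
      length forms  ≡⟨ sumOver-1 forms ⟨
      sumOver forms (λ _ → 1)  ≡⟨ sumOver-× (allFin r) nonzeros _ ⟩
      sumOver (allFin r) (λ t′ → sumOver nonzeros (λ _ → 1))  ≡⟨ sumOver-cong (allFin r) (λ _ → trans (sumOver-1 nonzeros) (sym (*-identityʳ p))) ⟩
      sumOver (allFin r) (λ t′ → p * 1)  ≡⟨ sumOver-*ˡ (allFin r) p (λ _ → 1) ⟩
      p * sumOver (allFin r) (λ _ → 1)  ≡⟨ cong (p *_) (trans (sumOver-1 (allFin r)) (length-tabulate id)) ⟩
      p * r  ∎
      where open ≡-Reasoning

    -- If the equation fails in coordinate t with value a ≠ 0, then the form belonging to (t , a) is
    -- one of the factors and vanishes.
    product-forms-0 : ∀ {x y z} → c · x ⊕ c′ · y ≢ s · z → product forms (x , y , z) ≡ 0#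
    product-forms-0 {x} {y} {z} no-eq with ∃? (λ t → ¬? (form t ≟ᶠ 0#))
      where
      form : Fin r → 𝔽
      form t = (c *ᶠ lookup x t +ᶠ c′ *ᶠ lookup y t) +ᶠ (-ᶠ s) *ᶠ lookup z t
    ... | yes (t , ≢0) = product-0 (∈-cartesianProduct⁺ (∈-allFin t) (∈-filter⁺ (λ a → ¬? (a ≟ᶠ 0#)) (complete _) ≢0))
      (solve 3 (λ a b c → (a :+ b) :+ (c :+ :- ((a :+ b) :+ c)) := :0) refl (c *ᶠ lookup x t) (c′ *ᶠ lookup y t) ((-ᶠ s) *ᶠ lookup z t))
    ... | no none = contradiction (all-eq x y z λ t → form-0 t) no-eq
      where
      form-0 : ∀ t → (c *ᶠ lookup x t +ᶠ c′ *ᶠ lookup y t) +ᶠ (-ᶠ s) *ᶠ lookup z t ≡ 0#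
      form-0 t with ((c *ᶠ lookup x t +ᶠ c′ *ᶠ lookup y t) +ᶠ (-ᶠ s) *ᶠ lookup z t) ≟ᶠ 0#
      ... | yes e = e
      ... | no ≢0 = contradiction (t , ≢0) none
      all-eq : ∀ {r} (x y z : V r) → (∀ t → (c *ᶠ lookup x t +ᶠ c′ *ᶠ lookup y t) +ᶠ (-ᶠ s) *ᶠ lookup z t ≡ 0#) →
        c · x ⊕ c′ · y ≡ s · z
      all-eq []       []       []       _ = refl
      all-eq (x ∷ xs) (y ∷ ys) (z ∷ zs) f = cong₂ _∷_
        (trans (solve 4 (λ x y s z → x :+ y := ((x :+ y) :+ (:- s) :* z) :+ s :* z) refl (c *ᶠ x) (c′ *ᶠ y) s z)
          (trans (cong (_+ᶠ s *ᶠ z) (f zero)) (+ᶠ-identityˡ _)))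
        (all-eq xs ys zs (f ∘ suc))

    -- At (x , x , x) the coordinates cancel because c + c′ = s, leaving factors -a with a ≠ 0.
    product-forms-diagonal : ∀ x → product forms (x , x , x) ≢ 0#
    product-forms-diagonal x = product-≢0 {forms} diagonal
      where
      diagonal : ∀ {l} → l ∈ forms → linear l (x , x , x) ≢ 0#
      diagonal {t , a} l∈ e = proj₂ (∈-filter⁻ (λ a → ¬? (a ≟ᶠ 0#)) {xs = elems} (proj₂ (∈-cartesianProduct⁻ (allFin r) nonzeros l∈)))
        (begin
          a  ≡⟨ solve 4 (λ c c′ u a → a := :- ((c :* u :+ c′ :* u) :+ ((:- (c :+ c′)) :* u :+ :- a))) refl c c′ (lookup x t) a ⟩
          -ᶠ ((c *ᶠ lookup x t +ᶠ c′ *ᶠ lookup x t) +ᶠ ((-ᶠ (c +ᶠ c′)) *ᶠ lookup x t +ᶠ -ᶠ a)) ≡⟨ cong (λ s → -ᶠ ((c *ᶠ lookup x t +ᶠ c′ *ᶠ lookup x t) +ᶠ ((-ᶠ s) *ᶠ lookup x t +ᶠ -ᶠ a))) c+c′≡s ⟩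
          -ᶠ linear (t , a) (x , x , x)  ≡⟨ cong -ᶠ_ e ⟩
          -ᶠ 0#  ≡⟨ solve 0 (:- :0 := :0) refl ⟩
          0#  ∎)
        where open ≡-Reasoning

    Kills : (V r → 𝔽) → Set
    Kills h = ∀ α → (∀ t → lookup α t ≤ p) → 3 * Vec.sum α ≤ p * r → ∑ᶠ (λ x → h x *ᶠ monomial α x) ≡ 0#

    module _ {h v u : V r → 𝔽} (h-kills : Kills h) (v-kills : Kills v) (u-kills : Kills u) where

      weighted : (α β γ : Vec ℕ r) → X³ → 𝔽
      weighted α β γ (x , y , z) = (h x *ᶠ monomial α x) *ᶠ ((v y *ᶠ monomial β y) *ᶠ (u z *ᶠ monomial γ z))

      weighted-separates : ∀ α β γ → ∑ᶠ (weighted α β γ) ≡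
        ∑ᶠ (λ x → h x *ᶠ monomial α x) *ᶠ (∑ᶠ (λ y → v y *ᶠ monomial β y) *ᶠ ∑ᶠ (λ z → u z *ᶠ monomial γ z))
      weighted-separates α β γ = begin
        ∑ᶠ (weighted α β γ)  ≡⟨ ∑ᶠ-× _ ⟩
        ∑ᶠ (λ x → ∑ᶠ (λ yz → f x *ᶠ gh yz))  ≡⟨ ∑ᶠ-cong (λ x → ∑ᶠ-*ˡ (f x) gh) ⟩
        ∑ᶠ (λ x → f x *ᶠ ∑ᶠ gh)  ≡⟨ ∑ᶠ-*ʳ _ f ⟩
        ∑ᶠ f *ᶠ ∑ᶠ gh  ≡⟨ cong (∑ᶠ f *ᶠ_) (trans (∑ᶠ-× gh) (trans (∑ᶠ-cong λ y → ∑ᶠ-*ˡ (g y) k) (∑ᶠ-*ʳ _ g))) ⟩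
        ∑ᶠ f *ᶠ (∑ᶠ g *ᶠ ∑ᶠ k)  ∎
        where
        open ≡-Reasoning
        f g k : V r → 𝔽
        f x = h x *ᶠ monomial α x
        g y = v y *ᶠ monomial β y
        k z = u z *ᶠ monomial γ z
        gh : V r × V r → 𝔽
        gh (y , z) = g y *ᶠ k z

      -- Invariant of the expansion: the exponent reached so far plus the number of forms still to
      -- come in the same coordinate is at most p. It guarantees exponents at most p at the end, as
      -- membership in `low` requires.
      record Fits (α : Vec ℕ r) (L : List (Fin r × 𝔽)) : Set where
        constructor fits
        field fit : ∀ t → lookup α t + count t L ≤ p

      Fits-tail : ∀ {α l L} → Fits α (l ∷ L) → Fits α L
      Fits-tail {α} {t′ , _} {L} (fits f) = fits λ t → ≤-trans (+-monoʳ-≤ (lookup α t) (m≤n+m _ (𝟙 (t′ Fin.≟ t)))) (f t)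

      Fits-bump : ∀ {α t a L} → Fits α ((t , a) ∷ L) → Fits (bump t α) L
      Fits-bump {α} {t′} {_} {L} (fits f) = fits λ t → begin
        lookup (bump t′ α) t + count t L  ≡⟨ cong (_+ count t L) (trans (lookup-bump t′ t α) (+-comm (𝟙 (t′ Fin.≟ t)) _)) ⟩
        lookup α t + 𝟙 (t′ Fin.≟ t) + count t L  ≡⟨ +-assoc (lookup α t) _ _ ⟩
        lookup α t + (𝟙 (t′ Fin.≟ t) + count t L)  ≤⟨ f t ⟩
        p  ∎
        where open ≤-Reasoning

      one-third : ∀ a b c n → a + b + c ≤ n → 3 * a ≤ n ⊎ (3 * b ≤ n ⊎ 3 * c ≤ n)
      one-third a b c n le with 3 * a ≤? n | 3 * b ≤? n | 3 * c ≤? n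
      ... | yes p | _ | _ = inj₁ p
      ... | _ | yes p | _ = inj₂ (inj₁ p)
      ... | _ | _ | yes p = inj₂ (inj₂ p)
      ... | no a> | no b> | no c> = contradiction (*-monoʳ-≤ 3 le) (<⇒≱ (begin-strict
        3 * n  ≡⟨ eq₁ n ⟩
        n + n + n  <⟨ +-mono-< (+-mono-< (≰⇒> a>) (≰⇒> b>)) (≰⇒> c>) ⟩
        3 * a + 3 * b + 3 * c  ≡⟨ eq₂ a b c ⟩
        3 * (a + b + c)  ∎))
        where
        open ≤-Reasoning
        eq₁ : ∀ n → 3 * n ≡ n + n + n
        eq₁ = solve-∀
        eq₂ : ∀ a b c → 3 * a + 3 * b + 3 * c ≡ 3 * (a + b + c)
        eq₂ = solve-∀

      -- Expanding one linear form at a time, every resulting monomial has low degree in x, y or z.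
      annihilated : ∀ L α β γ → Fits α L → Fits β L → Fits γ L →
        Vec.sum α + Vec.sum β + Vec.sum γ + length L ≤ p * r → ∑ᶠ (λ w → weighted α β γ w *ᶠ product L w) ≡ 0#
      annihilated [] α β γ α≤ β≤ γ≤ deg = trans (∑ᶠ-cong λ w → *ᶠ-identityʳ _) (trans (weighted-separates α β γ) (vanish third))
        where
        third = one-third (Vec.sum α) (Vec.sum β) (Vec.sum γ) (p * r) (≤-trans (≤-reflexive (sym (+-identityʳ _))) deg)
        drop0 : ∀ {α} → Fits α [] → ∀ t → lookup α t ≤ p
        drop0 (fits f) t = ≤-trans (≤-reflexive (sym (+-identityʳ _))) (f t)
        vanish : 3 * Vec.sum α ≤ p * r ⊎ (3 * Vec.sum β ≤ p * r ⊎ 3 * Vec.sum γ ≤ p * r) →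
          ∑ᶠ (λ x → h x *ᶠ monomial α x) *ᶠ (∑ᶠ (λ y → v y *ᶠ monomial β y) *ᶠ ∑ᶠ (λ z → u z *ᶠ monomial γ z)) ≡ 0#
        vanish (inj₁ lo)        = *ᶠ-0ˡ (h-kills α (drop0 α≤) lo)
        vanish (inj₂ (inj₁ lo)) = *ᶠ-0ʳ (*ᶠ-0ˡ (v-kills β (drop0 β≤) lo))
        vanish (inj₂ (inj₂ lo)) = *ᶠ-0ʳ (*ᶠ-0ʳ (u-kills γ (drop0 γ≤) lo))
      annihilated (l@(t , a) ∷ L) α β γ α≤ β≤ γ≤ deg = begin
        ∑ᶠ (λ w → weighted α β γ w *ᶠ (linear l w *ᶠ product L w))  ≡⟨ ∑ᶠ-cong expand ⟩
        ∑ᶠ (λ w → (c *ᶠ A w +ᶠ c′ *ᶠ B w) +ᶠ ((-ᶠ s) *ᶠ C w +ᶠ (-ᶠ a) *ᶠ D w)) ≡⟨ trans (∑ᶠ-+ _ _) (cong₂ _+ᶠ_ (trans (∑ᶠ-+ _ _) (cong₂ _+ᶠ_ (∑ᶠ-*ˡ c A) (∑ᶠ-*ˡ c′ B))) (trans (∑ᶠ-+ _ _) (cong₂ _+ᶠ_ (∑ᶠ-*ˡ (-ᶠ s) C) (∑ᶠ-*ˡ (-ᶠ a) D)))) ⟩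
        (c *ᶠ ∑ᶠ A +ᶠ c′ *ᶠ ∑ᶠ B) +ᶠ ((-ᶠ s) *ᶠ ∑ᶠ C +ᶠ (-ᶠ a) *ᶠ ∑ᶠ D) ≡⟨ cong₂ _+ᶠ_ (cong₂ (λ e f → c *ᶠ e +ᶠ c′ *ᶠ f) A≡0 B≡0) (cong₂ (λ e f → (-ᶠ s) *ᶠ e +ᶠ (-ᶠ a) *ᶠ f) C≡0 D≡0) ⟩
        (c *ᶠ 0# +ᶠ c′ *ᶠ 0#) +ᶠ ((-ᶠ s) *ᶠ 0# +ᶠ (-ᶠ a) *ᶠ 0#)  ≡⟨ solve 4 (λ c d s a → (c :* :0 :+ d :* :0) :+ ((:- s) :* :0 :+ (:- a) :* :0) := :0) refl c c′ s a ⟩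
        0#  ∎
        where
        open ≡-Reasoning
        A B C D : X³ → 𝔽
        A w = weighted (bump t α) β γ w *ᶠ product L w
        B w = weighted α (bump t β) γ w *ᶠ product L w
        C w = weighted α β (bump t γ) w *ᶠ product L w
        D w = weighted α β γ w *ᶠ product L w
        expand : ∀ w → weighted α β γ w *ᶠ (linear l w *ᶠ product L w) ≡ (c *ᶠ A w +ᶠ c′ *ᶠ B w) +ᶠ ((-ᶠ s) *ᶠ C w +ᶠ (-ᶠ a) *ᶠ D w)
        expand (x , y , z) rewrite monomial-bump t α x | monomial-bump t β y | monomial-bump t γ z =
          solve 14 (λ c d s a xt yt zt hx vy uz mx my mz P →
            ((hx :* mx) :* ((vy :* my) :* (uz :* mz))) :* (((c :* xt :+ d :* yt) :+ ((:- s) :* zt :+ :- a)) :* P)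
            := (c :* (((hx :* (xt :* mx)) :* ((vy :* my) :* (uz :* mz))) :* P) :+ d :* (((hx :* mx) :* ((vy :* (yt :* my)) :* (uz :* mz))) :* P))
            :+ ((:- s) :* (((hx :* mx) :* ((vy :* my) :* (uz :* (zt :* mz)))) :* P) :+ (:- a) :* (((hx :* mx) :* ((vy :* my) :* (uz :* mz))) :* P)))
            refl c c′ s a (lookup x t) (lookup y t) (lookup z t) (h x) (v y) (u z) (monomial α x) (monomial β y) (monomial γ z) (product L (x , y , z))
        degree : ∀ {d} → suc d + length L ≤ p * r → d + length L ≤ p * r
        degree = ≤-trans (n≤1+n _)
        A≡0 = annihilated L (bump t α) β γ (Fits-bump α≤) (Fits-tail β≤) (Fits-tail γ≤)
          (subst (_≤ p * r) (trans (+-suc _ (length L)) (cong (λ e → e + Vec.sum β + Vec.sum γ + length L) (sym (sum-bump t α)))) deg)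
        B≡0 = annihilated L α (bump t β) γ (Fits-tail α≤) (Fits-bump β≤) (Fits-tail γ≤)
          (subst (_≤ p * r) (trans (lem (Vec.sum α) (Vec.sum β) (Vec.sum γ) (length L)) (cong (λ e → Vec.sum α + e + Vec.sum γ + length L) (sym (sum-bump t β)))) deg)
          where
          lem : ∀ a b c l → a + b + c + suc l ≡ a + suc b + c + l
          lem = solve-∀
        C≡0 = annihilated L α β (bump t γ) (Fits-tail α≤) (Fits-tail β≤) (Fits-bump γ≤)
          (subst (_≤ p * r) (trans (lem (Vec.sum α) (Vec.sum β) (Vec.sum γ) (length L)) (cong (λ e → Vec.sum α + Vec.sum β + e + length L) (sym (sum-bump t γ)))) deg)
          where
          lem : ∀ a b c l → a + b + c + suc l ≡ a + b + suc c + l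
          lem = solve-∀
        D≡0 = annihilated L α β γ (Fits-tail α≤) (Fits-tail β≤) (Fits-tail γ≤)
          (≤-trans (+-monoʳ-≤ (Vec.sum α + Vec.sum β + Vec.sum γ) (n≤1+n _)) deg)

    -- The weighted sum of the product of all forms has a single nonzero term, at (j , j , j).
    no-isolating-weights : (S : Subset (V r)) →
      (∀ {x y z} → T (S x) → T (S y) → T (S z) → c · x ⊕ c′ · y ≡ s · z → x ≡ y × y ≡ z) →
      ∀ {h v j} → Kills h → Kills v → h j ≡ 1# → v j ≡ 1# →
      (∀ x → h x ≡ 0# ⊎ T (S x)) → (∀ x → v x ≡ 0# ⊎ T (S x)) → (∀ x → x ≢ j → h x ≡ 0# ⊎ v x ≡ 0#) → ⊥
    no-isolating-weights S trivial {h} {v} {j} h-kills v-kills h-one v-one h-support v-support hv-support =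
      sum≢0 (annihilated h-kills v-kills v-kills forms zeros zeros zeros fits₀ fits₀ fits₀ degree)
      where
      zeros = Vec.replicate r 0
      fits₀ : Fits h-kills v-kills v-kills zeros forms
      fits₀ = fits λ t → ≤-reflexive (cong₂ _+_ (Vec.lookup-replicate t 0) (count-forms t))
      degree : Vec.sum zeros + Vec.sum zeros + Vec.sum zeros + length forms ≤ p * r
      degree = ≤-reflexive (cong₂ _+_ (cong₂ _+_ (cong₂ _+_ (sum-0 r) (sum-0 r)) (sum-0 r)) length-forms)
      summand : X³ → 𝔽
      summand w = weighted h-kills v-kills v-kills zeros zeros zeros w *ᶠ product forms w
      off-diagonal : ∀ w → w ≢ (j , j , j) → summand w ≡ 0#
      off-diagonal (x , y , z) w≢ = cases (h-support x) (v-support y) (v-support z) ((c · x ⊕ c′ · y) ≟ᵛ (s · z))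
        where
        on-diagonal : x ≡ y × y ≡ z → summand (x , y , z) ≡ 0#
        on-diagonal (refl , refl) with hv-support x (λ { refl → w≢ refl })
        ... | inj₁ ≡0 = *ᶠ-0ˡ (*ᶠ-0ˡ (*ᶠ-0ˡ ≡0))
        ... | inj₂ ≡0 = *ᶠ-0ˡ (*ᶠ-0ʳ (*ᶠ-0ˡ (*ᶠ-0ˡ ≡0)))
        cases : h x ≡ 0# ⊎ T (S x) → v y ≡ 0# ⊎ T (S y) → v z ≡ 0# ⊎ T (S z) → Dec (c · x ⊕ c′ · y ≡ s · z) →
          summand (x , y , z) ≡ 0#
        cases (inj₁ ≡0) _ _ _ = *ᶠ-0ˡ (*ᶠ-0ˡ (*ᶠ-0ˡ ≡0))
        cases _ (inj₁ ≡0) _ _ = *ᶠ-0ˡ (*ᶠ-0ʳ (*ᶠ-0ˡ (*ᶠ-0ˡ ≡0)))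
        cases _ _ (inj₁ ≡0) _ = *ᶠ-0ˡ (*ᶠ-0ʳ (*ᶠ-0ʳ (*ᶠ-0ˡ ≡0)))
        cases _ _ _ (no no-eq) = *ᶠ-0ʳ (product-forms-0 no-eq)
        cases (inj₂ x∈) (inj₂ y∈) (inj₂ z∈) (yes eq) = on-diagonal (trivial x∈ y∈ z∈ eq)
      unit : ∀ {a} → a ≡ 1# → a *ᶠ monomial zeros j ≡ 1#
      unit one = trans (cong₂ _*ᶠ_ one (monomial-0 j)) (*ᶠ-identityˡ 1#)
      at-j : summand (j , j , j) ≡ product forms (j , j , j)
      at-j = trans (cong (_*ᶠ product forms (j , j , j)) (trans (cong₂ _*ᶠ_ (unit h-one) (trans (cong₂ _*ᶠ_ (unit v-one) (unit v-one)) (*ᶠ-identityˡ 1#))) (*ᶠ-identityˡ 1#)))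
        (*ᶠ-identityˡ _)
      sum≢0 : ∑ᶠ summand ≢ 0#
      sum≢0 e = product-forms-diagonal j (trans (sym at-j) (trans (sym (∑ᶠ-single (j , j , j) off-diagonal)) e))

    -- If S were larger, two rounds of elimination, each using at most as many pivots as there are
    -- low monomials, would leave an element j of S outside both pivot sets. It would carry two
    -- weights killing all low monomials, one living on j and P, the other on j and P′. As P and P′
    -- are disjoint, the weights meet only at j, which `no-isolating-weights` rules out.
    solution-free-bound : (S : Subset (V r)) →
      (∀ {x y z} → T (S x) → T (S y) → T (S z) → c · x ⊕ c′ · y ≡ s · z → x ≡ y × y ≡ z) →
      # S ≤ 2 * length (low r)
    solution-free-bound S trivial with # S ≤? 2 * length (low r)
    ... | yes le = le
    ... | no ¬le = ⊥-elim (isolate (pivot S fs))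
      where
      open Pivot {V r} _≟ᵛ_
      open Pivoted
      fs = low-monomials r
      Pivots : Subset (V r) → List (V r) → Set
      Pivots S P = length P ≤ length fs × (∀ {x} → x ∈ P → T (S x)) × (∀ j → T (S j) → j ∉ P → Pivoted P fs j)
      kill : ∀ {P j} (d : Pivoted P fs j) → Kills (weight d)
      kill d α α≤p lo = All.lookup (kills d) (low-complete α α≤p lo)
      in-S : ∀ {P j} → (∀ {x} → x ∈ P → T (S x)) → T (S j) → (d : Pivoted P fs j) → ∀ x → weight d x ≡ 0# ⊎ T (S x)
      in-S P⊆S j∈ d x with support d x
      ... | inj₁ ≡0          = inj₁ ≡0
      ... | inj₂ (inj₁ refl) = inj₂ j∈
      ... | inj₂ (inj₂ x∈)   = inj₂ (P⊆S x∈)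
      isolate : ∃ (Pivots S) → ⊥
      -- The second elimination runs inside S without P, which is what makes the two pivot sets
      -- disjoint.
      isolate (P , P≤ , P⊆S , piv) = isolate′ (pivot (S ∩ outside?) fs)
        where
        outside? : ∀ x → Dec (x ∉ P)
        outside? x = ¬? (x ∈ˡ? P)
        isolate′ : ∃ (Pivots (S ∩ outside?)) → ⊥
        isolate′ (P′ , P′≤ , P′⊆ , piv′) = at (escape S (P ++ P′) (≤-<-trans (begin
          length (P ++ P′)  ≡⟨ length-++ P ⟩
          length P + length P′  ≤⟨ +-mono-≤ P≤ P′≤ ⟩
          length fs + length fs  ≡⟨ cong₂ _+_ (length-map _ (low r)) (trans (length-map _ (low r)) (sym (+-identityʳ _))) ⟩
          2 * length (low r)  ∎) (≰⇒> ¬le)))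
          where
          open ≤-Reasoning
          at : (∃ λ j → T (S j) × j ∉ P ++ P′) → ⊥
          at (j , j∈ , j∉) = no-isolating-weights S trivial (kill H) (kill H′) (one H) (one H′)
            (in-S (λ x∈ → proj₁ (∈-∩⁻ S outside? (P′⊆ x∈))) j∈ H) (in-S P⊆S j∈ H′) disjoint
            where
            H′ = piv j j∈ (j∉ ∘ ∈-++⁺ˡ)
            H = piv′ j (∈-∩⁺ S outside? j∈ (j∉ ∘ ∈-++⁺ˡ)) (j∉ ∘ ∈-++⁺ʳ P)
            disjoint : ∀ x → x ≢ j → weight H x ≡ 0# ⊎ weight H′ x ≡ 0#
            disjoint x x≢j with support H x | support H′ x
            ... | inj₁ ≡0 | _ = inj₁ ≡0
            ... | _ | inj₁ ≡0 = inj₂ ≡0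
            ... | inj₂ (inj₁ x≡j) | _ = contradiction x≡j x≢j
            ... | _ | inj₂ (inj₁ x≡j) = contradiction x≡j x≢j
            ... | inj₂ (inj₂ x∈P′) | inj₂ (inj₂ x∈P) = contradiction x∈P (proj₂ (∈-∩⁻ S outside? (P′⊆ x∈P′)))

  -- Counting monomials of low degree

  ^-distribʳ-* : ∀ o m n → (m * n) ^ o ≡ m ^ o * n ^ o
  ^-distribʳ-* zero    m n = refl
  ^-distribʳ-* (suc o) m n = trans (cong (m * n *_) (^-distribʳ-* o m n)) ([m*n]*[o*p]≡[m*o]*[n*p] m n _ _)

  -- This is (1 + 1/M)^j ≤ M / (M - j) for M = 2a and j = a; `go` proves the general case by
  -- induction on j, with e standing for M - j.
  [1+2a]^a≤2*[2a]^a : ∀ a → .{{NonZero a}} → suc (2 * a) ^ a ≤ 2 * (2 * a) ^ a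
  [1+2a]^a≤2*[2a]^a a = *-cancelʳ-≤ _ _ a (begin
    suc (2 * a) ^ a * a  ≤⟨ go a a (cong (a +_) (sym (+-identityʳ a))) ⟩
    (2 * a) ^ a * (2 * a)  ≡⟨ eq ((2 * a) ^ a) a ⟩
    2 * (2 * a) ^ a * a  ∎)
    where
    open ≤-Reasoning
    eq : ∀ x a → x * (2 * a) ≡ 2 * x * a
    eq = solve-∀
    go : ∀ {M} j e → j + e ≡ M → suc M ^ j * e ≤ M ^ j * M
    go zero e refl = ≤-refl
    go {M} (suc j) e refl = begin
      suc M * suc M ^ j * e  ≡⟨ eq₁ (suc M) (suc M ^ j) e ⟩
      suc M ^ j * (suc M * e)  ≤⟨ *-monoʳ-≤ (suc M ^ j) (m≤m+n _ (suc j)) ⟩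
      suc M ^ j * (suc M * e + suc j)  ≡⟨ eq₂ (suc M ^ j) j e ⟩
      M * (suc M ^ j * suc e)  ≤⟨ *-monoʳ-≤ M (go j (suc e) (+-suc j e)) ⟩
      M * (M ^ j * M)  ≡⟨ *-assoc M (M ^ j) M ⟨
      M * M ^ j * M  ∎
      where
      eq₁ : ∀ a b c → a * b * c ≡ b * (a * c)
      eq₁ = solve-∀
      eq₂ : ∀ y j e → y * (suc (suc j + e) * e + suc j) ≡ (suc j + e) * (y * suc e)
      eq₂ = solve-∀

  -- Bernoulli's inequality (1 + 1/a)^n ≥ 1 + n/a at n = a.
  2*a^a≤[1+a]^a : ∀ a → .{{NonZero a}} → 2 * a ^ a ≤ suc a ^ a
  2*a^a≤[1+a]^a a = *-cancelʳ-≤ _ _ a (begin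
    2 * a ^ a * a  ≡⟨ eq (a ^ a) a ⟩
    a ^ a * (a + a)  ≤⟨ go a ⟩
    suc a ^ a * a  ∎)
    where
    open ≤-Reasoning
    eq : ∀ x a → 2 * x * a ≡ x * (a + a)
    eq = solve-∀
    go : ∀ n → a ^ n * (a + n) ≤ suc a ^ n * a
    go zero = ≤-reflexive (cong (1 *_) (+-identityʳ a))
    go (suc n) = begin
      a * a ^ n * (a + suc n)  ≤⟨ m≤m+n _ (a ^ n * n) ⟩
      a * a ^ n * (a + suc n) + a ^ n * n ≡⟨ eq′ a (a ^ n) n ⟩
      suc a * (a ^ n * (a + n))  ≤⟨ *-monoʳ-≤ (suc a) (go n) ⟩
      suc a * (suc a ^ n * a)  ≡⟨ *-assoc (suc a) (suc a ^ n) a ⟨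
      suc a * suc a ^ n * a  ∎
      where
      eq′ : ∀ a x n → a * x * (a + suc n) + x * n ≡ suc a * (x * (a + n))
      eq′ = solve-∀

  n≤2^n : ∀ n → n ≤ 2 ^ n
  n≤2^n zero    = z≤n
  n≤2^n (suc n) = begin
    suc n  ≤⟨ +-mono-≤ (^-monoʳ-≤ 2 {0} {n} z≤n) (n≤2^n n) ⟩
    2 ^ n + 2 ^ n  ≡⟨ cong (2 ^ n +_) (+-identityʳ _) ⟨
    2 * 2 ^ n  ∎
    where open ≤-Reasoning

  power-of-two : ∀ n → .{{NonZero n}} → ∃ λ l → n ≤ 2 ^ l × 2 ^ l ≤ 2 * n
  power-of-two (suc zero) = 0 , ≤-refl , s≤s z≤n
  power-of-two (suc (suc n)) with power-of-two (suc n)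
  ... | l , lower , upper with suc (suc n) ≤? 2 ^ l
  ...   | yes le = l , le , ≤-trans upper (*-monoʳ-≤ 2 (n≤1+n (suc n)))
  ...   | no ¬le = suc l , (begin
      suc (suc n)  ≤⟨ s≤s (s≤s (m≤m+n n n)) ⟩
      suc (suc (n + n))  ≡⟨ eq n ⟩
      2 * suc n  ≤⟨ *-monoʳ-≤ 2 lower ⟩
      2 * 2 ^ l  ∎) , *-monoʳ-≤ 2 (<⇒≤ (≰⇒> ¬le))
    where
    open ≤-Reasoning
    eq : ∀ n → suc (suc (n + n)) ≡ 2 * suc n
    eq = solve-∀

  instance
    p-nonZero : NonZero p
    p-nonZero = >-nonZero (nonempty (∈-filter⁺ (λ a → ¬? (a ≟ᶠ 0#)) (complete 1#) (0ᶠ≢1ᶠ ∘ sym)))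
      where
      nonempty : ∀ {A : Set} {x : A} {xs} → x ∈ xs → 0 < length xs
      nonempty (here _)  = s≤s z≤n
      nonempty (there _) = s≤s z≤n

  -- Weighting a monomial exponent i by (M + 1)^(p − i) M^i makes the low-degree
  -- monomials heavy, as in a Chernoff bound; U^t bounds their weights from below.
  M : ℕ
  M = 2 * p

  weight-of : Fin (suc p) → ℕ
  weight-of i = suc M ^ (p ∸ toℕ i) * M ^ toℕ i

  W U : ℕ
  W = ∑ weight-of
  U = (suc M ^ p * suc M ^ p) * M ^ p

  instance
    M-nonZero : NonZero M
    M-nonZero = m*n≢0 2 p

    U-nonZero : NonZero U
    U-nonZero = m*n≢0 (suc M ^ p * suc M ^ p) (M ^ p) {{m*n≢0 _ _ {{m^n≢0 (suc M) p}} {{m^n≢0 (suc M) p}}}} {{m^n≢0 M p}}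

    W-nonZero : NonZero W
    W-nonZero = >-nonZero (<-≤-trans (>-nonZero⁻¹ _ {{m*n≢0 _ _ {{m^n≢0 (suc M) p}} {{m^n≢0 M 0}}}}) (∑-≥ {A = Fin (suc p)} zero weight-of))

  weight-of-scaled : ∀ i → weight-of i * suc M ^ toℕ i ≡ suc M ^ p * M ^ toℕ i
  weight-of-scaled i = begin
    suc M ^ (p ∸ toℕ i) * M ^ toℕ i * suc M ^ toℕ i  ≡⟨ eq (suc M ^ (p ∸ toℕ i)) (M ^ toℕ i) (suc M ^ toℕ i) ⟩
    (suc M ^ (p ∸ toℕ i) * suc M ^ toℕ i) * M ^ toℕ i  ≡⟨ cong (_* M ^ toℕ i) (^-distribˡ-+-* (suc M) (p ∸ toℕ i) (toℕ i)) ⟨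
    suc M ^ (p ∸ toℕ i + toℕ i) * M ^ toℕ i  ≡⟨ cong (λ e → suc M ^ e * M ^ toℕ i) (m∸n+n≡m (Fin.toℕ≤pred[n] i)) ⟩
    suc M ^ p * M ^ toℕ i  ∎
    where
    open ≡-Reasoning
    eq : ∀ a b c → a * b * c ≡ (a * c) * b
    eq = solve-∀

  vec-weight : ∀ {r} → Vec (Fin (suc p)) r → ℕ
  vec-weight α = ∏ λ t → weight-of (lookup α t)

  vec-weight-scaled : ∀ {r} (α : Vec (Fin (suc p)) r) → let d = Vec.sum (Vec.map toℕ α) in
    vec-weight α * suc M ^ d ≡ (suc M ^ p) ^ r * M ^ d
  vec-weight-scaled [] = cong (_* 1) (∏-zero _)
  vec-weight-scaled {suc r} (i ∷ α) = begin
    vec-weight (i ∷ α) * suc M ^ (toℕ i + d)  ≡⟨ cong₂ _*_ (∏-suc _) (^-distribˡ-+-* (suc M) (toℕ i) d) ⟩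
    (weight-of i * vec-weight α) * (suc M ^ toℕ i * suc M ^ d)  ≡⟨ [m*n]*[o*p]≡[m*o]*[n*p] (weight-of i) _ _ _ ⟩
    (weight-of i * suc M ^ toℕ i) * (vec-weight α * suc M ^ d)  ≡⟨ cong₂ _*_ (weight-of-scaled i) (vec-weight-scaled α) ⟩
    (suc M ^ p * M ^ toℕ i) * ((suc M ^ p) ^ r * M ^ d)  ≡⟨ [m*n]*[o*p]≡[m*o]*[n*p] (suc M ^ p) _ _ _ ⟩
    (suc M ^ p * (suc M ^ p) ^ r) * (M ^ toℕ i * M ^ d)  ≡⟨ cong ((suc M ^ p) ^ suc r *_) (^-distribˡ-+-* M (toℕ i) d) ⟨
    (suc M ^ p) ^ suc r * M ^ (toℕ i + d)  ∎
    where
    open ≡-Reasoning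
    d = Vec.sum (Vec.map toℕ α)

  low-weight : ∀ t (α : Vec (Fin (suc p)) (3 * t)) → 3 * Vec.sum (Vec.map toℕ α) ≤ p * (3 * t) → U ^ t ≤ vec-weight α
  low-weight t α lo = *-cancelʳ-≤ (U ^ t) _ (suc M ^ d) {{m^n≢0 (suc M) d}} (begin
    U ^ t * suc M ^ d  ≡⟨ cong (_* suc M ^ d) U^t ⟩
    (suc M ^ (p * t) * suc M ^ (p * t)) * M ^ (p * t) * suc M ^ d  ≡⟨ cong (λ e → (A * A) * M ^ e * suc M ^ d) (m+[n∸m]≡n d≤) ⟨
    (A * A) * M ^ (d + c) * suc M ^ d  ≡⟨ cong (λ e → (A * A) * e * suc M ^ d) (^-distribˡ-+-* M d c) ⟩
    (A * A) * (M ^ d * M ^ c) * suc M ^ d  ≤⟨ *-monoˡ-≤ (suc M ^ d) (*-monoʳ-≤ (A * A) (*-monoʳ-≤ (M ^ d) (^-monoˡ-≤ c (n≤1+n M)))) ⟩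
    (A * A) * (M ^ d * suc M ^ c) * suc M ^ d  ≡⟨ eq A (M ^ d) (suc M ^ c) (suc M ^ d) ⟩
    (A * (A * (suc M ^ d * suc M ^ c))) * M ^ d  ≡⟨ cong (λ e → (A * (A * e)) * M ^ d) (trans (sym (^-distribˡ-+-* (suc M) d c)) (cong (suc M ^_) (m+[n∸m]≡n d≤))) ⟩
    (A * (A * A)) * M ^ d  ≡⟨ cong (_* M ^ d) A³ ⟨
    (suc M ^ p) ^ (3 * t) * M ^ d  ≡⟨ vec-weight-scaled α ⟨
    vec-weight α * suc M ^ d  ∎)
    where
    open ≤-Reasoning
    d = Vec.sum (Vec.map toℕ α)
    A = suc M ^ (p * t)
    d≤ : d ≤ p * t
    d≤ = *-cancelˡ-≤ 3 (≤-trans lo (≤-reflexive (eq₀ p t)))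
      where
      eq₀ : ∀ p t → p * (3 * t) ≡ 3 * (p * t)
      eq₀ = solve-∀
    c = p * t ∸ d
    eq : ∀ a x y z → (a * a) * (x * y) * z ≡ (a * (a * (z * y))) * x
    eq = solve-∀
    U^t : U ^ t ≡ (A * A) * M ^ (p * t)
    U^t = trans (^-distribʳ-* t (suc M ^ p * suc M ^ p) (M ^ p)) (cong₂ _*_ (trans (^-distribʳ-* t (suc M ^ p) _) (cong₂ _*_ (^-*-assoc (suc M) p t) (^-*-assoc (suc M) p t))) (^-*-assoc M p t))
    A³ : (suc M ^ p) ^ (3 * t) ≡ A * (A * A)
    A³ = trans (trans (^-*-assoc (suc M) p (3 * t)) (trans (cong (suc M ^_) (eq₁ p t)) (^-distribˡ-+-* (suc M) (p * t) _)))
      (cong (A *_) (^-distribˡ-+-* (suc M) (p * t) _))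
      where
      eq₁ : ∀ p t → p * (3 * t) ≡ p * t + (p * t + p * t)
      eq₁ = solve-∀

  low-count : ∀ t → length (low (3 * t)) * U ^ t ≤ W ^ (3 * t)
  low-count t = begin
    length (low (3 * t)) * U ^ t  ≡⟨ cong (_* U ^ t) (trans (cong length (low-def (3 * t))) (length-filter-∑ lo? elems)) ⟩
    sumOver elems (𝟙 ∘ lo?) * U ^ t  ≡⟨ cong (_* U ^ t) (∑-def (𝟙 ∘ lo?)) ⟨
    ∑ (𝟙 ∘ lo?) * U ^ t  ≡⟨ ∑-*ʳ (U ^ t) (𝟙 ∘ lo?) ⟨
    ∑ (λ α → 𝟙 (lo? α) * U ^ t)  ≤⟨ ∑-mono (λ α → 𝟙*≤ (lo? α) (low-weight t α)) ⟩
    ∑ (λ α → vec-weight α)  ≡⟨ ∏-∑ {n = 3 * t} (λ _ → weight-of) ⟩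
    ∏ {3 * t} (λ _ → W)  ≡⟨ ∏-const W ⟩
    W ^ (3 * t)  ∎
    where
    open ≤-Reasoning
    lo? : (α : Vec (Fin (suc p)) (3 * t)) → Dec (3 * Vec.sum (Vec.map toℕ α) ≤ p * (3 * t))
    lo? α = 3 * Vec.sum (Vec.map toℕ α) ≤? p * (3 * t)

  rearrangement : ∀ {u v s t} → v ≤ u → t ≤ s → u * t + s * v ≤ u * s + v * t
  rearrangement {u} {v} {s} {t} v≤u t≤s = subst₂ (λ u s → u * t + s * v ≤ u * s + v * t) (m+[n∸m]≡n v≤u) (m+[n∸m]≡n t≤s)
    (≤-trans (m≤m+n _ ((u ∸ v) * (s ∸ t))) (≤-reflexive (eq v t (u ∸ v) (s ∸ t))))
    where
    eq : ∀ v t e f → (v + e) * t + (t + f) * v + e * f ≡ (v + e) * (t + f) + v * t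
    eq = solve-∀

  -- The reflection i ↦ p - i pairs the terms of W, and by the rearrangement inequality each pair
  -- sums to at most the pair of extreme terms. So W is at most q times the mean of (M + 1)^p and
  -- M^p.
  2W≤ : 2 * W ≤ q * (suc M ^ p + M ^ p)
  2W≤ = begin
    2 * W  ≡⟨ cong (W +_) (+-identityʳ W) ⟩
    W + W  ≤⟨ +-monoʳ-≤ W reflected ⟩
    W + ∑ (λ i → weight-of (opposite i))  ≡⟨ ∑-+ weight-of (weight-of ∘ opposite) ⟨
    ∑ (λ i → weight-of i + weight-of (opposite i))  ≤⟨ ∑-mono pair ⟩
    ∑ (λ (i : Fin (suc p)) → suc M ^ p + M ^ p)  ≡⟨ ∑-const _ ⟩
    ∣ Fin (suc p) ∣ * (suc M ^ p + M ^ p)  ≡⟨ cong (_* (suc M ^ p + M ^ p)) (trans (∣∣-def (Fin (suc p))) (trans (length-tabulate id) (sym q≡1+p))) ⟩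
    q * (suc M ^ p + M ^ p)  ∎
    where
    open ≤-Reasoning
    reflected : W ≤ ∑ (λ i → weight-of (opposite i))
    reflected = begin
      W  ≡⟨ ∑-cong (λ i → cong weight-of (Fin.opposite-involutive i)) ⟨
      ∑ (λ i → weight-of (opposite (opposite i)))  ≤⟨ ∑-injective opposite (λ e → trans (sym (Fin.opposite-involutive _)) (trans (cong opposite e) (Fin.opposite-involutive _))) (weight-of ∘ opposite) ⟩
      ∑ (λ i → weight-of (opposite i))  ∎
    pair : ∀ i → weight-of i + weight-of (opposite i) ≤ suc M ^ p + M ^ p
    pair i = begin
      weight-of i + weight-of (opposite i)  ≡⟨ cong (weight-of i +_) (cong₂ (λ a b → suc M ^ a * M ^ b) (trans (cong (p ∸_) opp) (m∸[m∸n]≡n i≤p)) opp) ⟩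
      suc M ^ (p ∸ toℕ i) * M ^ toℕ i + suc M ^ toℕ i * M ^ (p ∸ toℕ i)  ≤⟨ rearrangement (^-monoˡ-≤ (p ∸ toℕ i) (n≤1+n M)) (^-monoˡ-≤ (toℕ i) (n≤1+n M)) ⟩
      suc M ^ (p ∸ toℕ i) * suc M ^ toℕ i + M ^ (p ∸ toℕ i) * M ^ toℕ i  ≡⟨ cong₂ _+_ (whole (suc M)) (whole M) ⟩
      suc M ^ p + M ^ p  ∎
      where
      i≤p : toℕ i ≤ p
      i≤p = Fin.toℕ≤pred[n] i
      opp : toℕ (opposite i) ≡ p ∸ toℕ i
      opp = Fin.opposite-prop i
      whole : ∀ x → x ^ (p ∸ toℕ i) * x ^ toℕ i ≡ x ^ p
      whole x = trans (sym (^-distribˡ-+-* x (p ∸ toℕ i) (toℕ i))) (cong (x ^_) (m∸n+n≡m i≤p))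

  -- With a = b + d this compares the cube of the mean of a and b with a² b. For a = b (1 + ε) the
  -- two are b³ (1 + 3ε/2 + ...) and b³ (1 + 2ε + ...), so the second wins for small ε; writing b =
  -- d + e shows that d ≤ b is small enough, the difference having nonnegative coefficients.
  cube-bound : ∀ b d → 0 < d → d ≤ b → (b + d + b) * (b + d + b) * (b + d + b) < 8 * ((b + d) * (b + d) * b)
  cube-bound b d 0<d d≤b = subst (λ b → (b + d + b) * (b + d + b) * (b + d + b) < 8 * ((b + d) * (b + d) * b)) (m+[n∸m]≡n d≤b)
    (<-≤-trans (m<m+n _ (>-nonZero⁻¹ _ {{m*n≢0 (5 * d * d) d {{m*n≢0 (5 * d) d {{m*n≢0 5 d}}}}}}))
      (≤-trans (m≤m+n _ _) (≤-reflexive (eq d (b ∸ d)))))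
    where
    instance
      d-nonZero : NonZero d
      d-nonZero = >-nonZero 0<d
    eq : ∀ d e → (d + e + d + (d + e)) * (d + e + d + (d + e)) * (d + e + d + (d + e)) + 5 * d * d * d + (10 * d * d * e + 4 * d * e * e)
      ≡ 8 * ((d + e + d) * (d + e + d) * (d + e))
    eq = solve-∀

  -- The exponential saving: by `low-count` there are at most (W³ / U)^t low monomials in 3 t
  -- variables, to be compared with the q^(3 t) points of the space.
  W³<q³U : W * W * W < (q * q * q) * U
  W³<q³U = *-cancelˡ-< 8 _ _ (begin-strict
    8 * (W * W * W)  ≡⟨ eq₁ W ⟩
    (2 * W) * (2 * W) * (2 * W)  ≤⟨ *-mono-≤ (*-mono-≤ 2W≤ 2W≤) 2W≤ ⟩
    (q * s) * (q * s) * (q * s)  ≡⟨ eq₂ q s ⟩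
    (q * q * q) * (s * s * s)  <⟨ *-monoʳ-< (q * q * q) cube ⟩
    (q * q * q) * (8 * U)  ≡⟨ eq₃ (q * q * q) U ⟩
    8 * ((q * q * q) * U)  ∎)
    where
    open ≤-Reasoning
    s = suc M ^ p + M ^ p
    instance
      q-nonZero : NonZero q
      q-nonZero = subst NonZero (sym q≡1+p) _
      q³-nonZero : NonZero (q * q * q)
      q³-nonZero = m*n≢0 (q * q) q {{m*n≢0 q q}}
    b<a : M ^ p < suc M ^ p
    b<a = ^-monoˡ-< p (n<1+n M)
    a≡ : M ^ p + (suc M ^ p ∸ M ^ p) ≡ suc M ^ p
    a≡ = m+[n∸m]≡n (<⇒≤ b<a)
    cube : s * s * s < 8 * U
    cube = subst (λ a → (a + M ^ p) * (a + M ^ p) * (a + M ^ p) < 8 * (a * a * M ^ p)) a≡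
      -- The choice M = 2 p enters here: it gives (M + 1)^p ≤ 2 M^p, so the difference of the two
      -- powers is at most M^p.
      (cube-bound (M ^ p) (suc M ^ p ∸ M ^ p) (m<n⇒0<n∸m b<a) (m≤n+o⇒m∸n≤o (suc M ^ p) (M ^ p)
        (≤-trans ([1+2a]^a≤2*[2a]^a p) (≤-reflexive (cong (M ^ p +_) (+-identityʳ _))))))
    eq₁ : ∀ w → 8 * (w * w * w) ≡ (2 * w) * (2 * w) * (2 * w)
    eq₁ = solve-∀
    eq₂ : ∀ q s → (q * s) * (q * s) * (q * s) ≡ (q * q * q) * (s * s * s)
    eq₂ = solve-∀
    eq₃ : ∀ q u → q * (8 * u) ≡ 8 * (q * u)
    eq₃ = solve-∀

  -- Three-term equations

  instance
    q-nonZero : NonZero q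
    q-nonZero = subst NonZero (sym q≡1+p) _

    ∣Vec𝔽∣-nonZero : ∀ {n} → NonZero ∣ V n ∣
    ∣Vec𝔽∣-nonZero {n} = subst NonZero (sym (trans ∣Vec∣ (cong (_^ n) ∣𝔽∣))) (m^n≢0 q n)

  8*D≤D⁴ : ∀ D → 2 ≤ D → 8 * D ≤ D ^ 4
  8*D≤D⁴ D 2≤D = ≤-trans (≤-reflexive (*-comm 8 D)) (*-monoʳ-≤ D (^-monoˡ-≤ 3 2≤D))

  -- Put a = W³. Since a + 1 ≤ q³ U and (1 + 1/a)^a ≥ 2, every a blocks of three coordinates gain a
  -- factor 2. Taking a l blocks, with 2^l between 4 D and 8 D, gains 4 D, and q^(3 a l) is then a
  -- fixed power of 2^l ≤ 8 D ≤ D^4.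
  low-sparse : ∃ λ e → ∀ D → 2 ≤ D → ∃ λ r → 4 * D * length (low (suc r)) ≤ q ^ suc r × q ^ suc r ≤ D ^ e
  low-sparse = 4 * E , λ D 2≤D → let instance _ = >-nonZero (<-≤-trans (s≤s z≤n) 2≤D) in choose D 2≤D
    where
    a = W * W * W
    instance
      a-nonZero : NonZero a
      a-nonZero = m*n≢0 (W * W) W {{m*n≢0 W W}}
    E = q * (3 * a)
    choose : ∀ D .{{_ : NonZero D}} → 2 ≤ D → ∃ λ r → 4 * D * length (low (suc r)) ≤ q ^ suc r × q ^ suc r ≤ D ^ (4 * E)
    choose D 2≤D with power-of-two (4 * D) {{m*n≢0 4 D}}
    ... | zero , 4D≤1 , _ = contradiction (≤-trans (*-monoʳ-≤ 4 (≤-trans (s≤s z≤n) 2≤D)) 4D≤1) λ { (s≤s ()) }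
    ... | l@(suc _) , 4D≤ , ≤8D = Data.Nat.pred (3 * t) , subst (λ r → 4 * D * length (low r) ≤ q ^ r × q ^ r ≤ D ^ (4 * E))
        (sym (suc-pred (3 * t) {{m*n≢0 3 t}})) (sparse , bounded)
      where
      open ≤-Reasoning
      t = a * l
      instance
        t-nonZero : NonZero t
        t-nonZero = m*n≢0 a l
      L = length (low (3 * t))
      W^3t : W ^ (3 * t) ≡ (a ^ a) ^ l
      W^3t = trans (sym (^-*-assoc W 3 t)) (trans (cong (_^ t) (eq W)) (sym (^-*-assoc a a l)))
        where
        eq : ∀ w → w * (w * (w * 1)) ≡ w * w * w
        eq = solve-∀
      q^3t : (q * q * q) ^ t ≡ q ^ (3 * t)
      q^3t = trans (cong (_^ t) (eq q)) (^-*-assoc q 3 t)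
        where
        eq : ∀ w → w * w * w ≡ w * (w * (w * 1))
        eq = solve-∀
      sparse : 4 * D * L ≤ q ^ (3 * t)
      sparse = *-cancelʳ-≤ _ _ (U ^ t) {{m^n≢0 U t}} (begin
        4 * D * L * U ^ t  ≡⟨ *-assoc (4 * D) L _ ⟩
        4 * D * (L * U ^ t)  ≤⟨ *-mono-≤ 4D≤ (low-count t) ⟩
        2 ^ l * W ^ (3 * t)  ≡⟨ cong (2 ^ l *_) W^3t ⟩
        2 ^ l * (a ^ a) ^ l  ≡⟨ ^-distribʳ-* l 2 (a ^ a) ⟨
        (2 * a ^ a) ^ l  ≤⟨ ^-monoˡ-≤ l (2*a^a≤[1+a]^a a) ⟩
        (suc a ^ a) ^ l  ≡⟨ ^-*-assoc (suc a) a l ⟩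
        suc a ^ t  ≤⟨ ^-monoˡ-≤ t W³<q³U ⟩
        (q * q * q * U) ^ t  ≡⟨ ^-distribʳ-* t (q * q * q) U ⟩
        (q * q * q) ^ t * U ^ t  ≡⟨ cong (_* U ^ t) q^3t ⟩
        q ^ (3 * t) * U ^ t  ∎)
      bounded : q ^ (3 * t) ≤ D ^ (4 * E)
      bounded = begin
        q ^ (3 * t)  ≤⟨ ^-monoˡ-≤ (3 * t) (n≤2^n q) ⟩
        (2 ^ q) ^ (3 * t)  ≡⟨ ^-*-assoc 2 q (3 * t) ⟩
        2 ^ (q * (3 * t))  ≡⟨ cong (2 ^_) (eq q a l) ⟩
        2 ^ (l * E)  ≡⟨ ^-*-assoc 2 l E ⟨
        (2 ^ l) ^ E  ≤⟨ ^-monoˡ-≤ E (≤-trans ≤8D (≤-reflexive (sym (*-assoc 2 4 D)))) ⟩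
        (8 * D) ^ E  ≤⟨ ^-monoˡ-≤ E (8*D≤D⁴ D 2≤D) ⟩
        (D ^ 4) ^ E  ≡⟨ ^-*-assoc D 4 E ⟩
        D ^ (4 * E)  ∎
        where
        eq : ∀ q a l → q * (3 * (a * l)) ≡ l * (q * (3 * a))
        eq = solve-∀

  -- Averaging over affine images

  affine : ∀ {n r} → V n → Vec (V n) r → V r → V n
  affine w ws u = w ⊕ comb u ws

  ∑-shift : ∀ {n} (d : V n) (g : V n → ℕ) → ∑ (λ w → g (w ⊕ d)) ≤ ∑ g
  ∑-shift d = ∑-injective (_⊕ d) (⊕-cancelʳ d)

  ∑-shift⁻ : ∀ {n} (d : V n) (g : V n → ℕ) → ∑ g ≤ ∑ (λ w → g (w ⊕ d))
  ∑-shift⁻ d g = ≤-trans (≤-reflexive (∑-cong λ w → cong g (sym (undo w)))) (∑-shift ((-ᶠ 1#) · d) (λ w → g (w ⊕ d)))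
    where
    undo : ∀ w → (w ⊕ (-ᶠ 1#) · d) ⊕ d ≡ w
    undo w = trans (⊕-assoc w _ d) (trans (cong (w ⊕_) (trans (⊕-comm _ d) (⊕-inverseʳ d))) (⊕-identityʳ w))

  -- The images of two distinct points under a random affine map are independent and uniform: each
  -- pair (a , b) arises from at most N^r choices of (w , ws). If the first coordinates differ, then
  -- for fixed remaining vectors (w , w₀) is determined by the two images.
  affine-pairs : ∀ {n r} (u v : V (suc r)) → u ≢ v → (G : V n → V n → ℕ) →
    ∑ (λ w → ∑ λ ws → G (affine w ws u) (affine w ws v)) ≤ ∣ V n ∣ ^ r * ∑ λ a → ∑ λ b → G a b
  affine-pairs {n} {r} (u ∷ us) (v ∷ vs) u≢v G with u ≟ᶠ v
  ... | no u≢v₀ = begin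
    ∑ (λ w → ∑ λ ws → H w ws)  ≡⟨ ∑-cong (λ w → ∑-∷ _) ⟩
    ∑ (λ w → ∑ λ w₀ → ∑ λ ws → H w (w₀ ∷ ws))  ≡⟨ ∑-× (λ (w , w₀) → ∑ λ ws → H w (w₀ ∷ ws)) ⟨
    ∑ (λ (w , w₀) → ∑ λ ws → H w (w₀ ∷ ws))  ≡⟨ ∑-swap (λ (w , w₀) ws → H w (w₀ ∷ ws)) ⟩
    ∑ (λ ws → ∑ λ (w , w₀) → H w (w₀ ∷ ws))  ≤⟨ ∑-mono (λ ws → ∑-injective (pair ws) (pair-injective ws) (uncurry G)) ⟩
    ∑ (λ (_ : Vec (V n) r) → ∑ (uncurry G))  ≡⟨ ∑-const _ ⟩
    ∣ Vec (V n) r ∣ * ∑ (uncurry G)  ≡⟨ cong₂ _*_ ∣Vec∣ (∑-× (uncurry G)) ⟩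
    ∣ V n ∣ ^ r * ∑ (λ a → ∑ λ b → G a b)  ∎
    where
    open ≤-Reasoning
    H : V n → Vec (V n) (suc r) → ℕ
    H w ws = G (affine w ws (u ∷ us)) (affine w ws (v ∷ vs))
    pair : Vec (V n) r → V n × V n → V n × V n
    pair ws (w , w₀) = w ⊕ (u · w₀ ⊕ comb us ws) , w ⊕ (v · w₀ ⊕ comb vs ws)
    difference : ∀ {n} (w w₀ : V n) → (u +ᶠ -ᶠ v) · w₀ ≡ (w ⊕ u · w₀) ⊕ (-ᶠ 1#) · (w ⊕ v · w₀)
    difference []      []        = refl
    difference (w ∷ ws) (w₀ ∷ ws₀) = cong₂ _∷_
      (solve 4 (λ u v w x → (u :+ :- v) :* x := (w :+ u :* x) :+ (:- :1) :* (w :+ v :* x)) refl u v w w₀) (difference ws ws₀)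
    u-v≢0 : u +ᶠ -ᶠ v ≢ 0#
    u-v≢0 e = u≢v₀ (trans (solve 2 (λ u v → u := (u :+ :- v) :+ v) refl u v) (trans (cong (_+ᶠ v) e) (+ᶠ-identityˡ v)))
    pair-injective : ∀ ws {x y} → pair ws x ≡ pair ws y → x ≡ y
    pair-injective ws {w , w₀} {y , y₀} e = cong₂ _,_ (⊕-cancelʳ (u · w₀) (trans e₁ (cong (λ z → y ⊕ u · z) (sym w₀≡y₀)))) w₀≡y₀
      where
      e₁ : w ⊕ u · w₀ ≡ y ⊕ u · y₀
      e₁ = ⊕-cancelʳ (comb us ws) (trans (⊕-assoc w _ _) (trans (cong proj₁ e) (sym (⊕-assoc y _ _))))
      e₂ : w ⊕ v · w₀ ≡ y ⊕ v · y₀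
      e₂ = ⊕-cancelʳ (comb vs ws) (trans (⊕-assoc w _ _) (trans (cong proj₂ e) (sym (⊕-assoc y _ _))))
      w₀≡y₀ : w₀ ≡ y₀
      w₀≡y₀ = ·-cancel u-v≢0 (trans (difference w w₀) (trans (cong₂ (λ a b → a ⊕ (-ᶠ 1#) · b) e₁ e₂) (sym (difference y y₀))))
  -- Equal first coordinates: w₀ translates both images by the same vector u · w₀, which summation
  -- over all pairs absorbs, and the remaining coordinates still separate the points.
  affine-pairs {r = zero} (u ∷ []) (v ∷ []) u≢v G | yes refl = contradiction refl u≢v
  affine-pairs {n} {suc r} (u ∷ us) (v ∷ vs) u≢v G | yes refl = begin
    ∑ (λ w → ∑ λ ws → G (affine w ws (u ∷ us)) (affine w ws (u ∷ vs)))  ≡⟨ ∑-cong (λ w → trans (∑-∷ _) (∑-cong λ w₀ → ∑-cong λ ws → cong₂ G (move w w₀ us ws) (move w w₀ vs ws))) ⟩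
    ∑ (λ w → ∑ λ w₀ → ∑ λ ws → G′ w₀ (affine w ws us) (affine w ws vs))  ≡⟨ ∑-swap (λ w w₀ → ∑ λ ws → G′ w₀ (affine w ws us) (affine w ws vs)) ⟩
    ∑ (λ w₀ → ∑ λ w → ∑ λ ws → G′ w₀ (affine w ws us) (affine w ws vs))  ≤⟨ ∑-mono (λ w₀ → affine-pairs us vs (λ { refl → u≢v refl }) (G′ w₀)) ⟩
    ∑ (λ w₀ → N ^ r * ∑ λ a → ∑ λ b → G′ w₀ a b)  ≤⟨ ∑-mono (λ w₀ → *-monoʳ-≤ (N ^ r) (≤-trans (∑-mono λ a → ∑-shift (u · w₀) (G (a ⊕ u · w₀))) (∑-shift (u · w₀) (λ a → ∑ λ b → G a b)))) ⟩
    ∑ (λ (_ : V n) → N ^ r * ∑ λ a → ∑ λ b → G a b)  ≡⟨ ∑-const _ ⟩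
    N * (N ^ r * ∑ λ a → ∑ λ b → G a b)  ≡⟨ *-assoc N (N ^ r) _ ⟨
    N ^ suc r * ∑ (λ a → ∑ λ b → G a b)  ∎
    where
    open ≤-Reasoning
    N = ∣ V n ∣
    G′ : V n → V n → V n → ℕ
    G′ w₀ a b = G (a ⊕ u · w₀) (b ⊕ u · w₀)
    move : ∀ w w₀ us ws → affine w (w₀ ∷ ws) (u ∷ us) ≡ affine w ws us ⊕ u · w₀
    move w w₀ us ws = trans (cong (w ⊕_) (⊕-comm (u · w₀) _)) (sym (⊕-assoc w _ _))

  module Triples {c c′ s : 𝔽} (s≢0 : s ≢ 0#) (c+c′≡s : c +ᶠ c′ ≡ s) where

    solution? : ∀ {n} (x y z : V n) → Dec (c · x ⊕ c′ · y ≡ s · z)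
    solution? x y z = (c · x ⊕ c′ · y) ≟ᵛ (s · z)

    triple : ∀ {n} → Subset (V n) → V n → V n → V n → ℕ
    triple S x y z = 𝟙 (x ∈? S) * (𝟙 (y ∈? S) * (𝟙 (z ∈? S) * 𝟙 (solution? x y z)))

    triples : ∀ {n} → Subset (V n) → ℕ
    triples S = ∑ λ x → ∑ λ y → ∑ λ z → triple S x y z

    affine-solution : ∀ {n r} (w : V n) ws {x y z : V r} → c · x ⊕ c′ · y ≡ s · z →
      c · affine w ws x ⊕ c′ · affine w ws y ≡ s · affine w ws z
    affine-solution w ws {x} {y} {z} e = begin
      c · (w ⊕ comb x ws) ⊕ c′ · (w ⊕ comb y ws)  ≡⟨ cong₂ _⊕_ (·-distribˡ c w _) (·-distribˡ c′ w _) ⟩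
      (c · w ⊕ c · comb x ws) ⊕ (c′ · w ⊕ c′ · comb y ws)  ≡⟨ ⊕-interchange _ _ _ _ ⟩
      (c · w ⊕ c′ · w) ⊕ (c · comb x ws ⊕ c′ · comb y ws)  ≡⟨ cong₂ _⊕_ (·-distribʳ c c′ w) (cong₂ _⊕_ (comb-·ˡ c x ws) (comb-·ˡ c′ y ws)) ⟨
      (c +ᶠ c′) · w ⊕ (comb (c · x) ws ⊕ comb (c′ · y) ws)  ≡⟨ cong₂ (λ a b → a · w ⊕ b) c+c′≡s (sym (comb-⊕ˡ (c · x) (c′ · y) ws)) ⟩
      s · w ⊕ comb (c · x ⊕ c′ · y) ws  ≡⟨ cong (λ u → s · w ⊕ comb u ws) e ⟩
      s · w ⊕ comb (s · z) ws  ≡⟨ cong (s · w ⊕_) (comb-·ˡ s z ws) ⟩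
      s · w ⊕ s · comb z ws  ≡⟨ ·-distribˡ s w _ ⟨
      s · (w ⊕ comb z ws)  ∎
      where open ≡-Reasoning

    module _ {r : ℕ} where

      X³ : Set
      X³ = V r × V r × V r

      Nontrivial : X³ → Set
      Nontrivial (x , y , z) = c · x ⊕ c′ · y ≡ s · z × x ≢ y

      nontrivial? : ∀ u → Dec (Nontrivial u)
      nontrivial? (x , y , z) = solution? x y z ×-dec ¬? (x ≟ᵛ y)

      Within : Subset (V r) → X³ → Set
      Within S (x , y , z) = T (S x) × T (S y) × T (S z)

      within? : ∀ S u → Dec (Within S u)
      within? S (x , y , z) = (x ∈? S) ×-dec ((y ∈? S) ×-dec (z ∈? S))

      nontrivial-triples : Subset (V r) → ℕ
      nontrivial-triples S = ∑ λ u → 𝟙 (nontrivial? u) * 𝟙 (within? S u)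

      -- One nontrivial triple already makes the right side at least the size of the whole space;
      -- without any, the slice-rank bound applies. The crude factor is affordable because the
      -- dimension will be logarithmic in D.
      bound-by-triples : ∀ S → # S ≤ 2 * length (low r) + ∣ V r ∣ * nontrivial-triples S
      bound-by-triples S with ∃? (λ u → nontrivial? u ×-dec within? S u)
      ... | yes (u , nt , wi) = begin
        # S  ≤⟨ #≤ S ⟩
        ∣ V r ∣  ≡⟨ *-identityʳ _ ⟨
        ∣ V r ∣ * 1  ≡⟨ cong (∣ V r ∣ *_) (cong₂ _*_ (𝟙-yes (nontrivial? u) nt) (𝟙-yes (within? S u) wi)) ⟨
        ∣ V r ∣ * (𝟙 (nontrivial? u) * 𝟙 (within? S u))  ≤⟨ *-monoʳ-≤ ∣ V r ∣ (∑-≥ u (λ u → 𝟙 (nontrivial? u) * 𝟙 (within? S u))) ⟩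
        ∣ V r ∣ * nontrivial-triples S  ≤⟨ m≤n+m _ _ ⟩
        2 * length (low r) + ∣ V r ∣ * nontrivial-triples S  ∎
        where open ≤-Reasoning
      ... | no none = ≤-trans (SliceRank.solution-free-bound c+c′≡s r S trivial) (m≤m+n _ _)
        where
        trivial : ∀ {x y z} → T (S x) → T (S y) → T (S z) → c · x ⊕ c′ · y ≡ s · z → x ≡ y × y ≡ z
        trivial {x} {y} {z} x∈ y∈ z∈ eq with x ≟ᵛ y
        ... | no x≢y = contradiction ((x , y , z) , (eq , x≢y) , x∈ , y∈ , z∈) none
        ... | yes refl = refl , ·-cancel s≢0 (trans (trans (cong (_· x) (sym c+c′≡s)) (·-distribʳ c c′ x)) eq)

    -- `bound-by-triples` summed over the preimages of S under all affine maps. Every point of the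
    -- small space lands in S with frequency # S / N, which gives the left side; every nontrivial
    -- triple has x ≠ y, so `affine-pairs` bounds how often it lands in S.
    averaging : ∀ {n} r (S : Subset (V n)) → let N = ∣ V n ∣; R = ∣ V (suc r) ∣ in
      R * (N * # S) ≤ N * N * (2 * length (low (suc r))) + R * (R * R * R * triples S)
    averaging {n} r S = *-cancelˡ-≤ (N ^ r) {{m^n≢0 N r}} (begin
      N ^ r * (R * (N * # S))  ≡⟨ eq₁ (N ^ r) R N (# S) ⟩
      N * N ^ r * (R * # S)  ≤⟨ many-points ⟩
      ∑ (λ w → ∑ λ ws → # (image w ws))  ≤⟨ ∑-mono (λ w → ∑-mono λ ws → bound-by-triples (image w ws)) ⟩
      ∑ (λ w → ∑ λ ws → B + R * nontrivial-triples (image w ws))  ≡⟨ ∑-cong (λ w → trans (∑-+ _ _) (cong₂ _+_ (trans (∑-const B) (cong (_* B) ∣Vec∣)) (∑-*ˡ R _))) ⟩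
      ∑ (λ w → N ^ suc r * B + R * ∑ λ ws → nontrivial-triples (image w ws)) ≡⟨ trans (∑-+ _ _) (cong₂ _+_ (∑-const _) (∑-*ˡ R _)) ⟩
      N * (N ^ suc r * B) + R * ∑ (λ w → ∑ λ ws → nontrivial-triples (image w ws)) ≤⟨ +-monoʳ-≤ (N * (N ^ suc r * B)) (*-monoʳ-≤ R few-triples) ⟩
      N * (N ^ suc r * B) + R * (R * R * R * (N ^ r * triples S))  ≡⟨ eq₂ (N ^ r) N B R (triples S) ⟩
      N ^ r * (N * N * B + R * (R * R * R * triples S))  ∎)
      where
      open ≤-Reasoning
      N = ∣ V n ∣
      R = ∣ V (suc r) ∣
      B = 2 * length (low (suc r))
      eq₁ : ∀ x R N S → x * (R * (N * S)) ≡ N * x * (R * S)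
      eq₁ = solve-∀
      eq₂ : ∀ x N B R T → N * (N * x * B) + R * (R * R * R * (x * T)) ≡ x * (N * N * B + R * (R * R * R * T))
      eq₂ = solve-∀
      image : V n → Vec (V n) (suc r) → Subset (V (suc r))
      image w ws u = S (affine w ws u)
      many-points : N * N ^ r * (R * # S) ≤ ∑ λ w → ∑ λ ws → # (image w ws)
      many-points = begin
        N ^ suc r * (R * # S)  ≡⟨ cong (_* (R * # S)) ∣Vec∣ ⟨
        ∣ Vec (V n) (suc r) ∣ * (R * # S)  ≡⟨ trans (∑-cong (λ _ → ∑-const (# S))) (∑-const _) ⟨
        ∑ (λ (ws : Vec (V n) (suc r)) → ∑ λ (u : V (suc r)) → # S) ≤⟨ ∑-mono (λ ws → ∑-mono λ u → ∑-shift⁻ (comb u ws) (λ a → 𝟙 (a ∈? S))) ⟩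
        ∑ (λ ws → ∑ λ u → ∑ λ w → 𝟙 (affine w ws u ∈? S))  ≡⟨ ∑-cong (λ ws → ∑-swap (λ u w → 𝟙 (affine w ws u ∈? S))) ⟩
        ∑ (λ ws → ∑ λ w → # (image w ws))  ≡⟨ ∑-swap (λ ws w → # (image w ws)) ⟩
        ∑ (λ w → ∑ λ ws → # (image w ws))  ∎
      -- Summing over the third point leaves only the pair of images of x and y to be controlled.
      G : V n → V n → ℕ
      G a b = ∑ (triple S a b)
      per-triple : ∀ u → ∑ (λ w → ∑ λ ws → 𝟙 (nontrivial? u) * 𝟙 (within? (image w ws) u)) ≤ N ^ r * triples S
      per-triple u@(x , y , z) with nontrivial? u
      ... | no _ = ≤-trans (≤-reflexive (trans (∑-cong λ w → trans (∑-const 0) (*-zeroʳ ∣ Vec (V n) (suc r) ∣)) (trans (∑-const 0) (*-zeroʳ ∣ V n ∣)))) z≤n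
      ... | yes (eq , x≢y) = ≤-trans (∑-mono λ w → ∑-mono λ ws → counted w ws) (affine-pairs x y x≢y G)
        where
        counted : ∀ w ws → 1 * 𝟙 (within? (image w ws) u) ≤ G (affine w ws x) (affine w ws y)
        counted w ws = begin
          1 * 𝟙 (within? (image w ws) u)  ≡⟨ *-identityˡ _ ⟩
          𝟙 (within? (image w ws) u)  ≡⟨ trans (cong (𝟙 (a ∈? S) *_) (𝟙-× (b ∈? S) (d ∈? S))) (𝟙-× (a ∈? S) ((b ∈? S) ×-dec (d ∈? S))) ⟨
          𝟙 (a ∈? S) * (𝟙 (b ∈? S) * 𝟙 (d ∈? S))  ≡⟨ cong (λ e → 𝟙 (a ∈? S) * (𝟙 (b ∈? S) * e)) (trans (cong (𝟙 (d ∈? S) *_) (𝟙-yes (solution? a b d) (affine-solution w ws eq))) (*-identityʳ _)) ⟨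
          triple S a b d  ≤⟨ ∑-≥ d (triple S a b) ⟩
          G a b  ∎
          where
          a = affine w ws x
          b = affine w ws y
          d = affine w ws z
      few-triples : ∑ (λ w → ∑ λ ws → nontrivial-triples (image w ws)) ≤ R * R * R * (N ^ r * triples S)
      few-triples = begin
        ∑ (λ w → ∑ λ ws → nontrivial-triples (image w ws))  ≡⟨ ∑-cong (λ w → ∑-swap (λ ws u → f w ws u)) ⟩
        ∑ (λ w → ∑ λ u → ∑ λ ws → f w ws u)  ≡⟨ ∑-swap (λ w u → ∑ λ ws → f w ws u) ⟩
        ∑ (λ u → ∑ λ w → ∑ λ ws → f w ws u)  ≤⟨ ∑-mono per-triple ⟩
        ∑ (λ (u : X³) → K)  ≡⟨ trans (∑-× _) (trans (∑-cong λ _ → trans (∑-× _) (trans (∑-cong λ _ → ∑-const K) (∑-const _))) (∑-const _)) ⟩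
        R * (R * (R * K))  ≡⟨ eq R K ⟩
        R * R * R * K  ∎
        where
        K = N ^ r * triples S
        f : V n → Vec (V n) (suc r) → X³ → ℕ
        f w ws u = 𝟙 (nontrivial? u) * 𝟙 (within? (image w ws) u)
        eq : ∀ R K → R * (R * (R * K)) ≡ R * R * R * K
        eq = solve-∀

    -- Density makes the left side of `averaging` at least R N² / D, and the choice of r makes the
    -- slice-rank term at most half of this, so the triples account for the other half. The loss is
    -- 2 D R³, at most D^(2 + 3 e).
    supersaturation-step : ∀ e {n D r} (S : Subset (V n)) → 2 ≤ D → ∣ V n ∣ ≤ D * # S →
      4 * D * length (low (suc r)) ≤ q ^ suc r → q ^ suc r ≤ D ^ e →
      ∣ V n ∣ * ∣ V n ∣ ≤ D ^ (2 + 3 * e) * triples S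
    supersaturation-step e {n} {D} {r} S 2≤D dense sparse small = *-cancelˡ-≤ R (+-cancelʳ-≤ (R * (N * N)) _ _ (begin
      R * (N * N) + R * (N * N)  ≡⟨ eq₁ R N ⟩
      2 * (R * (N * N))  ≤⟨ *-monoʳ-≤ 2 (*-monoʳ-≤ R (*-monoʳ-≤ N dense)) ⟩
      2 * (R * (N * (D * # S)))  ≡⟨ eq₂ R N D (# S) ⟩
      2 * D * (R * (N * # S))  ≤⟨ *-monoʳ-≤ (2 * D) (averaging r S) ⟩
      2 * D * (N * N * (2 * L) + R * (R * R * R * t))  ≡⟨ eq₃ D N L R t ⟩
      4 * D * L * (N * N) + 2 * D * (R * (R * R * R * t))  ≤⟨ +-monoˡ-≤ _ (*-monoˡ-≤ (N * N) (≤-trans sparse (≤-reflexive (sym R≡)))) ⟩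
      R * (N * N) + 2 * D * (R * (R * R * R * t))  ≤⟨ +-monoʳ-≤ (R * (N * N)) (*-mono-≤ (*-monoˡ-≤ D 2≤D) (*-monoʳ-≤ R (*-monoˡ-≤ t (*-mono-≤ (*-mono-≤ R≤ R≤) R≤)))) ⟩
      R * (N * N) + D * D * (R * (D ^ e * D ^ e * D ^ e * t))  ≡⟨ trans (+-comm (R * (N * N)) _) (cong (_+ R * (N * N)) eq₄) ⟩
      R * (D ^ (2 + 3 * e) * t) + R * (N * N)  ∎))
      where
      open ≤-Reasoning
      N = ∣ V n ∣
      R = ∣ V (suc r) ∣
      L = length (low (suc r))
      t = triples S
      R≡ : R ≡ q ^ suc r
      R≡ = trans ∣Vec∣ (cong (_^ suc r) ∣𝔽∣)
      R≤ : R ≤ D ^ e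
      R≤ = ≤-trans (≤-reflexive R≡) small
      eq₁ : ∀ R N → R * (N * N) + R * (N * N) ≡ 2 * (R * (N * N))
      eq₁ = solve-∀
      eq₂ : ∀ R N D S → 2 * (R * (N * (D * S))) ≡ 2 * D * (R * (N * S))
      eq₂ = solve-∀
      eq₃ : ∀ D N L R t → 2 * D * (N * N * (2 * L) + R * (R * R * R * t)) ≡ 4 * D * L * (N * N) + 2 * D * (R * (R * R * R * t))
      eq₃ = solve-∀
      D^3e : D ^ (3 * e) ≡ D ^ e * D ^ e * D ^ e
      D^3e = trans (^-distribˡ-+-* D e _) (trans (cong (D ^ e *_) (trans (^-distribˡ-+-* D e _) (cong (λ k → D ^ e * D ^ k) (+-identityʳ e)))) (sym (*-assoc (D ^ e) _ _)))
      eq₄ : D * D * (R * (D ^ e * D ^ e * D ^ e * t)) ≡ R * (D ^ (2 + 3 * e) * t)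
      eq₄ = trans (lem D R (D ^ e * D ^ e * D ^ e) t) (cong (λ k → R * (D * (D * k) * t)) (sym D^3e))
        where
        lem : ∀ D R x t → D * D * (R * (x * t)) ≡ R * (D * (D * x) * t)
        lem = solve-∀

    triple-supersaturation : ∃ λ e → ∀ n D (S : Subset (V n)) → 2 ≤ D → ∣ V n ∣ ≤ D * # S →
      ∣ V n ∣ * ∣ V n ∣ ≤ D ^ e * triples S
    triple-supersaturation = from-sparse low-sparse
      where
      from-sparse : (∃ λ e → ∀ D → 2 ≤ D → ∃ λ r → 4 * D * length (low (suc r)) ≤ q ^ suc r × q ^ suc r ≤ D ^ e) →
        ∃ λ e → ∀ n D (S : Subset (V n)) → 2 ≤ D → ∣ V n ∣ ≤ D * # S →
        ∣ V n ∣ * ∣ V n ∣ ≤ D ^ e * triples S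
      from-sparse (e , choose) = 2 + 3 * e , λ n D S 2≤D dense →
        let r , sparse , small = choose D 2≤D in supersaturation-step e {r = r} S 2≤D dense sparse small

  -- Single equations

  D²-power : ∀ D e → (D * D) ^ e ≡ D ^ (2 * e)
  D²-power D e = trans (cong (_^ e) (cong (D *_) (sym (*-identityʳ D)))) (^-*-assoc D 2 e)

  ·-neg : ∀ {n} c (x : V n) → c · x ⊕ (-ᶠ c) · x ≡ 𝟎
  ·-neg c x = trans (sym (·-distribʳ c (-ᶠ c) x)) (trans (cong (_· x) (+ᶠ-inverseʳ c)) (·-zeroˡ x))

  isolateʳ : ∀ {n} c {x y z : V n} → c · x ⊕ y ≡ z → y ≡ z ⊕ (-ᶠ c) · x
  isolateʳ c {x} {y} refl = begin
    y  ≡⟨ ⊕-identityˡ y ⟨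
    𝟎 ⊕ y  ≡⟨ cong (_⊕ y) (·-neg c x) ⟨
    (c · x ⊕ (-ᶠ c) · x) ⊕ y  ≡⟨ ⊕-assoc (c · x) _ y ⟩
    c · x ⊕ ((-ᶠ c) · x ⊕ y)  ≡⟨ cong (c · x ⊕_) (⊕-comm _ y) ⟩
    c · x ⊕ (y ⊕ (-ᶠ c) · x)  ≡⟨ ⊕-assoc (c · x) y _ ⟨
    (c · x ⊕ y) ⊕ (-ᶠ c) · x  ∎
    where open ≡-Reasoning

  total : List 𝔽 → 𝔽
  total []       = 0#
  total (c ∷ cs) = c +ᶠ total cs

  rep : ∀ {n} → List 𝔽 → Subset (V n) → V n → ℕ
  rep []       S w = 𝟙 (w ≟ᵛ 𝟎)
  rep (c ∷ cs) S w = ∑ λ x → 𝟙 (x ∈? S) * rep cs S (w ⊕ (-ᶠ c) · x)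

  _⊆_ : ∀ {A : Set} → Subset A → Subset A → Set
  S ⊆ S′ = ∀ {a} → T (S a) → T (S′ a)

  rep-mono : ∀ {n} cs {S S′ : Subset (V n)} → S ⊆ S′ → ∀ w → rep cs S w ≤ rep cs S′ w
  rep-mono []       S⊆ w = ≤-refl
  rep-mono (c ∷ cs) {S} {S′} S⊆ w = ∑-mono λ x → *-mono-≤ (𝟙-mono (x ∈? S) (x ∈? S′) S⊆) (rep-mono cs S⊆ _)

  Dense : ∀ {n} → ℕ → Subset (V n) → Set
  Dense {n} D S = ∣ V n ∣ ≤ D * # S

  -- The number of solutions of Σ c_j x_j = (Σ c_j) z in S. There are |cs| + 1 variables and one
  -- equation, so N^|cs| is the order to be reached up to a power of D.
  diagonal-reps : ∀ {n} → List 𝔽 → Subset (V n) → ℕ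
  diagonal-reps cs S = ∑ λ z → 𝟙 (z ∈? S) * rep cs S (total cs · z)

  Supersaturated : List 𝔽 → ℕ → Set
  Supersaturated cs e = ∀ {n D} (S : Subset (V n)) → 2 ≤ D → Dense D S →
    ∣ V n ∣ ^ length cs ≤ D ^ e * diagonal-reps cs S

  -- A vector has at most N^(|cs| - 1) representations on average over the space; popular elements
  -- reach this order up to D^b. The missing factor N is moved to the right to avoid subtraction.
  Popular : ∀ {n} → List 𝔽 → ℕ → ℕ → Subset (V n) → V n → Set
  Popular {n} cs b D S z = ∣ V n ∣ ^ length cs ≤ D ^ b * (∣ V n ∣ * rep cs S (total cs · z))

  PopularSubset : ∀ {n} → List 𝔽 → ℕ → ℕ → Subset (V n) → Set
  PopularSubset cs b D S = ∃ λ S₁ → S₁ ⊆ S × Dense (D * D) S₁ × (∀ {z} → T (S₁ z) → Popular cs b D S z)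

  #-split : ∀ {A : Set} {{_ : Finite A}} {P : A → Set} (S : Subset A) (P? : ∀ a → Dec (P a)) →
    # S ≡ # (S ∩ P?) + # (S ∩ (¬? ∘ P?))
  #-split S P? = trans (∑-cong split) (∑-+ _ _)
    where
    split : ∀ a → 𝟙 (a ∈? S) ≡ 𝟙 (a ∈? (S ∩ P?)) + 𝟙 (a ∈? (S ∩ (¬? ∘ P?)))
    split a with a ∈? S | P? a
    ... | yes _ | yes _ = refl
    ... | yes _ | no _  = refl
    ... | no _  | yes _ = refl
    ... | no _  | no _  = refl

  -- Otherwise the unpopular elements would be dense, and supersaturation within them
  -- would give an element with many representations.
  popular-subset : ∀ {cs e} → Supersaturated cs e → ∀ {n D} (S : Subset (V n)) → 2 ≤ D → Dense D S →
    PopularSubset cs (suc (2 * e)) D S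
  popular-subset {cs} {e} sat {n} {D} S 2≤D dense =
    S₁ , (λ z∈ → proj₁ (∈-∩⁻ S pop? z∈)) , dense₁ , (λ z∈ → proj₂ (∈-∩⁻ S pop? z∈))
    where
    open ≤-Reasoning
    instance
      D-nonZero : NonZero D
      D-nonZero = >-nonZero (<-≤-trans (s≤s z≤n) 2≤D)
    N = ∣ V n ∣
    X = N ^ length cs
    -- Supersaturation is applied at density parameter D², which costs D^(2 e); one further factor D
    -- ≥ 2 makes the contradiction strict.
    b = suc (2 * e)
    pop? : ∀ z → Dec (Popular cs b D S z)
    pop? z = X ≤? D ^ b * (N * rep cs S (total cs · z))
    S₁ Bad : Subset (V n)
    S₁  = S ∩ pop?
    Bad = S ∩ (¬? ∘ pop?)
    bad-sparse : ¬ Dense (D * D) Bad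
    bad-sparse dense′ = <⇒≱ (begin-strict
      N * X  ≡⟨ *-identityˡ _ ⟨
      1 * (N * X)  <⟨ *-monoˡ-< (N * X) {{m*n≢0 N X {{it}} {{m^n≢0 N (length cs)}}}} 2≤D ⟩
      D * (N * X)  ∎) (begin
      D * (N * X)  ≤⟨ *-monoʳ-≤ D (*-monoʳ-≤ N (sat Bad (≤-trans 2≤D (m≤m*n D D)) dense′)) ⟩
      D * (N * ((D * D) ^ e * diagonal-reps cs Bad))  ≡⟨ cong (λ k → D * (N * (k * diagonal-reps cs Bad))) (D²-power D e) ⟩
      D * (N * (D ^ (2 * e) * diagonal-reps cs Bad))  ≡⟨ eq D N (D ^ (2 * e)) _ ⟩
      (D ^ b * N) * diagonal-reps cs Bad  ≡⟨ ∑-*ˡ (D ^ b * N) _ ⟨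
      ∑ (λ z → D ^ b * N * (𝟙 (z ∈? Bad) * rep cs Bad (total cs · z))) ≤⟨ ∑-mono unpopular ⟩
      ∑ (λ z → 𝟙 (z ∈? Bad) * X)  ≡⟨ ∑-*ʳ X _ ⟩
      # Bad * X  ≤⟨ *-monoˡ-≤ X (#≤ Bad) ⟩
      N * X  ∎)
      where
      eq : ∀ d n k t → d * (n * (k * t)) ≡ (d * k * n) * t
      eq = solve-∀
      unpopular : ∀ z → D ^ b * N * (𝟙 (z ∈? Bad) * rep cs Bad (total cs · z)) ≤ 𝟙 (z ∈? Bad) * X
      unpopular z with z ∈? Bad
      ... | no _ = ≤-trans (≤-reflexive (*-zeroʳ (D ^ b * N))) z≤n
      ... | yes z∈ = begin
        D ^ b * N * (1 * rep cs Bad (total cs · z))  ≤⟨ *-monoʳ-≤ (D ^ b * N) (*-monoʳ-≤ 1 (rep-mono cs (λ a∈ → proj₁ (∈-∩⁻ S (¬? ∘ pop?) a∈)) (total cs · z))) ⟩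
        D ^ b * N * (1 * rep cs S (total cs · z))  ≡⟨ trans (cong (D ^ b * N *_) (*-identityˡ _)) (*-assoc (D ^ b) N _) ⟩
        D ^ b * (N * rep cs S (total cs · z))  ≤⟨ <⇒≤ (≰⇒> (proj₂ (∈-∩⁻ S (¬? ∘ pop?) z∈))) ⟩
        X  ≡⟨ *-identityˡ X ⟨
        1 * X  ∎
    -- From D² # Bad < N ≤ D # S and D ≥ 2: at least half of S is popular, and 2 D ≤ D² is the new
    -- density parameter.
    few-bad : 2 * # Bad ≤ # S
    few-bad = *-cancelˡ-≤ D (begin
      D * (2 * # Bad)  ≤⟨ *-monoʳ-≤ D (*-monoˡ-≤ (# Bad) 2≤D) ⟩
      D * (D * # Bad)  ≡⟨ *-assoc D D _ ⟨
      D * D * # Bad  ≤⟨ <⇒≤ (≰⇒> bad-sparse) ⟩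
      N  ≤⟨ dense ⟩
      D * # S  ∎)
    half : # S ≤ 2 * # S₁
    half = +-cancelʳ-≤ (2 * # Bad) _ _ (begin
      # S + 2 * # Bad  ≤⟨ +-monoʳ-≤ (# S) few-bad ⟩
      # S + # S  ≡⟨ cong (# S +_) (+-identityʳ (# S)) ⟨
      2 * # S  ≡⟨ cong (2 *_) (#-split S pop?) ⟩
      2 * (# S₁ + # Bad)  ≡⟨ *-distribˡ-+ 2 (# S₁) _ ⟩
      2 * # S₁ + 2 * # Bad  ∎)
    dense₁ : Dense (D * D) S₁
    dense₁ = begin
      N  ≤⟨ dense ⟩
      D * # S  ≤⟨ *-monoʳ-≤ D (≤-trans half (*-monoˡ-≤ (# S₁) 2≤D)) ⟩
      D * (D * # S₁)  ≡⟨ *-assoc D D _ ⟨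
      D * D * # S₁  ∎

  module _ {n b D} {cs : List 𝔽} {S S₁ : Subset (V n)}
    (popular : ∀ {z} → T (S₁ z) → Popular cs b D S z) (σ≢0 : total cs ≢ 0#) where

    -- Trades a popular variable for representations. As the total is nonzero, total · y = w leaves
    -- a single candidate y, and if it lies in S₁ then w has at least N^|cs| / (D^b N)
    -- representations in S.
    absorb : ∀ {w} {P : V n → Set} (P? : ∀ y → Dec (P y)) → (∀ {y} → P y → total cs · y ≡ w) →
      ∑ (λ y → 𝟙 (y ∈? S₁) * 𝟙 (P? y)) * ∣ V n ∣ ^ length cs ≤ D ^ b * (∣ V n ∣ * rep cs S w)
    absorb {w} P? P⇒ = begin
      ∑ (λ y → 𝟙 (y ∈? S₁) * 𝟙 (P? y)) * X  ≡⟨ ∑-*ʳ X _ ⟨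
      ∑ (λ y → 𝟙 (y ∈? S₁) * 𝟙 (P? y) * X)  ≤⟨ ∑-mono each ⟩
      ∑ (λ y → 𝟙 (y₀ ≟ᵛ y) * K)  ≡⟨ ∑-pick _≟ᵛ_ y₀ (λ _ → K) ⟩
      K  ∎
      where
      open ≤-Reasoning
      X = ∣ V n ∣ ^ length cs
      K = D ^ b * (∣ V n ∣ * rep cs S w)
      y₀ = (total cs ⁻¹) · w
      each : ∀ y → 𝟙 (y ∈? S₁) * 𝟙 (P? y) * X ≤ 𝟙 (y₀ ≟ᵛ y) * K
      each y = ≤-trans (≤-reflexive (cong (_* X) (𝟙-× (y ∈? S₁) (P? y)))) (𝟙-*-mono ((y ∈? S₁) ×-dec P? y) (y₀ ≟ᵛ y)
        (λ (_ , p) → trans (cong ((total cs ⁻¹) ·_) (sym (P⇒ p))) (⁻¹-· σ≢0 y))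
        (λ (y∈ , p) → ≤-trans (popular y∈) (≤-reflexive (cong (λ v → D ^ b * (∣ V n ∣ * rep cs S v)) (P⇒ p)))))

  2≤D² : ∀ {D} → 2 ≤ D → 2 ≤ D * D
  2≤D² {D} 2≤D = ≤-trans 2≤D (m≤m*n D D {{>-nonZero (<-≤-trans (s≤s z≤n) 2≤D)}})

  supersaturated-[_] : ∀ c → Supersaturated (c ∷ []) 1
  supersaturated-[ c ] {n} {D} S 2≤D dense = begin
    ∣ V n ∣ * 1  ≡⟨ *-identityʳ _ ⟩
    ∣ V n ∣  ≤⟨ dense ⟩
    D * # S  ≡⟨ cong (_* # S) (*-identityʳ D) ⟨
    D * 1 * # S  ≤⟨ *-monoʳ-≤ (D * 1) (∑-mono self) ⟩
    D * 1 * diagonal-reps (c ∷ []) S  ∎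
    where
    open ≤-Reasoning
    self : ∀ z → 𝟙 (z ∈? S) ≤ 𝟙 (z ∈? S) * rep (c ∷ []) S ((c +ᶠ 0#) · z)
    self z with z ∈? S in z∈?
    ... | no _ = z≤n
    ... | yes z∈ = ≤-trans (≤-reflexive (sym term)) (≤-trans (∑-≥ z f) (≤-reflexive (sym (*-identityˡ _))))
      where
      f : V n → ℕ
      f x = 𝟙 (x ∈? S) * 𝟙 (((c +ᶠ 0#) · z ⊕ (-ᶠ c) · x) ≟ᵛ 𝟎)
      term : f z ≡ 1
      term = cong₂ _*_ (𝟙-yes (z ∈? S) z∈) (𝟙-yes (_ ≟ᵛ 𝟎) (trans (cong (λ a → a · z ⊕ (-ᶠ c) · z) (+ᶠ-identityʳ c)) (·-neg c z)))

  -- The tail is first treated as one variable: c x + σ′ y = σ z has many solutions in the popular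
  -- set, where σ′ is the sum of the tail, and `absorb` then expands σ′ y. The popular set has
  -- density parameter D², which doubles the exponent of the three-term bound.
  supersaturated-∷ : ∀ {c cs e} → c +ᶠ total cs ≢ 0# → total cs ≢ 0# → Supersaturated cs e →
    ∃ (Supersaturated (c ∷ cs))
  supersaturated-∷ {c} {cs} {e} σ≢0 σ′≢0 sat = from-triples triple-supersaturation
    where
    open Triples σ≢0 refl
    b = suc (2 * e)
    module _ {n D} {S S₁ : Subset (V n)} (S₁⊆S : S₁ ⊆ S) (popular : ∀ {z} → T (S₁ z) → Popular cs b D S z) where
      open ≤-Reasoning
      count-triples : triples S₁ * ∣ V n ∣ ^ length cs ≤ D ^ b * (∣ V n ∣ * diagonal-reps (c ∷ cs) S)
      count-triples = begin
        triples S₁ * X  ≡⟨ cong (_* X) rearranged ⟩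
        ∑ (λ z → ∑ λ x → 𝟙 (z ∈? S₁) * (𝟙 (x ∈? S₁) * ∑ λ y → 𝟙 (y ∈? S₁) * sol x y z)) * X ≡⟨ trans (sym (∑-*ʳ X _)) (∑-cong λ z → trans (sym (∑-*ʳ X _)) (∑-cong λ x → eq₁ (𝟙 (z ∈? S₁)) (𝟙 (x ∈? S₁)) _ X)) ⟩
        ∑ (λ z → ∑ λ x → 𝟙 (z ∈? S₁) * (𝟙 (x ∈? S₁) * (∑ (λ y → 𝟙 (y ∈? S₁) * sol x y z) * X))) ≤⟨ ∑-mono (λ z → ∑-mono λ x → *-mono-≤ (𝟙-mono (z ∈? S₁) (z ∈? S) S₁⊆S)
                    (*-mono-≤ (𝟙-mono (x ∈? S₁) (x ∈? S) S₁⊆S)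
                    (absorb {b = b} {D} {cs} {S} {S₁} popular σ′≢0 (λ y → solution? x y z) (isolateʳ c)))) ⟩
        ∑ (λ z → ∑ λ x → 𝟙 (z ∈? S) * (𝟙 (x ∈? S) * (D ^ b * (N * rep cs S (σ · z ⊕ (-ᶠ c) · x))))) ≡⟨ ∑-cong (λ z → trans (∑-cong λ x → eq₂ (𝟙 (z ∈? S)) (𝟙 (x ∈? S)) (D ^ b) N _) (trans (∑-*ˡ (D ^ b * N) _) (cong (D ^ b * N *_) (∑-*ˡ (𝟙 (z ∈? S)) _)))) ⟩
        ∑ (λ z → D ^ b * N * (𝟙 (z ∈? S) * rep (c ∷ cs) S (σ · z)))  ≡⟨ ∑-*ˡ (D ^ b * N) _ ⟩
        D ^ b * N * diagonal-reps (c ∷ cs) S  ≡⟨ *-assoc (D ^ b) N _ ⟩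
        D ^ b * (N * diagonal-reps (c ∷ cs) S)  ∎
        where
        N = ∣ V n ∣
        X = N ^ length cs
        σ = c +ᶠ total cs
        sol : V n → V n → V n → ℕ
        sol x y z = 𝟙 (solution? x y z)
        eq₁ : ∀ a b c X → a * (b * c) * X ≡ a * (b * (c * X))
        eq₁ = solve-∀
        eq₂ : ∀ a b d N r → a * (b * (d * (N * r))) ≡ d * N * (a * (b * r))
        eq₂ = solve-∀
        eq₃ : ∀ x y z s → x * (y * (z * s)) ≡ z * (x * (y * s))
        eq₃ = solve-∀
        rearranged : triples S₁ ≡ ∑ (λ z → ∑ λ x → 𝟙 (z ∈? S₁) * (𝟙 (x ∈? S₁) * ∑ λ y → 𝟙 (y ∈? S₁) * sol x y z))
        rearranged = begin-equality
          ∑ (λ x → ∑ λ y → ∑ λ z → triple S₁ x y z)  ≡⟨ ∑-cong (λ x → ∑-swap (triple S₁ x)) ⟩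
          ∑ (λ x → ∑ λ z → ∑ λ y → triple S₁ x y z)  ≡⟨ ∑-swap (λ x z → ∑ λ y → triple S₁ x y z) ⟩
          ∑ (λ z → ∑ λ x → ∑ λ y → triple S₁ x y z)  ≡⟨ ∑-cong (λ z → ∑-cong λ x → trans (∑-cong λ y → eq₃ (𝟙 (x ∈? S₁)) (𝟙 (y ∈? S₁)) (𝟙 (z ∈? S₁)) (sol x y z))
                    (trans (∑-*ˡ (𝟙 (z ∈? S₁)) _) (cong (𝟙 (z ∈? S₁) *_) (∑-*ˡ (𝟙 (x ∈? S₁)) _)))) ⟩
          ∑ (λ z → ∑ λ x → 𝟙 (z ∈? S₁) * (𝟙 (x ∈? S₁) * ∑ λ y → 𝟙 (y ∈? S₁) * sol x y z)) ∎
    from-triples : (∃ λ e′ → ∀ n D (S : Subset (V n)) → 2 ≤ D → ∣ V n ∣ ≤ D * # S →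
      ∣ V n ∣ * ∣ V n ∣ ≤ D ^ e′ * triples S) → ∃ (Supersaturated (c ∷ cs))
    from-triples (e′ , many) = 2 * e′ + b , bound
      where
      bound : Supersaturated (c ∷ cs) (2 * e′ + b)
      bound {n} {D} S 2≤D dense = conclude (popular-subset {cs} {e} sat S 2≤D dense)
        where
        open ≤-Reasoning
        conclude : PopularSubset cs b D S →
          ∣ V n ∣ * ∣ V n ∣ ^ length cs ≤ D ^ (2 * e′ + b) * diagonal-reps (c ∷ cs) S
        conclude (S₁ , S₁⊆S , dense₁ , popular) = *-cancelˡ-≤ N (begin
          N * (N * X)  ≡⟨ *-assoc N N X ⟨
          N * N * X  ≤⟨ *-monoˡ-≤ X (many n (D * D) S₁ (2≤D² 2≤D) dense₁) ⟩
          (D * D) ^ e′ * triples S₁ * X  ≡⟨ trans (*-assoc ((D * D) ^ e′) _ X) (cong (_* (triples S₁ * X)) (D²-power D e′)) ⟩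
          D ^ (2 * e′) * (triples S₁ * X)  ≤⟨ *-monoʳ-≤ (D ^ (2 * e′)) (count-triples {D = D} S₁⊆S popular) ⟩
          D ^ (2 * e′) * (D ^ b * (N * diag))  ≡⟨ eq (D ^ (2 * e′)) (D ^ b) N diag ⟩
          N * (D ^ (2 * e′) * D ^ b * diag)  ≡⟨ cong (λ k → N * (k * diag)) (^-distribˡ-+-* D (2 * e′) b) ⟨
          N * (D ^ (2 * e′ + b) * diag)  ∎)
          where
          N = ∣ V n ∣
          X = N ^ length cs
          diag = diagonal-reps (c ∷ cs) S
          eq : ∀ a b N d → a * (b * (N * d)) ≡ N * (a * b * d)
          eq = solve-∀

  pair-collisions : ∀ {n} (c s : 𝔽) (S : Subset (V n)) → let I = λ x → 𝟙 (x ∈? S) in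
    (# S * # S) * (# S * # S) ≤ ∣ V n ∣ *
      ∑ λ z → ∑ λ x → ∑ λ u → I z * (I x * (I u * ∑ λ y → I y * 𝟙 ((c · x ⊕ s · y) ≟ᵛ (c · z ⊕ s · u))))
  pair-collisions {n} c s S = begin
    (# S * # S) * (# S * # S)  ≡⟨ cong₂ _*_ ∑f ∑f ⟨
    ∑ f * ∑ f  ≤⟨ collisions _≟ᵛ_ h f ⟩
    ∣ V n ∣ * ∑ (λ a → ∑ λ a′ → f a * (f a′ * 𝟙 (h a ≟ᵛ h a′))) ≡⟨ cong (∣ V n ∣ *_) (trans (∑-× _) (∑-cong λ z →
      trans (∑-cong λ u → trans (∑-× _) (∑-cong λ x → trans (∑-cong λ y → each z x u y) (pull z x u))) (∑-swap (λ u x → I z * (I x * (I u * Y z x u)))))) ⟩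
    ∣ V n ∣ * ∑ (λ z → ∑ λ x → ∑ λ u → I z * (I x * (I u * Y z x u))) ∎
    where
    open ≤-Reasoning
    I : V n → ℕ
    I x = 𝟙 (x ∈? S)
    f : V n × V n → ℕ
    f (a , b) = I a * I b
    h : V n × V n → V n
    h (a , b) = c · a ⊕ s · b
    ∑f : ∑ f ≡ # S * # S
    ∑f = trans (∑-× f) (trans (∑-cong λ a → ∑-*ˡ (I a) I) (∑-*ʳ (# S) I))
    E : V n → V n → V n → V n → ℕ
    E z x u y = 𝟙 ((c · x ⊕ s · y) ≟ᵛ (c · z ⊕ s · u))
    Y : V n → V n → V n → ℕ
    Y z x u = ∑ λ y → I y * E z x u y
    eq : ∀ z u x y e → z * u * (x * y * e) ≡ z * (x * (u * (y * e)))
    eq = solve-∀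
    each : ∀ z x u y → I z * I u * (I x * I y * 𝟙 (h (z , u) ≟ᵛ h (x , y))) ≡ I z * (I x * (I u * (I y * E z x u y)))
    each z x u y = trans (eq (I z) (I u) (I x) (I y) _)
      (cong (λ k → I z * (I x * (I u * (I y * k)))) (𝟙-cong (h (z , u) ≟ᵛ h (x , y)) (h (x , y) ≟ᵛ h (z , u)) sym sym))
    pull : ∀ z x u → ∑ (λ y → I z * (I x * (I u * (I y * E z x u y)))) ≡ I z * (I x * (I u * Y z x u))
    pull z x u = trans (∑-*ˡ (I z) _) (cong (I z *_) (trans (∑-*ˡ (I x) _) (cong (I x *_) (∑-*ˡ (I u) _))))

  -- Here the coefficients other than c cancel, and z − x is represented in two ways as a
  -- difference: solutions come from collisions of c z + s u, with s the sum of cs.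
  supersaturated-∷∷ : ∀ {c c₂ cs e} → c₂ +ᶠ total cs ≡ 0# → total cs ≢ 0# → Supersaturated cs e →
    Supersaturated (c ∷ c₂ ∷ cs) (8 + suc (2 * e))
  supersaturated-∷∷ {c} {c₂} {cs} {e} cancel s≢0 sat {n} {D} S 2≤D dense = conclude (popular-subset {cs} {e} sat S 2≤D dense)
    where
    N = ∣ V n ∣
    X = N ^ length cs
    b = suc (2 * e)
    s = total cs
    σ = c +ᶠ (c₂ +ᶠ s)
    s≡-c₂ : s ≡ -ᶠ c₂
    s≡-c₂ = trans (solve 2 (λ a b → b := (:- a) :+ (a :+ b)) refl c₂ s) (trans (cong ((-ᶠ c₂) +ᶠ_) cancel) (+ᶠ-identityʳ _))
    σ≡c : σ ≡ c
    σ≡c = trans (cong (c +ᶠ_) cancel) (+ᶠ-identityʳ c)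
    -- What remains for `cs` to represent in c x + c₂ u + ... = σ z. Since σ = c and -c₂ = s, a
    -- collision c x + s y = c z + s u says that s y is exactly this vector.
    target : V n → V n → V n → V n
    target z x u = (σ · z ⊕ (-ᶠ c) · x) ⊕ (-ᶠ c₂) · u
    hits : ∀ {z x u y} → c · x ⊕ s · y ≡ c · z ⊕ s · u → s · y ≡ target z x u
    hits {z} {x} {u} {y} eq = begin
      s · y  ≡⟨ isolateʳ c eq ⟩
      (c · z ⊕ s · u) ⊕ (-ᶠ c) · x  ≡⟨ ⊕-assoc (c · z) _ _ ⟩
      c · z ⊕ (s · u ⊕ (-ᶠ c) · x)  ≡⟨ cong (c · z ⊕_) (⊕-comm (s · u) _) ⟩
      c · z ⊕ ((-ᶠ c) · x ⊕ s · u)  ≡⟨ ⊕-assoc (c · z) _ _ ⟨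
      (c · z ⊕ (-ᶠ c) · x) ⊕ s · u  ≡⟨ cong₂ (λ k l → (k · z ⊕ (-ᶠ c) · x) ⊕ l · u) (sym σ≡c) s≡-c₂ ⟩
      target z x u  ∎
      where open ≡-Reasoning
    conclude : PopularSubset cs b D S →
      N * (N * X) ≤ D ^ (8 + b) * diagonal-reps (c ∷ c₂ ∷ cs) S
    conclude (S₁ , S₁⊆S , dense₁ , popular) = *-cancelˡ-≤ (N * N) {{m*n≢0 N N}} (begin
      -- A collision takes four variables from S₁, each at density parameter D²; this is the origin
      -- of the 8 in the exponent.
      (N * N) * (N * (N * X))  ≡⟨ eq₁ N X ⟩
      ((N * N) * (N * N)) * X  ≤⟨ *-monoˡ-≤ X (*-mono-≤ (*-mono-≤ dense₁ dense₁) (*-mono-≤ dense₁ dense₁)) ⟩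
      ((Q * k) * (Q * k)) * ((Q * k) * (Q * k)) * X  ≡⟨ eq₂ D k X ⟩
      D ^ 8 * ((k * k) * (k * k)) * X  ≤⟨ *-monoˡ-≤ X (*-monoʳ-≤ (D ^ 8) (pair-collisions c s S₁)) ⟩
      D ^ 8 * (N * coll) * X  ≡⟨ eq₃ (D ^ 8) N coll X ⟩
      D ^ 8 * N * (coll * X)  ≤⟨ *-monoʳ-≤ (D ^ 8 * N) count-collisions ⟩
      D ^ 8 * N * (D ^ b * (N * diag))  ≡⟨ eq₄ (D ^ 8) N (D ^ b) diag ⟩
      N * N * (D ^ 8 * D ^ b * diag)  ≡⟨ cong (λ k → N * N * (k * diag)) (^-distribˡ-+-* D 8 b) ⟨
      N * N * (D ^ (8 + b) * diag)  ∎)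
      where
      open ≤-Reasoning
      Q = D * D
      k = # S₁
      diag = diagonal-reps (c ∷ c₂ ∷ cs) S
      I I₁ : V n → ℕ
      I  x = 𝟙 (x ∈? S)
      I₁ x = 𝟙 (x ∈? S₁)
      I₁≤I : ∀ x → I₁ x ≤ I x
      I₁≤I x = 𝟙-mono (x ∈? S₁) (x ∈? S) S₁⊆S
      collide? : ∀ z x u y → Dec (c · x ⊕ s · y ≡ c · z ⊕ s · u)
      collide? z x u y = (c · x ⊕ s · y) ≟ᵛ (c · z ⊕ s · u)
      Y : V n → V n → V n → ℕ
      Y z x u = ∑ λ y → I₁ y * 𝟙 (collide? z x u y)
      coll = ∑ λ z → ∑ λ x → ∑ λ u → I₁ z * (I₁ x * (I₁ u * Y z x u))
      eq₁ : ∀ N X → (N * N) * (N * (N * X)) ≡ ((N * N) * (N * N)) * X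
      eq₁ = solve-∀
      eq₂ : ∀ D k X → (((D * D) * k) * ((D * D) * k)) * (((D * D) * k) * ((D * D) * k)) * X
        ≡ (D * (D * (D * (D * (D * (D * (D * (D * 1)))))))) * ((k * k) * (k * k)) * X
      eq₂ = solve-∀
      eq₃ : ∀ d N c X → d * (N * c) * X ≡ d * N * (c * X)
      eq₃ = solve-∀
      eq₄ : ∀ d N b g → d * N * (b * (N * g)) ≡ N * N * (d * b * g)
      eq₄ = solve-∀
      count-collisions : coll * X ≤ D ^ b * (N * diag)
      count-collisions = begin
        coll * X  ≡⟨ trans (sym (∑-*ʳ X _)) (∑-cong λ z → trans (sym (∑-*ʳ X _)) (∑-cong λ x →
                    trans (sym (∑-*ʳ X _)) (∑-cong λ u → eq₅ (I₁ z) (I₁ x) (I₁ u) (Y z x u) X))) ⟩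
        ∑ (λ z → ∑ λ x → ∑ λ u → I₁ z * (I₁ x * (I₁ u * (Y z x u * X))))  ≤⟨ ∑-mono (λ z → ∑-mono λ x → ∑-mono λ u → *-mono-≤ (I₁≤I z) (*-mono-≤ (I₁≤I x) (*-mono-≤ (I₁≤I u)
                    (absorb {b = b} {D} {cs} {S} {S₁} popular s≢0 (collide? z x u) hits)))) ⟩
        ∑ (λ z → ∑ λ x → ∑ λ u → I z * (I x * (I u * (D ^ b * (N * ρ z x u)))))  ≡⟨ ∑-cong (λ z → trans (∑-cong λ x → trans (∑-cong λ u → eq₆ (I z) (I x) (I u) (D ^ b) N (ρ z x u))
                    (trans (∑-*ˡ (D ^ b * N) _) (cong (D ^ b * N *_) (trans (∑-*ˡ (I z) _) (cong (I z *_) (∑-*ˡ (I x) _))))))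
                    (trans (∑-*ˡ (D ^ b * N) _) (cong (D ^ b * N *_) (∑-*ˡ (I z) _)))) ⟩
        ∑ (λ z → D ^ b * N * (I z * ∑ λ x → I x * ∑ λ u → I u * ρ z x u))  ≡⟨ ∑-*ˡ (D ^ b * N) _ ⟩
        D ^ b * N * diag  ≡⟨ *-assoc (D ^ b) N diag ⟩
        D ^ b * (N * diag)  ∎
        where
        ρ : V n → V n → V n → ℕ
        ρ z x u = rep cs S (target z x u)
        eq₅ : ∀ a b c j X → a * (b * (c * j)) * X ≡ a * (b * (c * (j * X)))
        eq₅ = solve-∀
        eq₆ : ∀ a b c d N r → a * (b * (c * (d * (N * r)))) ≡ d * N * (a * (b * (c * r)))
        eq₆ = solve-∀

  -- The induction has to stay among lists with nonzero total. If dropping c leaves total zero, then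
  -- dropping the next coefficient c₂ ≠ 0 as well leaves -c₂, so two coefficients are removed at
  -- once.
  supersaturated : ∀ cs → All (_≢ 0#) cs → total cs ≢ 0# → ∃ (Supersaturated cs)
  supersaturated []       _          σ≢0 = contradiction refl σ≢0
  supersaturated (c ∷ cs) (c≢0 ∷ nz) σ≢0 with total cs ≟ᶠ 0#
  ... | no σ′≢0 = supersaturated-∷ {c} {cs} {proj₁ (supersaturated cs nz σ′≢0)} σ≢0 σ′≢0 (proj₂ (supersaturated cs nz σ′≢0))
  supersaturated (c ∷ [])      _                σ≢0 | yes _ = 1 , supersaturated-[ c ]
  supersaturated (c ∷ c₂ ∷ cs) (_ ∷ c₂≢0 ∷ nz)  σ≢0 | yes cancel =
    8 + suc (2 * proj₁ rest) , supersaturated-∷∷ {c} {c₂} {cs} {proj₁ rest} cancel s≢0 (proj₂ rest)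
    where
    s≢0 : total cs ≢ 0#
    s≢0 s≡0 = c₂≢0 (trans (sym (+ᶠ-identityʳ c₂)) (trans (cong (c₂ +ᶠ_) (sym s≡0)) cancel))
    rest = supersaturated cs nz s≢0

  -- Column classes

  opaque
    unfolding ∏

    ∏-extract : ∀ {X : Set} {{_ : Finite X}} {ℓ} (f : Fin ℓ → ℕ) (g : X → ℕ) (h : X → Fin ℓ → ℕ) t₀ →
      f t₀ ≡ ∑ (λ x → g x * h x t₀) → (∀ x t → t₀ ≢ t → f t ≡ h x t) → ∏ f ≡ ∑ λ x → g x * ∏ (h x)
    ∏-extract f g h zero at off = begin
      f zero * ∏ (f ∘ suc)  ≡⟨ cong (_* ∏ (f ∘ suc)) at ⟩
      ∑ (λ x → g x * h x zero) * ∏ (f ∘ suc)  ≡⟨ ∑-*ʳ _ _ ⟨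
      ∑ (λ x → g x * h x zero * ∏ (f ∘ suc))  ≡⟨ ∑-cong (λ x → trans (*-assoc (g x) (h x zero) _) (cong (λ e → g x * (h x zero * e)) (∏-cong λ t → off x (suc t) λ ()))) ⟩
      ∑ (λ x → g x * (h x zero * ∏ (h x ∘ suc)))  ∎
      where open ≡-Reasoning
    ∏-extract f g h (suc t₀) at off = begin
      f zero * ∏ (f ∘ suc)  ≡⟨ cong (f zero *_) (∏-extract (f ∘ suc) g (λ x → h x ∘ suc) t₀ at λ x t ne → off x (suc t) λ { refl → ne refl }) ⟩
      f zero * ∑ (λ x → g x * ∏ (h x ∘ suc))  ≡⟨ ∑-*ˡ (f zero) _ ⟨
      ∑ (λ x → f zero * (g x * ∏ (h x ∘ suc)))  ≡⟨ ∑-cong (λ x → trans (eq (f zero) (g x) _) (cong (λ e → g x * (e * ∏ (h x ∘ suc))) (off x zero λ ()))) ⟩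
      ∑ (λ x → g x * (h x zero * ∏ (h x ∘ suc)))  ∎
      where
      open ≡-Reasoning
      eq : ∀ a b c → a * (b * c) ≡ b * (a * c)
      eq = solve-∀

    ∏-scale : ∀ {ℓ} (f h : Fin ℓ → ℕ) c t₀ → f t₀ ≡ c * h t₀ → (∀ t → t₀ ≢ t → f t ≡ h t) → ∏ f ≡ c * ∏ h
    ∏-scale f h c zero at off = trans (cong₂ _*_ at (∏-cong λ t → off (suc t) λ ())) (*-assoc c _ _)
    ∏-scale f h c (suc t₀) at off = trans (cong₂ _*_ (off zero λ ()) (∏-scale (f ∘ suc) (h ∘ suc) c t₀ at λ t ne → off (suc t) λ { refl → ne refl }))
      (eq (h zero) c _)
      where
      eq : ∀ a b c → a * (b * c) ≡ b * (a * c)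
      eq = solve-∀

    ∏-𝟙≤ : ∀ {ℓ} {P : Fin ℓ → Set} {Q : Set} (P? : ∀ t → Dec (P t)) (Q? : Dec Q) → ((∀ t → P t) → Q) → ∏ (λ t → 𝟙 (P? t)) ≤ 𝟙 Q?
    ∏-𝟙≤ {zero}  P? Q? all⇒ = ≤-reflexive (sym (𝟙-yes Q? (all⇒ λ ())))
    ∏-𝟙≤ {suc ℓ} {P} P? Q? all⇒ = 𝟙*≤ (P? zero) λ p₀ → ∏-𝟙≤ (P? ∘ suc) Q? λ ps → all⇒ λ { zero → p₀ ; (suc t) → ps t }

    ∏-1 : ∀ {ℓ} (f : Fin ℓ → ℕ) → (∀ t → f t ≡ 1) → ∏ f ≡ 1
    ∏-1 {zero}  f f≡1 = refl
    ∏-1 {suc ℓ} f f≡1 = cong₂ _*_ (f≡1 zero) (∏-1 (f ∘ suc) (f≡1 ∘ suc))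

  module Classes {ℓ : ℕ} where

    coeffs : ∀ {k} → Vec (𝔽 × Fin ℓ) k → Fin ℓ → List 𝔽
    coeffs [] t = []
    coeffs ((c , t₀) ∷ cc) t with t₀ Fin.≟ t
    ... | yes _ = c ∷ coeffs cc t
    ... | no _  = coeffs cc t

    add-at : ∀ {n} → Fin ℓ → V n → (Fin ℓ → V n) → Fin ℓ → V n
    add-at t₀ a y t with t₀ Fin.≟ t
    ... | yes _ = a ⊕ y t
    ... | no _  = y t

    class-sum : ∀ {k n} → Vec (𝔽 × Fin ℓ) k → Vec (V n) k → Fin ℓ → V n
    class-sum []              []       t = 𝟎
    class-sum ((c , t₀) ∷ cc) (x ∷ xs) = add-at t₀ (c · x) (class-sum cc xs)

    weight-in : ∀ {k n} → Subset (V n) → Vec (V n) k → ℕ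
    weight-in S x = ∏ λ j → 𝟙 (lookup x j ∈? S)

    -- Both sides count the tuples in S^k whose class sums are y. A new column of class t₀ opens a
    -- sum in the factor t₀ alone, and its contribution is moved from the class sum to the
    -- prescribed value.
    ∏-rep : ∀ {k n} (cc : Vec (𝔽 × Fin ℓ) k) (S : Subset (V n)) (y : Fin ℓ → V n) →
      ∏ (λ t → rep (coeffs cc t) S (y t)) ≡ ∑ λ x → weight-in S x * ∏ λ t → 𝟙 (class-sum cc x t ≟ᵛ y t)
    ∏-rep [] S y = sym (trans (∑-[] _) (trans (cong (_* ∏ (λ t → 𝟙 (𝟎 ≟ᵛ y t))) (∏-zero _)) (trans (*-identityˡ _)
      (∏-cong λ t → 𝟙-cong (𝟎 ≟ᵛ y t) (y t ≟ᵛ 𝟎) sym sym))))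
    ∏-rep {n = n} ((c , t₀) ∷ cc) S y = begin
      ∏ (λ t → rep (coeffs ((c , t₀) ∷ cc) t) S (y t))  ≡⟨ ∏-extract _ (λ x → 𝟙 (x ∈? S)) (λ x t → rep (coeffs cc t) S (add-at t₀ ((-ᶠ c) · x) y t)) t₀ at off ⟩
      ∑ (λ x → 𝟙 (x ∈? S) * ∏ (λ t → rep (coeffs cc t) S (add-at t₀ ((-ᶠ c) · x) y t)))
                    ≡⟨ ∑-cong (λ x → trans (cong (𝟙 (x ∈? S) *_) (∏-rep cc S (add-at t₀ ((-ᶠ c) · x) y))) (sym (∑-*ˡ (𝟙 (x ∈? S)) _))) ⟩
      ∑ (λ x → ∑ λ xs → 𝟙 (x ∈? S) * (weight-in S xs * ∏ λ t → 𝟙 (class-sum cc xs t ≟ᵛ add-at t₀ ((-ᶠ c) · x) y t)))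
                    ≡⟨ ∑-cong (λ x → ∑-cong λ xs → trans (sym (*-assoc (𝟙 (x ∈? S)) _ _)) (cong₂ _*_ (sym (∏-suc _)) (∏-cong (same x xs)))) ⟩
      ∑ (λ x → ∑ λ xs → weight-in S (x ∷ xs) * ∏ λ t → 𝟙 (class-sum ((c , t₀) ∷ cc) (x ∷ xs) t ≟ᵛ y t)) ≡⟨ ∑-∷ _ ⟨
      ∑ (λ x → weight-in S x * ∏ λ t → 𝟙 (class-sum ((c , t₀) ∷ cc) x t ≟ᵛ y t)) ∎
      where
      open ≡-Reasoning
      at : rep (coeffs ((c , t₀) ∷ cc) t₀) S (y t₀) ≡ ∑ λ x → 𝟙 (x ∈? S) * rep (coeffs cc t₀) S (add-at t₀ ((-ᶠ c) · x) y t₀)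
      at with t₀ Fin.≟ t₀
      ... | yes _ = ∑-cong λ x → cong (λ w → 𝟙 (x ∈? S) * rep (coeffs cc t₀) S w) (⊕-comm (y t₀) _)
      ... | no ne = contradiction refl ne
      off : ∀ x t → t₀ ≢ t → rep (coeffs ((c , t₀) ∷ cc) t) S (y t) ≡ rep (coeffs cc t) S (add-at t₀ ((-ᶠ c) · x) y t)
      off x t ne with t₀ Fin.≟ t
      ... | yes eq = contradiction eq ne
      ... | no _ = refl
      same : ∀ x xs t → 𝟙 (class-sum cc xs t ≟ᵛ add-at t₀ ((-ᶠ c) · x) y t) ≡ 𝟙 (add-at t₀ (c · x) (class-sum cc xs) t ≟ᵛ y t)
      same x xs t with t₀ Fin.≟ t
      ... | no _ = refl
      ... | yes _ = 𝟙-cong (_ ≟ᵛ _) (_ ≟ᵛ _) (λ e → trans (cong (c · x ⊕_) e) (trans (sym (⊕-assoc (c · x) _ _)) (trans (cong (_⊕ y t) (·-neg c x)) (⊕-identityˡ _))))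
        (λ e → trans (isolateʳ c e) (⊕-comm (y t) _))

    row-of : ∀ {k} → Vec (𝔽 × Fin ℓ) k → V ℓ → V k
    row-of cc w = Vec.map (λ (c , t) → c *ᶠ lookup w t) cc

    comb-𝟎 : ∀ {ℓ n} (w : V ℓ) → comb w (Vec.tabulate λ _ → 𝟎 {n}) ≡ 𝟎
    comb-𝟎 []       = refl
    comb-𝟎 (w ∷ ws) = trans (cong₂ _⊕_ (·-zeroʳ w) (comb-𝟎 ws)) (⊕-identityˡ 𝟎)

  comb-add-at : ∀ {ℓ n} (w : V ℓ) t₀ (a : V n) (y : Fin ℓ → V n) →
    comb w (Vec.tabulate (Classes.add-at t₀ a y)) ≡ lookup w t₀ · a ⊕ comb w (Vec.tabulate y)
  comb-add-at (w ∷ ws) zero a y = trans (cong (_⊕ comb ws (Vec.tabulate (y ∘ suc))) (·-distribˡ w a (y zero))) (⊕-assoc (w · a) _ _)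
  comb-add-at (w ∷ ws) (suc t₀) a y = begin
    w · y zero ⊕ comb ws (Vec.tabulate (λ t → Classes.add-at (suc t₀) a y (suc t)))  ≡⟨ cong (λ v → w · y zero ⊕ comb ws v) (Vec.tabulate-cong same) ⟩
    w · y zero ⊕ comb ws (Vec.tabulate (Classes.add-at t₀ a (y ∘ suc)))  ≡⟨ cong (w · y zero ⊕_) (comb-add-at ws t₀ a (y ∘ suc)) ⟩
    w · y zero ⊕ (lookup ws t₀ · a ⊕ rest)  ≡⟨ ⊕-assoc (w · y zero) _ rest ⟨
    (w · y zero ⊕ lookup ws t₀ · a) ⊕ rest  ≡⟨ cong (_⊕ rest) (⊕-comm (w · y zero) _) ⟩
    (lookup ws t₀ · a ⊕ w · y zero) ⊕ rest  ≡⟨ ⊕-assoc (lookup ws t₀ · a) _ rest ⟩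
    lookup ws t₀ · a ⊕ (w · y zero ⊕ rest)  ∎
    where
    open ≡-Reasoning
    rest = comb ws (Vec.tabulate (y ∘ suc))
    same : ∀ t → Classes.add-at (suc t₀) a y (suc t) ≡ Classes.add-at t₀ a (y ∘ suc) t
    same t with t₀ Fin.≟ t
    ... | yes _ = refl
    ... | no _  = refl

  module ClassSystem {ℓ k m : ℕ} (cc : Vec (𝔽 × Fin ℓ) k) (ws : Vec (V ℓ) m) where
    open Classes {ℓ}

    rows : Vec (V k) m
    rows = Vec.map (row-of cc) ws

    comb-row-of : ∀ {k n} (cc : Vec (𝔽 × Fin ℓ) k) (w : V ℓ) (x : Vec (V n) k) →
      comb (row-of cc w) x ≡ comb w (Vec.tabulate (class-sum cc x))
    comb-row-of []              w []       = sym (comb-𝟎 w)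
    comb-row-of ((c , t₀) ∷ cc) w (x ∷ xs) = begin
      (c *ᶠ lookup w t₀) · x ⊕ comb (row-of cc w) xs  ≡⟨ cong₂ _⊕_ (trans (cong (_· x) (*ᶠ-comm c _)) (·-assoc _ c x)) (comb-row-of cc w xs) ⟩
      lookup w t₀ · c · x ⊕ comb w (Vec.tabulate (class-sum cc xs))  ≡⟨ comb-add-at w t₀ (c · x) (class-sum cc xs) ⟨
      comb w (Vec.tabulate (add-at t₀ (c · x) (class-sum cc xs)))  ∎
      where open ≡-Reasoning

    solutions : ∀ {n} → Subset (V n) → ℕ
    solutions S = ∑ λ x → weight-in S x * 𝟙 (solves? rows x)

    class-values : ∀ {n} → Subset (V n) → ℕ
    class-values {n} S = ∑ λ (y : Vec (V n) ℓ) → 𝟙 (solves? ws y) * ∏ λ t → rep (coeffs cc t) S (lookup y t)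

    solves-rows : ∀ {n m} (ws : Vec (V ℓ) m) (x : Vec (V n) k) →
      Solves ws (Vec.tabulate (class-sum cc x)) → Solves (Vec.map (row-of cc) ws) x
    solves-rows []       x []       = []
    solves-rows (w ∷ ws) x (p ∷ ps) = trans (comb-row-of cc w x) p ∷ solves-rows ws x ps

    class-values≤solutions : ∀ {n} (S : Subset (V n)) → class-values S ≤ solutions S
    class-values≤solutions {n} S = begin
      class-values S  ≡⟨ ∑-cong (λ y → trans (cong (𝟙 (solves? ws y) *_) (∏-rep cc S (lookup y))) (trans (sym (∑-*ˡ (𝟙 (solves? ws y)) _)) (∑-cong λ x → eq (𝟙 (solves? ws y)) (weight-in S x) (matches x y)))) ⟩
      ∑ (λ y → ∑ λ x → weight-in S x * (matches x y * 𝟙 (solves? ws y)))  ≡⟨ ∑-swap (λ y x → weight-in S x * (matches x y * 𝟙 (solves? ws y))) ⟩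
      ∑ (λ x → ∑ λ y → weight-in S x * (matches x y * 𝟙 (solves? ws y)))  ≡⟨ ∑-cong (λ x → ∑-*ˡ (weight-in S x) _) ⟩
      ∑ (λ x → weight-in S x * ∑ λ y → matches x y * 𝟙 (solves? ws y))  ≤⟨ ∑-mono (λ x → *-monoʳ-≤ (weight-in S x) (≤-trans (∑-mono (λ y → *-monoˡ-≤ _ (match x y)))
                    (≤-trans (≤-reflexive (∑-pick (Vec.≡-dec _≟ᵛ_) (Y x) (λ y → 𝟙 (solves? ws y)))) (𝟙-mono (solves? ws (Y x)) (solves? rows x) (solves-rows ws x))))) ⟩
      solutions S  ∎
      where
      open ≤-Reasoning
      Y : Vec (V n) k → Vec (V n) ℓ
      Y x = Vec.tabulate (class-sum cc x)
      matches : Vec (V n) k → Vec (V n) ℓ → ℕ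
      matches x y = ∏ λ t → 𝟙 (class-sum cc x t ≟ᵛ lookup y t)
      match : ∀ x y → matches x y ≤ 𝟙 (Vec.≡-dec _≟ᵛ_ (Y x) y)
      match x y = ∏-𝟙≤ (λ t → class-sum cc x t ≟ᵛ lookup y t) (Vec.≡-dec _≟ᵛ_ (Y x) y)
        λ eqs → trans (Vec.tabulate-cong eqs) (Vec.tabulate∘lookup y)
      eq : ∀ a b c → a * (b * c) ≡ b * (c * a)
      eq = solve-∀

    ∏-lengths : ∀ N {k} (cc : Vec (𝔽 × Fin ℓ) k) → ∏ (λ t → N ^ length (coeffs cc t)) ≡ N ^ k
    ∏-lengths N [] = ∏-1 (λ _ → 1) (λ _ → refl)
    ∏-lengths N ((c , t₀) ∷ cc) = trans (∏-scale _ (λ t → N ^ length (coeffs cc t)) N t₀ at off) (cong (N *_) (∏-lengths N cc))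
      where
      at : N ^ length (coeffs ((c , t₀) ∷ cc) t₀) ≡ N * N ^ length (coeffs cc t₀)
      at with t₀ Fin.≟ t₀
      ... | yes _ = refl
      ... | no ne = contradiction refl ne
      off : ∀ t → t₀ ≢ t → N ^ length (coeffs ((c , t₀) ∷ cc) t) ≡ N ^ length (coeffs cc t)
      off t ne with t₀ Fin.≟ t
      ... | yes eq = contradiction eq ne
      ... | no _ = refl

  -- All classes have to be popular at the same z, so the popular subsets are taken one inside the
  -- other. Each stage squares D, whence the doubled exponents, and popularity relative to a smaller
  -- set passes to S because `rep` is monotone in the set.
  common-popular : ∀ {ℓ} (css : Fin ℓ → List 𝔽) → (∀ t → ∃ (Supersaturated (css t))) →
    ∃ λ a → ∃ λ b → ∀ {n D} (S : Subset (V n)) → 2 ≤ D → Dense D S →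
      ∃ λ S₁ → S₁ ⊆ S × Dense (D ^ a) S₁ × (∀ t {z} → T (S₁ z) → Popular (css t) b D S z)
  common-popular {zero} css sats = 1 , 0 , λ {n} {D} S 2≤D dense →
    S , id , ≤-trans dense (*-monoˡ-≤ (# S) (≤-reflexive (sym (*-identityʳ D)))) , λ ()
  common-popular {suc ℓ} css sats = 2 * a , b₀ + 2 * b , step
    where
    e₀ = proj₁ (sats zero)
    rest = common-popular (css ∘ suc) (sats ∘ suc)
    a = proj₁ rest
    b = proj₁ (proj₂ rest)
    b₀ = suc (2 * e₀)
    step : ∀ {n D} (S : Subset (V n)) → 2 ≤ D → Dense D S →
      ∃ λ S₁ → S₁ ⊆ S × Dense (D ^ (2 * a)) S₁ × (∀ t {z} → T (S₁ z) → Popular (css t) (b₀ + 2 * b) D S z)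
    step {n} {D} S 2≤D dense = first (popular-subset {css zero} {e₀} (proj₂ (sats zero)) S 2≤D dense)
      where
      open ≤-Reasoning
      N = ∣ V n ∣
      instance
        D-nonZero : NonZero D
        D-nonZero = >-nonZero (<-≤-trans (s≤s z≤n) 2≤D)
      first : PopularSubset (css zero) b₀ D S →
        ∃ λ S₁ → S₁ ⊆ S × Dense (D ^ (2 * a)) S₁ × (∀ t {z} → T (S₁ z) → Popular (css t) (b₀ + 2 * b) D S z)
      first (S₁ , S₁⊆S , dense₁ , pop₁) = second (proj₂ (proj₂ rest) S₁ (2≤D² 2≤D) dense₁)
        where
        second : (∃ λ S₂ → S₂ ⊆ S₁ × Dense ((D * D) ^ a) S₂ × (∀ t {z} → T (S₂ z) → Popular (css (suc t)) b (D * D) S₁ z)) →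
          ∃ λ S₂ → S₂ ⊆ S × Dense (D ^ (2 * a)) S₂ × (∀ t {z} → T (S₂ z) → Popular (css t) (b₀ + 2 * b) D S z)
        second (S₂ , S₂⊆S₁ , dense₂ , pop₂) = S₂ , (λ z∈ → S₁⊆S (S₂⊆S₁ z∈)) , ≤-trans dense₂ (≤-reflexive (cong (_* # S₂) (D²-power D a))) , pop
          where
          pop : ∀ t {z} → T (S₂ z) → Popular (css t) (b₀ + 2 * b) D S z
          pop zero z∈ = ≤-trans (pop₁ (S₂⊆S₁ z∈)) (*-monoˡ-≤ _ (^-monoʳ-≤ D (m≤m+n b₀ (2 * b))))
          pop (suc t) {z} z∈ = begin
            N ^ length cs  ≤⟨ pop₂ t z∈ ⟩
            (D * D) ^ b * (N * rep cs S₁ (total cs · z))  ≤⟨ *-monoʳ-≤ ((D * D) ^ b) (*-monoʳ-≤ N (rep-mono cs S₁⊆S (total cs · z))) ⟩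
            (D * D) ^ b * (N * rep cs S (total cs · z))  ≤⟨ *-monoˡ-≤ (N * rep cs S (total cs · z)) (≤-trans (≤-reflexive (D²-power D b)) (^-monoʳ-≤ D (m≤n+m (2 * b) b₀))) ⟩
            D ^ (b₀ + 2 * b) * (N * rep cs S (total cs · z))  ∎
            where cs = css (suc t)

  ∏-popular : ∀ {ℓ} K (f g h : Fin ℓ → ℕ) → (∀ t → f t * g t ≤ K * h t) → ∏ f * ∏ g ≤ K ^ ℓ * ∏ h
  ∏-popular {ℓ} K f g h le = begin
    ∏ f * ∏ g  ≡⟨ ∏-* f g ⟨
    ∏ (λ t → f t * g t)  ≤⟨ ∏-mono le ⟩
    ∏ (λ t → K * h t)  ≡⟨ ∏-* (λ _ → K) h ⟩
    ∏ {ℓ} (λ _ → K) * ∏ h  ≡⟨ cong (_* ∏ h) (∏-const {ℓ} K) ⟩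
    K ^ ℓ * ∏ h  ∎
    where open ≤-Reasoning

  comb-tabulate-⊕ : ∀ {ℓ n} (w : V ℓ) (f g : Fin ℓ → V n) →
    comb w (Vec.tabulate λ t → f t ⊕ g t) ≡ comb w (Vec.tabulate f) ⊕ comb w (Vec.tabulate g)
  comb-tabulate-⊕ []       f g = sym (⊕-identityˡ 𝟎)
  comb-tabulate-⊕ (w ∷ ws) f g = trans (cong₂ _⊕_ (·-distribˡ w _ _) (comb-tabulate-⊕ ws (f ∘ suc) (g ∘ suc))) (⊕-interchange _ _ _ _)

  comb-tabulate-· : ∀ {ℓ n} (w : V ℓ) a (f : Fin ℓ → V n) →
    comb w (Vec.tabulate λ t → a · f t) ≡ a · comb w (Vec.tabulate f)
  comb-tabulate-· []       a f = sym (·-zeroʳ a)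
  comb-tabulate-· (w ∷ ws) a f = trans (cong₂ _⊕_ (trans (sym (·-assoc w a _)) (trans (cong (_· f zero) (*ᶠ-comm w a)) (·-assoc a w _)))
    (comb-tabulate-· ws a (f ∘ suc))) (sym (·-distribˡ a _ _))

  -- From single classes to the whole system

  module _ {ℓ k m : ℕ} (cc : Vec (𝔽 × Fin ℓ) k) (ws : Vec (V ℓ) m) where
    open Classes {ℓ}
    open ClassSystem cc ws

    SystemSupersaturated : ℕ → Set
    SystemSupersaturated e = ∀ {n D} (S : Subset (V n)) → 2 ≤ D → Dense D S →
      ∣ V n ∣ ^ k ≤ D ^ e * (∣ V n ∣ ^ m * solutions S)

    -- All class values are set to multiples σ_t z of a common z.
    supersaturated-nonzero-classes : ℓ ≡ suc m → (∀ t → ∃ (Supersaturated (coeffs cc t))) → (∀ t → total (coeffs cc t) ≢ 0#) →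
      (∀ {n} (z : V n) → Solves ws (Vec.tabulate λ t → total (coeffs cc t) · z)) → ∃ SystemSupersaturated
    supersaturated-nonzero-classes refl sats σ≢0 diagonal = a + b * ℓ , bound
      where
      common = common-popular (coeffs cc) sats
      a = proj₁ common
      b = proj₁ (proj₂ common)
      bound : SystemSupersaturated (a + b * ℓ)
      bound {n} {D} S 2≤D dense = conclude (proj₂ (proj₂ common) S 2≤D dense)
        where
        open ≤-Reasoning
        N = ∣ V n ∣
        conclude : (∃ λ S₁ → S₁ ⊆ S × Dense (D ^ a) S₁ × (∀ t {z} → T (S₁ z) → Popular (coeffs cc t) b D S z)) →
          N ^ k ≤ D ^ (a + b * ℓ) * (N ^ m * solutions S)
        conclude (S₁ , _ , dense₁ , popular) = *-cancelˡ-≤ N (begin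
          N * N ^ k  ≤⟨ *-monoˡ-≤ (N ^ k) dense₁ ⟩
          D ^ a * # S₁ * N ^ k  ≡⟨ *-assoc (D ^ a) _ _ ⟩
          D ^ a * (# S₁ * N ^ k)  ≤⟨ *-monoʳ-≤ (D ^ a) many ⟩
          D ^ a * ((D ^ b * N) ^ ℓ * solutions S)  ≡⟨ cong (λ e → D ^ a * (e * solutions S)) (trans (^-distribʳ-* ℓ (D ^ b) N) (cong (_* N ^ ℓ) (^-*-assoc D b ℓ))) ⟩
          -- Here ℓ = m + 1 enters: N^ℓ is N times N^m, and the extra N cancels against the density
          -- of the popular z on the left.
          D ^ a * (D ^ (b * ℓ) * (N * N ^ m) * solutions S)  ≡⟨ eq (D ^ a) (D ^ (b * ℓ)) N (N ^ m) (solutions S) ⟩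
          N * (D ^ a * D ^ (b * ℓ) * (N ^ m * solutions S))  ≡⟨ cong (λ e → N * (e * (N ^ m * solutions S))) (^-distribˡ-+-* D a (b * ℓ)) ⟨
          N * (D ^ (a + b * ℓ) * (N ^ m * solutions S))  ∎)
          where
          eq : ∀ a b N M s → a * (b * (N * M) * s) ≡ N * (a * b * (M * s))
          eq = solve-∀
          values : V n → Vec (V n) ℓ
          values z = Vec.tabulate λ t → total (coeffs cc t) · z
          count-at : Vec (V n) ℓ → ℕ
          count-at y = 𝟙 (solves? ws y) * ∏ λ t → rep (coeffs cc t) S (lookup y t)
          each : ∀ z → 𝟙 (z ∈? S₁) * N ^ k ≤ (D ^ b * N) ^ ℓ * count-at (values z)
          each z = 𝟙*≤ (z ∈? S₁) λ z∈ → begin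
            N ^ k  ≡⟨ trans (*-identityʳ _) (∏-lengths N cc) ⟨
            ∏ (λ t → N ^ length (coeffs cc t)) * 1  ≡⟨ cong (∏ (λ t → N ^ length (coeffs cc t)) *_) (∏-1 {ℓ} (λ _ → 1) (λ _ → refl)) ⟨
            ∏ (λ t → N ^ length (coeffs cc t)) * ∏ {ℓ} (λ _ → 1)  ≤⟨ ∏-popular (D ^ b * N) _ (λ _ → 1) (λ t → rep (coeffs cc t) S (lookup (values z) t)) (λ t → pop t z∈) ⟩
            (D ^ b * N) ^ ℓ * ∏ (λ t → rep (coeffs cc t) S (lookup (values z) t))  ≡⟨ cong ((D ^ b * N) ^ ℓ *_) (trans (cong (_* ∏ (λ t → rep (coeffs cc t) S (lookup (values z) t))) (𝟙-yes (solves? ws (values z)) (diagonal z))) (*-identityˡ _)) ⟨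
            (D ^ b * N) ^ ℓ * count-at (values z)  ∎
            where
            pop : ∀ t → T (S₁ z) → N ^ length (coeffs cc t) * 1 ≤ D ^ b * N * rep (coeffs cc t) S (lookup (values z) t)
            pop t z∈ = begin
              N ^ length (coeffs cc t) * 1  ≡⟨ *-identityʳ _ ⟩
              N ^ length (coeffs cc t)  ≤⟨ popular t z∈ ⟩
              D ^ b * (N * rep (coeffs cc t) S (total (coeffs cc t) · z))  ≡⟨ *-assoc (D ^ b) N _ ⟨
              D ^ b * N * rep (coeffs cc t) S (total (coeffs cc t) · z)  ≡⟨ cong (λ v → D ^ b * N * rep (coeffs cc t) S v) (Vec.lookup∘tabulate (λ t → total (coeffs cc t) · z) t) ⟨
              D ^ b * N * rep (coeffs cc t) S (lookup (values z) t)  ∎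
          -- As ℓ = m + 1 there is a class `zero`, and its nonzero total recovers z from the class
          -- values.
          values-injective : ∀ {z z′} → values z ≡ values z′ → z ≡ z′
          values-injective e = ·-cancel (σ≢0 zero) (Vec.∷-injectiveˡ e)
          many : # S₁ * N ^ k ≤ (D ^ b * N) ^ ℓ * solutions S
          many = begin
            # S₁ * N ^ k  ≡⟨ ∑-*ʳ (N ^ k) _ ⟨
            ∑ (λ z → 𝟙 (z ∈? S₁) * N ^ k)  ≤⟨ ∑-mono each ⟩
            ∑ (λ z → (D ^ b * N) ^ ℓ * count-at (values z))  ≡⟨ ∑-*ˡ ((D ^ b * N) ^ ℓ) _ ⟩
            (D ^ b * N) ^ ℓ * ∑ (λ z → count-at (values z))  ≤⟨ *-monoʳ-≤ ((D ^ b * N) ^ ℓ) (≤-trans (∑-injective values values-injective count-at) (class-values≤solutions S)) ⟩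
            (D ^ b * N) ^ ℓ * solutions S  ∎

    -- The class value y is written as c (x − x′), where c x comes from the first column of
    -- the class and − c x′ is spread over its remaining columns.
    supersaturated-zero-classes : (hd : Fin ℓ → 𝔽) (tl : Fin ℓ → List 𝔽) → (∀ t → coeffs cc t ≡ hd t ∷ tl t) →
      (∀ t → hd t +ᶠ total (tl t) ≡ 0#) → (∀ t → hd t ≢ 0#) → (∀ t → ∃ (Supersaturated (tl t))) → ∃ SystemSupersaturated
    supersaturated-zero-classes hd tl coeffs≡ cancel hd≢0 sats = a * ℓ + a * ℓ + b * ℓ , bound
      where
      common = common-popular tl sats
      a = proj₁ common
      b = proj₁ (proj₂ common)
      τ : Fin ℓ → 𝔽
      τ t = total (tl t)
      τ≡-hd : ∀ t → τ t ≡ -ᶠ hd t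
      τ≡-hd t = trans (solve 2 (λ a b → b := (:- a) :+ (a :+ b)) refl (hd t) (τ t)) (trans (cong ((-ᶠ hd t) +ᶠ_) (cancel t)) (+ᶠ-identityʳ _))
      τ≢0 : ∀ t → τ t ≢ 0#
      τ≢0 t e = hd≢0 t (trans (sym (+ᶠ-identityʳ _)) (trans (cong (hd t +ᶠ_) (sym e)) (cancel t)))
      bound : SystemSupersaturated (a * ℓ + a * ℓ + b * ℓ)
      bound {n} {D} S 2≤D dense = conclude (proj₂ (proj₂ common) S 2≤D dense)
        where
        open ≤-Reasoning
        N = ∣ V n ∣
        conclude : (∃ λ S₁ → S₁ ⊆ S × Dense (D ^ a) S₁ × (∀ t {z} → T (S₁ z) → Popular (tl t) b D S z)) →
          N ^ k ≤ D ^ (a * ℓ + a * ℓ + b * ℓ) * (N ^ m * solutions S)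
        conclude (S₁ , S₁⊆S , dense₁ , popular) = *-cancelˡ-≤ (N ^ ℓ * N ^ ℓ) {{m*n≢0 _ _ {{m^n≢0 N ℓ}} {{m^n≢0 N ℓ}}}} (begin
          N ^ ℓ * N ^ ℓ * N ^ k  ≤⟨ *-monoˡ-≤ (N ^ k) (*-mono-≤ N^ℓ≤ N^ℓ≤) ⟩
          D ^ (a * ℓ) * # S₁ ^ ℓ * (D ^ (a * ℓ) * # S₁ ^ ℓ) * N ^ k  ≡⟨ eq₁ (D ^ (a * ℓ)) (# S₁ ^ ℓ) (N ^ k) ⟩
          D ^ (a * ℓ) * D ^ (a * ℓ) * (# S₁ ^ ℓ * # S₁ ^ ℓ) * N ^ k  ≤⟨ *-monoˡ-≤ (N ^ k) (*-monoʳ-≤ (D ^ (a * ℓ) * D ^ (a * ℓ)) difference-collisions) ⟩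
          D ^ (a * ℓ) * D ^ (a * ℓ) * (N ^ m * diffs) * N ^ k  ≡⟨ eq₂ (D ^ (a * ℓ) * D ^ (a * ℓ)) (N ^ m) diffs (N ^ k) ⟩
          D ^ (a * ℓ) * D ^ (a * ℓ) * (N ^ m * (diffs * N ^ k))  ≤⟨ *-monoʳ-≤ (D ^ (a * ℓ) * D ^ (a * ℓ)) (*-monoʳ-≤ (N ^ m) diffs≤) ⟩
          D ^ (a * ℓ) * D ^ (a * ℓ) * (N ^ m * ((D ^ b * (N * N)) ^ ℓ * solutions S)) ≡⟨ cong (λ e → D ^ (a * ℓ) * D ^ (a * ℓ) * (N ^ m * (e * solutions S)))
                    (trans (^-distribʳ-* ℓ (D ^ b) (N * N)) (cong₂ _*_ (^-*-assoc D b ℓ) (^-distribʳ-* ℓ N N))) ⟩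
          D ^ (a * ℓ) * D ^ (a * ℓ) * (N ^ m * (D ^ (b * ℓ) * (N ^ ℓ * N ^ ℓ) * solutions S)) ≡⟨ eq₃ (D ^ (a * ℓ) * D ^ (a * ℓ)) (N ^ m) (D ^ (b * ℓ)) (N ^ ℓ * N ^ ℓ) (solutions S) ⟩
          N ^ ℓ * N ^ ℓ * (D ^ (a * ℓ) * D ^ (a * ℓ) * D ^ (b * ℓ) * (N ^ m * solutions S)) ≡⟨ cong (λ e → N ^ ℓ * N ^ ℓ * (e * (N ^ m * solutions S)))
                    (trans (^-distribˡ-+-* D (a * ℓ + a * ℓ) (b * ℓ)) (cong (_* D ^ (b * ℓ)) (^-distribˡ-+-* D (a * ℓ) (a * ℓ)))) ⟨
          N ^ ℓ * N ^ ℓ * (D ^ (a * ℓ + a * ℓ + b * ℓ) * (N ^ m * solutions S))  ∎)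
          where
          eq₁ : ∀ d s x → d * s * (d * s) * x ≡ d * d * (s * s) * x
          eq₁ = solve-∀
          eq₂ : ∀ d M s x → d * (M * s) * x ≡ d * (M * (s * x))
          eq₂ = solve-∀
          eq₃ : ∀ d M b N s → d * (M * (b * N * s)) ≡ N * (d * b * (M * s))
          eq₃ = solve-∀
          N^ℓ≤ : N ^ ℓ ≤ D ^ (a * ℓ) * # S₁ ^ ℓ
          N^ℓ≤ = ≤-trans (^-monoˡ-≤ ℓ dense₁) (≤-reflexive (trans (^-distribʳ-* ℓ (D ^ a) (# S₁)) (cong (_* # S₁ ^ ℓ) (^-*-assoc D a ℓ))))
          I : V n → ℕ
          I x = 𝟙 (x ∈? S₁)
          value : Fin ℓ → V n → V n → V n
          value t x x′ = hd t · x ⊕ τ t · x′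
          r : Fin ℓ → V n → ℕ
          r t y = ∑ λ x → I x * ∑ λ x′ → I x′ * 𝟙 (value t x x′ ≟ᵛ y)
          diffs = ∑ λ (y : Vec (V n) ℓ) → 𝟙 (solves? ws y) * ∏ λ t → r t (lookup y t)
          -- Of the two factors N, one comes from the normalisation in `Popular` and one from the
          -- detached head variable, which is counted in the length of the class.
          r-bound : ∀ t y → r t y * N ^ length (coeffs cc t) ≤ D ^ b * (N * N) * rep (coeffs cc t) S y
          r-bound t y rewrite coeffs≡ t = begin
            r t y * (N * X)  ≡⟨ eq₄ (r t y) N X ⟩
            N * (r t y * X)  ≤⟨ *-monoʳ-≤ N (begin
              r t y * X  ≡⟨ trans (sym (∑-*ʳ X _)) (∑-cong λ x → *-assoc (I x) _ X) ⟩
              ∑ (λ x → I x * ((∑ λ x′ → I x′ * 𝟙 (value t x x′ ≟ᵛ y)) * X))  ≤⟨ ∑-mono (λ x → *-mono-≤ (𝟙-mono (x ∈? S₁) (x ∈? S) S₁⊆S)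
                    (absorb {b = b} {D} {tl t} {S} {S₁} (popular t) (τ≢0 t) (λ x′ → value t x x′ ≟ᵛ y) (isolateʳ (hd t)))) ⟩
              ∑ (λ x → 𝟙 (x ∈? S) * (D ^ b * (N * rep (tl t) S (y ⊕ (-ᶠ hd t) · x)))) ≡⟨ trans (∑-cong λ x → eq₅ (𝟙 (x ∈? S)) (D ^ b) N _) (∑-*ˡ (D ^ b * N) _) ⟩
              D ^ b * N * rep (hd t ∷ tl t) S y  ∎) ⟩
            N * (D ^ b * N * rep (hd t ∷ tl t) S y)  ≡⟨ eq₆ N (D ^ b) (rep (hd t ∷ tl t) S y) ⟩
            D ^ b * (N * N) * rep (hd t ∷ tl t) S y  ∎
            where
            X = N ^ length (tl t)
            eq₄ : ∀ r N X → r * (N * X) ≡ N * (r * X)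
            eq₄ = solve-∀
            eq₅ : ∀ i d N r → i * (d * (N * r)) ≡ d * N * (i * r)
            eq₅ = solve-∀
            eq₆ : ∀ N d r → N * (d * N * r) ≡ d * (N * N) * r
            eq₆ = solve-∀
          diffs≤ : diffs * N ^ k ≤ (D ^ b * (N * N)) ^ ℓ * solutions S
          diffs≤ = begin
            diffs * N ^ k  ≡⟨ ∑-*ʳ (N ^ k) _ ⟨
            ∑ (λ y → 𝟙 (solves? ws y) * ∏ (λ t → r t (lookup y t)) * N ^ k) ≤⟨ ∑-mono each ⟩
            ∑ (λ y → K ^ ℓ * (𝟙 (solves? ws y) * ∏ (λ t → rep (coeffs cc t) S (lookup y t)))) ≡⟨ ∑-*ˡ (K ^ ℓ) _ ⟩
            K ^ ℓ * class-values S  ≤⟨ *-monoʳ-≤ (K ^ ℓ) (class-values≤solutions S) ⟩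
            K ^ ℓ * solutions S  ∎
            where
            K = D ^ b * (N * N)
            eq₇ : ∀ s k p → s * (k * p) ≡ k * (s * p)
            eq₇ = solve-∀
            each : ∀ y → 𝟙 (solves? ws y) * ∏ (λ t → r t (lookup y t)) * N ^ k ≤
              K ^ ℓ * (𝟙 (solves? ws y) * ∏ (λ t → rep (coeffs cc t) S (lookup y t)))
            each y = begin
              𝟙 (solves? ws y) * ∏ (λ t → r t (lookup y t)) * N ^ k  ≡⟨ *-assoc (𝟙 (solves? ws y)) _ _ ⟩
              𝟙 (solves? ws y) * (∏ (λ t → r t (lookup y t)) * N ^ k)  ≡⟨ cong (λ e → 𝟙 (solves? ws y) * (∏ (λ t → r t (lookup y t)) * e)) (∏-lengths N cc) ⟨
              𝟙 (solves? ws y) * (∏ (λ t → r t (lookup y t)) * ∏ (λ t → N ^ length (coeffs cc t)))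
                    ≤⟨ *-monoʳ-≤ (𝟙 (solves? ws y)) (∏-popular K _ _ _ (λ t → r-bound t (lookup y t))) ⟩
              𝟙 (solves? ws y) * (K ^ ℓ * ∏ (λ t → rep (coeffs cc t) S (lookup y t))) ≡⟨ eq₇ (𝟙 (solves? ws y)) (K ^ ℓ) _ ⟩
              K ^ ℓ * (𝟙 (solves? ws y) * ∏ (λ t → rep (coeffs cc t) S (lookup y t))) ∎
          difference-collisions : # S₁ ^ ℓ * # S₁ ^ ℓ ≤ N ^ m * diffs
          difference-collisions = begin
            # S₁ ^ ℓ * # S₁ ^ ℓ  ≡⟨ cong₂ _*_ ∑f ∑f ⟨
            ∑ f * ∑ f  ≤⟨ collisions (Vec.≡-dec _≟ᵛ_) h f ⟩
            ∣ Vec (V n) m ∣ * ∑ (λ x → ∑ λ x′ → f x * (f x′ * 𝟙 (Vec.≡-dec _≟ᵛ_ (h x) (h x′)))) ≤⟨ *-mono-≤ (≤-reflexive (∣Vec∣ {n = m})) (∑-mono λ x → ∑-mono λ x′ → each x x′) ⟩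
            N ^ m * ∑ (λ x → ∑ λ x′ → G (Vec.zip x x′))  ≡⟨ cong (N ^ m *_) (∑-× (λ (x , x′) → G (Vec.zip x x′))) ⟨
            N ^ m * ∑ (λ (x , x′) → G (Vec.zip x x′))  ≤⟨ *-monoʳ-≤ (N ^ m) (∑-injective (uncurry Vec.zip) zip-injective G) ⟩
            N ^ m * ∑ G  ≡⟨ cong (N ^ m *_) expand ⟨
            N ^ m * diffs  ∎
            where
            f : Vec (V n) ℓ → ℕ
            f x = ∏ λ t → I (lookup x t)
            ∑f : ∑ f ≡ # S₁ ^ ℓ
            ∑f = trans (∏-∑ {n = ℓ} (λ _ → I)) (∏-const {ℓ} (# S₁))
            scaled : Vec (V n) ℓ → Vec (V n) ℓ
            scaled x = Vec.tabulate λ t → hd t · lookup x t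
            -- Equal images mean that Σ_t w_t hd_t (x_t - x′_t) vanishes for every row w. Because τ
            -- t = -hd t, the values hd_t x_t + τ_t x′_t are these differences and therefore solve
            -- `ws`.
            h : Vec (V n) ℓ → Vec (V n) m
            h x = Vec.map (λ w → comb w (scaled x)) ws
            term : Fin ℓ → V n → V n × V n → ℕ
            term t y (x , x′) = I x * (I x′ * 𝟙 (value t x x′ ≟ᵛ y))
            G : Vec (V n × V n) ℓ → ℕ
            G P = ∑ λ (y : Vec (V n) ℓ) → 𝟙 (solves? ws y) * ∏ λ t → term t (lookup y t) (lookup P t)
            expand : diffs ≡ ∑ G
            expand = trans (∑-cong λ y → trans (cong (𝟙 (solves? ws y) *_) (trans (∏-cong (λ t → trans (∑-cong λ x → sym (∑-*ˡ (I x) _)) (sym (∑-× (term t (lookup y t))))))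
              (sym (∏-∑ (λ t → term t (lookup y t)))))) (sym (∑-*ˡ (𝟙 (solves? ws y)) _)))
              (∑-swap (λ y P → 𝟙 (solves? ws y) * ∏ λ t → term t (lookup y t) (lookup P t)))
            zip-injective : ∀ {ℓ} {u v : Vec (V n) ℓ × Vec (V n) ℓ} → uncurry Vec.zip u ≡ uncurry Vec.zip v → u ≡ v
            zip-injective {u = [] , []} {[] , []} _ = refl
            zip-injective {u = x ∷ xs , x′ ∷ xs′} {y ∷ ys , y′ ∷ ys′} e with Vec.∷-injectiveˡ e | zip-injective {u = xs , xs′} {ys , ys′} (Vec.∷-injectiveʳ e)
            ... | refl | refl = refl
            Y : Vec (V n) ℓ → Vec (V n) ℓ → Vec (V n) ℓ
            Y x x′ = Vec.tabulate λ t → value t (lookup x t) (lookup x′ t)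
            solves-difference : ∀ {m} (ws : Vec (V ℓ) m) x x′ → Vec.map (λ w → comb w (scaled x)) ws ≡ Vec.map (λ w → comb w (scaled x′)) ws →
              Solves ws (Y x x′)
            solves-difference []       x x′ _ = []
            solves-difference (w ∷ ws) x x′ e = vanish ∷ solves-difference ws x x′ (Vec.∷-injectiveʳ e)
              where
              value≡ : ∀ t → value t (lookup x t) (lookup x′ t) ≡ hd t · lookup x t ⊕ (-ᶠ 1#) · hd t · lookup x′ t
              value≡ t = cong (hd t · lookup x t ⊕_) (trans (cong (_· lookup x′ t) (trans (τ≡-hd t) (solve 1 (λ a → :- a := (:- :1) :* a) refl (hd t))))
                (·-assoc (-ᶠ 1#) (hd t) _))
              vanish : comb w (Y x x′) ≡ 𝟎
              vanish = trans (cong (comb w) (Vec.tabulate-cong value≡)) (trans (comb-tabulate-⊕ w _ _) (trans (cong₂ _⊕_ (Vec.∷-injectiveˡ e) (comb-tabulate-· w (-ᶠ 1#) _))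
                (⊕-inverseʳ (comb w (scaled x′)))))
            each : ∀ x x′ → f x * (f x′ * 𝟙 (Vec.≡-dec _≟ᵛ_ (h x) (h x′))) ≤ G (Vec.zip x x′)
            each x x′ = begin
              f x * (f x′ * 𝟙 (Vec.≡-dec _≟ᵛ_ (h x) (h x′)))  ≤⟨ *-monoʳ-≤ (f x) (*-monoʳ-≤ (f x′) (𝟙-mono (Vec.≡-dec _≟ᵛ_ (h x) (h x′)) (solves? ws (Y x x′)) (solves-difference ws x x′))) ⟩
              f x * (f x′ * 𝟙 (solves? ws (Y x x′)))  ≡⟨ eq₈ (f x) (f x′) (𝟙 (solves? ws (Y x x′))) ⟩
              𝟙 (solves? ws (Y x x′)) * (f x * f x′)  ≡⟨ cong (𝟙 (solves? ws (Y x x′)) *_) (trans (∏-cong matched) (∏-* (λ t → I (lookup x t)) (λ t → I (lookup x′ t)))) ⟨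
              𝟙 (solves? ws (Y x x′)) * ∏ (λ t → term t (lookup (Y x x′) t) (lookup (Vec.zip x x′) t))
                    ≤⟨ ∑-≥ (Y x x′) (λ y → 𝟙 (solves? ws y) * ∏ λ t → term t (lookup y t) (lookup (Vec.zip x x′) t)) ⟩
              G (Vec.zip x x′)  ∎
              where
              eq₈ : ∀ a b s → a * (b * s) ≡ s * (a * b)
              eq₈ = solve-∀
              matched : ∀ t → term t (lookup (Y x x′) t) (lookup (Vec.zip x x′) t) ≡ I (lookup x t) * I (lookup x′ t)
              matched t = trans (cong₂ (term t) (Vec.lookup∘tabulate (λ t → value t (lookup x t) (lookup x′ t)) t) (Vec.lookup-zip t x x′))
                (cong (I (lookup x t) *_) (trans (cong (I (lookup x′ t) *_) (𝟙-yes (_ ≟ᵛ _) refl)) (*-identityʳ _)))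

  -- Generic solutions

  lookup-comb : ∀ {s n} (c : V s) (x : Vec (V n) s) t → lookup (comb c x) t ≡ sum F (λ j → lookup c j *ᶠ lookup (lookup x j) t)
  lookup-comb []       []       t = Vec.lookup-replicate t 0#
  lookup-comb (c ∷ cs) (x ∷ xs) t = trans (Vec.lookup-zipWith _+ᶠ_ t (c · x) (comb cs xs))
    (cong₂ _+ᶠ_ (Vec.lookup-map t (c *ᶠ_) x) (lookup-comb cs xs t))

  sum-cong : ∀ {k} {f g : Fin k → 𝔽} → (∀ j → f j ≡ g j) → sum F f ≡ sum F g
  sum-cong {zero}  f≗g = refl
  sum-cong {suc k} f≗g = cong₂ _+ᶠ_ (f≗g zero) (sum-cong (f≗g ∘ suc))

  lookup-ext : ∀ {A : Set} {n} {x y : Vec A n} → (∀ t → lookup x t ≡ lookup y t) → x ≡ y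
  lookup-ext {x = x} {y} e = trans (sym (Vec.tabulate∘lookup x)) (trans (Vec.tabulate-cong e) (Vec.tabulate∘lookup y))

  lookup-𝟎 : ∀ {n} (t : Fin n) → lookup 𝟎 t ≡ 0#
  lookup-𝟎 t = Vec.lookup-replicate t 0#

  module _ {m k} (A : Matrix F m k) where

    matrix-rows : Vec (V k) m
    matrix-rows = Vec.tabulate λ i → Vec.tabulate (A i)

    lookup-matrix-rows : ∀ i j → lookup (lookup matrix-rows i) j ≡ A i j
    lookup-matrix-rows i j = trans (cong (λ v → lookup v j) (Vec.lookup∘tabulate _ i)) (Vec.lookup∘tabulate (A i) j)

    lookup-comb-rows : ∀ (c : V m) j → lookup (comb c matrix-rows) j ≡ sum F (λ i → lookup c i *ᶠ A i j)
    lookup-comb-rows c j = trans (lookup-comb c matrix-rows j) (sum-cong λ i → cong (lookup c i *ᶠ_) (lookup-matrix-rows i j))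

    independent-rows : NonDegenerate F A → Independent matrix-rows
    independent-rows (indep , _) = go matrix-rows λ c c≡𝟎 → lookup-ext λ i → trans
      (indep (lookup c) (λ j → trans (sym (lookup-comb-rows c j)) (trans (cong (λ v → lookup v j) c≡𝟎) (lookup-𝟎 j))) i) (sym (lookup-𝟎 i))
      where
      go : ∀ {m} (rows : Vec (V k) m) → (∀ c → comb c rows ≡ 𝟎 → c ≡ 𝟎) → Independent rows
      go []         _   = tt
      go (r ∷ rows) ind = r∉ , go rows λ c e → Vec.∷-injectiveʳ (ind (0# ∷ c) (trans (cong (_⊕ comb c rows) (·-zeroˡ r)) (trans (⊕-identityˡ _) e)))
        where
        r∉ : ¬ InRow rows r
        -- A row in the span of the others gives a vanishing combination with coefficient -1 at r.
        r∉ (c , r≡) = 0ᶠ≢1ᶠ (trans (sym (+ᶠ-inverseʳ 1#)) (trans (cong (1# +ᶠ_) (Vec.∷-injectiveˡ (ind ((-ᶠ 1#) ∷ c)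
          (trans (cong ((-ᶠ 1#) · r ⊕_) (sym r≡)) (trans (⊕-comm _ r) (⊕-inverseʳ r)))))) (+ᶠ-identityʳ 1#)))

    solution : ∀ {n} (x : Vec (V n) k) → Solves matrix-rows x → IsSolution F A (lookup x)
    solution x solves i t = begin
      sum F (λ j → A i j *ᶠ lookup (lookup x j) t)  ≡⟨ sum-cong (λ j → cong (_*ᶠ lookup (lookup x j) t) (Vec.lookup∘tabulate (A i) j)) ⟨
      sum F (λ j → lookup (Vec.tabulate (A i)) j *ᶠ lookup (lookup x j) t) ≡⟨ lookup-comb (Vec.tabulate (A i)) x t ⟨
      lookup (comb (Vec.tabulate (A i)) x) t  ≡⟨ cong (λ r → lookup (comb r x) t) (Vec.lookup∘tabulate _ i) ⟨
      lookup (comb (lookup matrix-rows i) x) t  ≡⟨ cong (λ v → lookup v t) (VAllₚ.lookup⁺ solves i) ⟩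
      lookup 𝟎 t  ≡⟨ lookup-𝟎 t ⟩
      0#  ∎
      where open ≡-Reasoning

    generic : ∀ {n} (x : Vec (V n) k) → (∀ b → comb b x ≡ 𝟎 → InRow matrix-rows b) → IsGeneric F A (lookup x)
    generic x all-in-row b _ b-kills = in-row (all-in-row (Vec.tabulate b) (lookup-ext λ t → trans (lookup-comb (Vec.tabulate b) x t)
        (trans (sum-cong λ j → cong (_*ᶠ lookup (lookup x j) t) (Vec.lookup∘tabulate b j)) (trans (b-kills t) (sym (lookup-𝟎 t))))))
      where
      in-row : InRow matrix-rows (Vec.tabulate b) → InRowSpace F A b
      in-row (c , b≡) = lookup c , λ j → trans (sym (Vec.lookup∘tabulate b j)) (trans (cong (λ v → lookup v j) b≡) (lookup-comb-rows c j))

  module _ {m k} (rows : Vec (V k) m) (independent : Independent rows) where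

    InRow? : ∀ b → Dec (InRow rows b)
    InRow? b = ∃? λ c → b ≟ᵛ comb c rows

    degenerate-count : ∀ n → ∣ V n ∣ ^ suc m * ∑ (λ (b : V k) → 𝟙 (¬? (InRow? b)) * kernel n (b ∷ rows)) ≤ q ^ k * ∣ V n ∣ ^ k
    degenerate-count n = begin
      N ^ suc m * ∑ (λ (b : V k) → 𝟙 (¬? (InRow? b)) * kernel n (b ∷ rows))  ≡⟨ ∑-*ˡ (N ^ suc m) _ ⟨
      ∑ (λ (b : V k) → N ^ suc m * (𝟙 (¬? (InRow? b)) * kernel n (b ∷ rows)))  ≤⟨ ∑-mono each ⟩
      ∑ (λ (b : V k) → N ^ k)  ≡⟨ trans (∑-const _) (cong (_* N ^ k) (trans ∣Vec∣ (cong (_^ k) ∣𝔽∣))) ⟩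
      q ^ k * N ^ k  ∎
      where
      open ≤-Reasoning
      N = ∣ V n ∣
      eq : ∀ a b c → a * (b * c) ≡ b * (a * c)
      eq = solve-∀
      each : ∀ b → N ^ suc m * (𝟙 (¬? (InRow? b)) * kernel n (b ∷ rows)) ≤ N ^ k
      each b = ≤-trans (≤-reflexive (eq (N ^ suc m) (𝟙 (¬? (InRow? b))) _)) (𝟙*≤ (¬? (InRow? b)) λ b∉ → kernel-count n (b ∷ rows) (b∉ , independent))

    GenericIn : ∀ {n} → Subset (V n) → Vec (V n) k → Set
    GenericIn S x = (∀ j → T (S (lookup x j))) × Solves rows x × (∀ b → comb b x ≡ 𝟎 → InRow rows b)

    solutions-in : ∀ {n} → Subset (V n) → ℕ
    solutions-in S = ∑ λ x → ∏ (λ j → 𝟙 (lookup x j ∈? S)) * 𝟙 (solves? rows x)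

    -- With no generic solution in S, every solution in S is killed by some b outside the row space.
    find-generic : ∀ {n e D} (S : Subset (V n)) → ∣ V n ∣ ^ k ≤ D ^ e * (∣ V n ∣ ^ m * solutions-in S) →
      D ^ e * q ^ k < ∣ V n ∣ → ∃ (GenericIn S)
    find-generic {n} {e} {D} S supersat large with ∃? generic?
      where
      killed? : ∀ x b → Dec (comb b x ≡ 𝟎 → InRow rows b)
      killed? x b with comb b x ≟ᵛ 𝟎 | InRow? b
      ... | _      | yes b∈ = yes λ _ → b∈
      ... | no ≢𝟎  | no _   = yes λ ≡𝟎 → contradiction ≡𝟎 ≢𝟎
      ... | yes ≡𝟎 | no b∉  = no λ f → b∉ (f ≡𝟎)
      generic? : ∀ x → Dec (GenericIn S x)
      generic? x = ∀? (λ j → lookup x j ∈? S) ×-dec (solves? rows x ×-dec ∀? (killed? x))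
    ... | yes found = found
    ... | no none = contradiction large (≤⇒≯ (*-cancelʳ-≤ N _ (N ^ k) {{m^n≢0 N k}} (begin
      N * N ^ k  ≤⟨ *-monoʳ-≤ N supersat ⟩
      N * (D ^ e * (N ^ m * solutions-in S))  ≡⟨ eq N (D ^ e) (N ^ m) (solutions-in S) ⟩
      D ^ e * (N ^ suc m * solutions-in S)  ≤⟨ *-monoʳ-≤ (D ^ e) (*-monoʳ-≤ (N ^ suc m) all-degenerate) ⟩
      D ^ e * (N ^ suc m * ∑ (λ b → 𝟙 (¬? (InRow? b)) * kernel n (b ∷ rows))) ≤⟨ *-monoʳ-≤ (D ^ e) (degenerate-count n) ⟩
      D ^ e * (q ^ k * N ^ k)  ≡⟨ *-assoc (D ^ e) _ _ ⟨
      D ^ e * q ^ k * N ^ k  ∎)))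
      where
      open ≤-Reasoning
      N = ∣ V n ∣
      eq : ∀ N d M s → N * (d * (M * s)) ≡ d * (N * M * s)
      eq = solve-∀
      Killer : Vec (V n) k → V k → Set
      Killer x b = ¬ InRow rows b × comb b x ≡ 𝟎
      killer : ∀ x → (∀ j → T (S (lookup x j))) → Solves rows x → ∃ (Killer x)
      killer x x∈ solves with ∃? (λ b → ¬? (InRow? b) ×-dec (comb b x ≟ᵛ 𝟎))
      ... | yes found = found
      ... | no no-killer = contradiction (x , x∈ , solves , λ b ≡𝟎 → in-row b ≡𝟎) none
        where
        in-row : ∀ b → comb b x ≡ 𝟎 → InRow rows b
        in-row b ≡𝟎 with InRow? b
        ... | yes b∈ = b∈
        ... | no b∉  = contradiction (b , b∉ , ≡𝟎) no-killer
      all-degenerate : solutions-in S ≤ ∑ (λ b → 𝟙 (¬? (InRow? b)) * kernel n (b ∷ rows))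
      all-degenerate = begin
        solutions-in S  ≤⟨ ∑-mono each ⟩
        ∑ (λ x → ∑ λ b → 𝟙 (¬? (InRow? b)) * 𝟙 (solves? (b ∷ rows) x))  ≡⟨ ∑-swap (λ x b → 𝟙 (¬? (InRow? b)) * 𝟙 (solves? (b ∷ rows) x)) ⟩
        ∑ (λ b → ∑ λ x → 𝟙 (¬? (InRow? b)) * 𝟙 (solves? (b ∷ rows) x))  ≡⟨ ∑-cong (λ b → ∑-*ˡ (𝟙 (¬? (InRow? b))) _) ⟩
        ∑ (λ b → 𝟙 (¬? (InRow? b)) * kernel n (b ∷ rows))  ∎
        where
        f : Vec (V n) k → V k → ℕ
        f x b = 𝟙 (¬? (InRow? b)) * 𝟙 (solves? (b ∷ rows) x)
        each : ∀ x → ∏ (λ j → 𝟙 (lookup x j ∈? S)) * 𝟙 (solves? rows x) ≤ ∑ (f x)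
        each x = begin
          ∏ (λ j → 𝟙 (lookup x j ∈? S)) * 𝟙 (solves? rows x)  ≤⟨ *-monoˡ-≤ _ (∏-𝟙≤ (λ j → lookup x j ∈? S) (∀? λ j → lookup x j ∈? S) id) ⟩
          𝟙 (∀? λ j → lookup x j ∈? S) * 𝟙 (solves? rows x)  ≡⟨ trans (𝟙-× (∀? λ j → lookup x j ∈? S) (solves? rows x)) (sym (*-identityʳ _)) ⟩
          𝟙 ((∀? λ j → lookup x j ∈? S) ×-dec solves? rows x) * 1 ≤⟨ 𝟙*≤ ((∀? λ j → lookup x j ∈? S) ×-dec solves? rows x) (λ (x∈ , solves) → killed solves (killer x x∈ solves)) ⟩
          ∑ (f x)  ∎
          where
          killed : Solves rows x → ∃ (Killer x) → 1 ≤ ∑ (f x)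
          killed solves (b , b∉ , ≡𝟎) = ≤-trans (≤-reflexive (sym (cong₂ _*_ (𝟙-yes (¬? (InRow? b)) b∉) (𝟙-yes (solves? (b ∷ rows) x) (≡𝟎 ∷ solves))))) (∑-≥ b (f x))

  -- The local function of ClassSumsToZero, recovered by unification from a 1 × 1 instance.
  mutual
    indicator : ∀ {ℓ} → Fin ℓ → Fin ℓ → 𝔽 → 𝔽
    indicator = _

    indicator-spec : ∀ {ℓ} (s t : Fin ℓ) (a : 𝔽) → ClassSumsToZero F {1} {1} (λ _ _ → a) (λ _ → s) t →
      ∀ (i : Fin 1) → indicator s t a +ᶠ 0# ≡ 0#
    indicator-spec s t a h = h

  indicator-≡ : ∀ {ℓ} (t : Fin ℓ) a → indicator t t a ≡ a
  indicator-≡ zero    a = refl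
  indicator-≡ (suc t) a = indicator-≡ t a

  indicator-≢ : ∀ {ℓ} (s t : Fin ℓ) a → s ≢ t → indicator s t a ≡ 0#
  indicator-≢ zero    zero    a s≢t = contradiction refl s≢t
  indicator-≢ zero    (suc t) a s≢t = refl
  indicator-≢ (suc s) zero    a s≢t = refl
  indicator-≢ (suc s) (suc t) a s≢t = indicator-≢ s t a λ { refl → s≢t refl }

  -- Class data of a matrix

  module _ {ℓ : ℕ} where
    open Classes {ℓ}

    columns : ∀ {k} → (Fin k → 𝔽) → (Fin k → Fin ℓ) → Vec (𝔽 × Fin ℓ) k
    columns c cls = Vec.tabulate λ j → c j , cls j

    -- Within class t every entry is c_j times the same u t, so the class sum of a row factors; this
    -- links class sums of columns to totals of coefficient lists.
    class-total : ∀ {k} (c : Fin k → 𝔽) (cls : Fin k → Fin ℓ) (u : Fin ℓ → 𝔽) {a : Fin k → 𝔽} → (∀ j → a j ≡ c j *ᶠ u (cls j)) →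
      ∀ t → sum F (λ j → indicator (cls j) t (a j)) ≡ total (coeffs (columns c cls) t) *ᶠ u t
    class-total {zero}  c cls u a≡ t = sym (*ᶠ-zeroˡ (u t))
    class-total {suc k} c cls u a≡ t with cls zero Fin.≟ t
    ... | yes refl = trans (cong₂ _+ᶠ_ (trans (indicator-≡ t _) (a≡ zero)) (class-total (c ∘ suc) (cls ∘ suc) u (a≡ ∘ suc) t)) (sym (*ᶠ-distribʳ (u t) (c zero) _))
    ... | no ≢t = trans (cong₂ _+ᶠ_ (indicator-≢ (cls zero) t _ ≢t) (class-total (c ∘ suc) (cls ∘ suc) u (a≡ ∘ suc) t)) (+ᶠ-identityˡ _)

    coeffs-nonzero : ∀ {k} (c : Fin k → 𝔽) (cls : Fin k → Fin ℓ) → (∀ j → c j ≢ 0#) → ∀ t → All (_≢ 0#) (coeffs (columns c cls) t)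
    coeffs-nonzero {zero}  c cls c≢0 t = []
    coeffs-nonzero {suc k} c cls c≢0 t with cls zero Fin.≟ t
    ... | yes _ = c≢0 zero ∷ coeffs-nonzero (c ∘ suc) (cls ∘ suc) (c≢0 ∘ suc) t
    ... | no _  = coeffs-nonzero (c ∘ suc) (cls ∘ suc) (c≢0 ∘ suc) t

    coeffs-nonempty : ∀ {k} (c : Fin k → 𝔽) (cls : Fin k → Fin ℓ) j {t} → cls j ≡ t →
      ∃ λ hd → ∃ λ tl → coeffs (columns c cls) t ≡ hd ∷ tl
    coeffs-nonempty {suc k} c cls j {t} eq with cls zero Fin.≟ t
    coeffs-nonempty {suc k} c cls j       eq | yes _ = _ , _ , refl
    coeffs-nonempty {suc k} c cls zero    eq | no ≢t = contradiction eq ≢t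
    coeffs-nonempty {suc k} c cls (suc j) eq | no _  = coeffs-nonempty (c ∘ suc) (cls ∘ suc) j eq

    class-sum-replicate : ∀ {k n} (cc : Vec (𝔽 × Fin ℓ) k) (z : V n) t →
      class-sum cc (Vec.replicate k z) t ≡ total (coeffs cc t) · z
    class-sum-replicate []              z t = sym (·-zeroˡ z)
    class-sum-replicate ((c , t₀) ∷ cc) z t with t₀ Fin.≟ t
    ... | yes _ = trans (cong (c · z ⊕_) (class-sum-replicate cc z t)) (sym (·-distribʳ c _ z))
    ... | no _  = class-sum-replicate cc z t

  comb-replicate : ∀ {k n} (f : Fin k → 𝔽) (z : V n) → comb (Vec.tabulate f) (Vec.replicate k z) ≡ sum F f · z
  comb-replicate {zero}  f z = sym (·-zeroˡ z)
  comb-replicate {suc k} f z = trans (cong (f zero · z ⊕_) (comb-replicate (f ∘ suc) z)) (sym (·-distribʳ (f zero) _ z))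

  -- Here N = q^n is the size of the space, and γ = q · 2e / (2e + 1) has (γ / q)^e ≥ 1/2 ≥ 1/q.
  density-parameter : ∀ e .{{_ : NonZero e}} C n L → 2 ≤ q → L ≤ q ^ n →
    suc (C * 3 ^ e) * (q * (2 * e)) ^ n ≤ L * suc (2 * e) ^ n →
    ∃ λ D → 2 ≤ D × q ^ n ≤ D * L × D ^ e * C < q ^ n
  density-parameter e C n L 2≤q L≤N dense = D , m≤n+m 2 _ , covers , *-cancelʳ-< (L ^ e) _ _ (begin-strict
    D ^ e * C * L ^ e  ≡⟨ eq₁ (D ^ e) C (L ^ e) ⟩
    C * (D ^ e * L ^ e)  ≡⟨ cong (C *_) (^-distribʳ-* e D L) ⟨
    C * (D * L) ^ e  ≤⟨ *-monoʳ-≤ C (^-monoˡ-≤ e D*L≤3N) ⟩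
    C * (3 * N) ^ e  ≡⟨ trans (cong (C *_) (^-distribʳ-* e 3 N)) (sym (*-assoc C _ _)) ⟩
    C * 3 ^ e * N ^ e  <⟨ *-monoˡ-< (N ^ e) {{m^n≢0 N e}} (n<1+n (C * 3 ^ e)) ⟩
    B * N ^ e  ≤⟨ *-monoˡ-≤ (N ^ e) (≤-trans (≤-reflexive (sym (*-identityʳ B))) (^-monoʳ-≤ B {1} {e} (>-nonZero⁻¹ e))) ⟩
    B ^ e * N ^ e  ≤⟨ key ⟩
    N * L ^ e  ∎)
    where
    open ≤-Reasoning
    N = q ^ n
    B = suc (C * 3 ^ e)
    μ = 2 * e
    instance
      μ-nonZero : NonZero μ
      μ-nonZero = m*n≢0 2 e
      N-nonZero : NonZero N
      N-nonZero = m^n≢0 q n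
      -- The left side of the density hypothesis is positive, so the set is not empty and division
      -- by L is legitimate.
      L-nonZero : NonZero L
      L-nonZero = positive L dense
        where
        positive : ∀ L → B * (q * μ) ^ n ≤ L * suc μ ^ n → NonZero L
        positive (suc L) _  = _
        positive zero    le = contradiction le (<⇒≱ (>-nonZero⁻¹ _ {{m*n≢0 B ((q * μ) ^ n) {{_}} {{m^n≢0 (q * μ) n {{m*n≢0 q μ}}}}}}))
    -- The summand 2 rounds the quotient up and makes 2 ≤ D immediate. With L ≤ N it keeps D L ≤ 3
    -- N, the origin of the factor 3^e in B.
    D = N / L + 2
    eq₁ : ∀ d c l → d * c * l ≡ c * (d * l)
    eq₁ = solve-∀
    covers : N ≤ D * L
    covers = begin
      N  ≡⟨ m≡m%n+[m/n]*n N L ⟩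
      N % L + N / L * L ≤⟨ +-monoˡ-≤ (N / L * L) (<⇒≤ (m%n<n N L)) ⟩
      L + N / L * L  ≤⟨ m≤m+n _ L ⟩
      L + N / L * L + L  ≡⟨ eq L (N / L) ⟩
      D * L  ∎
      where
      eq : ∀ l d → l + d * l + l ≡ (d + 2) * l
      eq = solve-∀
    D*L≤3N : D * L ≤ 3 * N
    D*L≤3N = begin
      (N / L + 2) * L  ≡⟨ *-distribʳ-+ L (N / L) 2 ⟩
      N / L * L + 2 * L  ≤⟨ +-mono-≤ (m/n*n≤m N L) (*-monoʳ-≤ 2 L≤N) ⟩
      N + 2 * N  ∎
    exchange : ∀ x → (x ^ n) ^ e ≡ (x ^ e) ^ n
    exchange x = trans (^-*-assoc x n e) (trans (cong (x ^_) (*-comm n e)) (sym (^-*-assoc x e n)))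
    X = (μ ^ e) ^ n
    -- The density hypothesis raised to the power e: L^e is at least B^e N^e (γ / q)^(e n), and the
    -- last factor is at least 1 / N.
    key : B ^ e * N ^ e ≤ N * L ^ e
    key = *-cancelʳ-≤ _ _ X {{m^n≢0 (μ ^ e) n {{m^n≢0 μ e}}}} (begin
      B ^ e * N ^ e * X  ≡⟨ *-assoc (B ^ e) _ X ⟩
      B ^ e * (N ^ e * X)  ≡⟨ cong (λ y → B ^ e * (N ^ e * y)) (exchange μ) ⟨
      B ^ e * (N ^ e * (μ ^ n) ^ e)  ≡⟨ cong (B ^ e *_) (trans (cong (_^ e) (^-distribʳ-* n q μ)) (^-distribʳ-* e N (μ ^ n))) ⟨
      B ^ e * ((q * μ) ^ n) ^ e  ≡⟨ ^-distribʳ-* e B _ ⟨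
      (B * (q * μ) ^ n) ^ e  ≤⟨ ^-monoˡ-≤ e dense ⟩
      (L * suc μ ^ n) ^ e  ≡⟨ trans (^-distribʳ-* e L (suc μ ^ n)) (cong (L ^ e *_) (exchange (suc μ))) ⟩
      L ^ e * (suc μ ^ e) ^ n  ≤⟨ *-monoʳ-≤ (L ^ e) (^-monoˡ-≤ n (≤-trans ([1+2a]^a≤2*[2a]^a e) (*-monoˡ-≤ (μ ^ e) 2≤q))) ⟩
      L ^ e * (q * μ ^ e) ^ n  ≡⟨ cong (L ^ e *_) (^-distribʳ-* n q (μ ^ e)) ⟩
      L ^ e * (N * X)  ≡⟨ eq₂ (L ^ e) N X ⟩
      N * L ^ e * X  ∎)
      where
      eq₂ : ∀ l N x → l * (N * x) ≡ N * l * x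
      eq₂ = solve-∀

  -- From supersaturation to temperance

  2≤q : 2 ≤ q
  2≤q = ≤-trans (s≤s (>-nonZero⁻¹ p)) (≤-reflexive (sym q≡1+p))

  ∣Vec𝔽∣ : ∀ n → ∣ V n ∣ ≡ q ^ n
  ∣Vec𝔽∣ n = trans ∣Vec∣ (cong (_^ n) ∣𝔽∣)

  module _ {m k} (A : Matrix F m k) where

    MatrixSupersaturated : ℕ → Set
    MatrixSupersaturated e = ∀ {n D} (S : Subset (V n)) → 2 ≤ D → Dense D S →
      ∣ V n ∣ ^ k ≤ D ^ e * (∣ V n ∣ ^ m * ∑ λ x → ∏ (λ j → 𝟙 (lookup x j ∈? S)) * 𝟙 (solves? (matrix-rows A) x))

    temperate : NonDegenerate F A → ∃ MatrixSupersaturated → Temperate F A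
    temperate nondeg (e , supersat) = toℚ B , γ , fraction-< {0} {0} {B} {0} (s≤s z≤n) ,
      fraction-< {0} {0} {q * μ} {μ} (≤-trans (>-nonZero⁻¹ (q * μ) {{m*n≢0 q μ}}) (≤-reflexive (sym (*-identityʳ _)))) ,
      fraction-< {q * μ} {μ} {q} {0} (≤-trans (≤-reflexive (cong suc (*-identityʳ (q * μ)))) (*-monoʳ-< q (n<1+n μ))) ,
      contains-generic
      where
      -- The successor makes the exponent positive, as the choice of D requires.
      e′ = suc e
      μ = 2 * e′
      -- This is β: it outweighs the q^k candidates for b and the loss 3^e′ from rounding D.
      B = suc (q ^ k * 3 ^ e′)
      γ = (pos (q * μ)) ℚ./ suc μ
      ind = independent-rows A nondeg
      contains-generic : ∀ n (S : List (V n)) → Unique S → toℚ B ℚ.* (γ ^ℚ n) ℚ.≤ toℚ (length S) →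
        ∃ λ x → (∀ (j : Fin k) → x j ∈ S) × IsGenericSolution F A x
      contains-generic n S uniq dense = extract (density-parameter e′ (q ^ k) n (length S) 2≤q small (clear-denominators B (q * μ) μ n (length S) dense))
        where
        open ≤-Reasoning
        N = ∣ V n ∣
        in-S? : ∀ v → Dec (v ∈ S)
        in-S? v = any? (v ≟ᵛ_) S
        S′ : Subset (V n)
        S′ v = ⌊ in-S? v ⌋
        length≤# : length S ≤ # S′
        length≤# = begin
          length S  ≡⟨ sumOver-1 S ⟨
          sumOver S (λ _ → 1)  ≤⟨ go S id ⟩
          sumOver S (λ v → 𝟙 (v ∈? S′))  ≤⟨ sumOver-⊆ _ uniq (λ _ → complete _) ⟩
          sumOver elems (λ v → 𝟙 (v ∈? S′))  ≡⟨ ∑-def _ ⟨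
          # S′  ∎
          where
          go : ∀ vs → (∀ {v} → v ∈ vs → v ∈ S) → sumOver vs (λ _ → 1) ≤ sumOver vs (λ v → 𝟙 (v ∈? S′))
          go []       _    = z≤n
          go (v ∷ vs) vs⊆S = +-mono-≤ (≤-reflexive (sym (𝟙-yes (v ∈? S′) (fromWitness (vs⊆S (here refl)))))) (go vs (vs⊆S ∘ there))
        small : length S ≤ q ^ n
        small = ≤-trans length≤# (≤-trans (#≤ S′) (≤-reflexive (∣Vec𝔽∣ n)))
        extract : (∃ λ D → 2 ≤ D × q ^ n ≤ D * length S × D ^ e′ * q ^ k < q ^ n) →
          ∃ λ x → (∀ (j : Fin k) → x j ∈ S) × IsGenericSolution F A x
        extract (D , 2≤D , covers , large) = from-generic (find-generic (matrix-rows A) ind {e = e′} {D} S′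
          (≤-trans (supersat S′ 2≤D dense′) (*-monoˡ-≤ _ (^-monoʳ-≤ D {{>-nonZero (<-≤-trans (s≤s z≤n) 2≤D)}} (n≤1+n e))))
          (≤-trans large (≤-reflexive (sym (∣Vec𝔽∣ n)))))
          where
          dense′ : Dense D S′
          dense′ = ≤-trans (≤-reflexive (∣Vec𝔽∣ n)) (≤-trans covers (*-monoʳ-≤ D length≤#))
          from-generic : ∃ (GenericIn (matrix-rows A) ind S′) → ∃ λ x → (∀ (j : Fin k) → x j ∈ S) × IsGenericSolution F A x
          from-generic (x , x∈ , solves , gen) = lookup x , (λ j → toWitness (x∈ j)) , solution A x solves , generic A x gen

    module _ {ℓ} (cls : Fin k → Fin ℓ) (balanced : Balanced F A) (nondeg : NonDegenerate F A) (labelling : ClassLabelling F A ℓ cls) where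
      open Classes {ℓ}

      -- The vector v_t of a class is the column of this representative, and `scalar` gives the
      -- multiples relative to it.
      rep-of : Fin ℓ → Fin k
      rep-of t = proj₁ (proj₂ (proj₂ labelling) t)

      cls-rep-of : ∀ t → cls (rep-of t) ≡ t
      cls-rep-of t = proj₂ (proj₂ (proj₂ labelling) t)

      proportional : ∀ j → ColEquiv F A (rep-of (cls j)) j
      proportional j = proj₁ labelling (rep-of (cls j)) j (cls-rep-of (cls j))

      scalar : Fin k → 𝔽
      scalar j = proj₁ (proportional j)

      scalar≢0 : ∀ j → scalar j ≢ 0#
      scalar≢0 j = proj₁ (proj₂ (proportional j))

      column≡ : ∀ i j → A i j ≡ scalar j *ᶠ A i (rep-of (cls j))
      column≡ i j = proj₂ (proj₂ (proportional j)) i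

      cc : Vec (𝔽 × Fin ℓ) k
      cc = columns scalar cls

      ws : Vec (V ℓ) m
      ws = Vec.tabulate λ i → Vec.tabulate λ t → A i (rep-of t)

      row-of≡ : ∀ i → row-of cc (Vec.tabulate λ t → A i (rep-of t)) ≡ Vec.tabulate (A i)
      row-of≡ i = trans (sym (Vec.tabulate-∘ _ (λ j → scalar j , cls j)))
        (Vec.tabulate-cong λ j → trans (cong (scalar j *ᶠ_) (Vec.lookup∘tabulate _ (cls j))) (sym (column≡ i j)))

      rows≡ : ClassSystem.rows cc ws ≡ matrix-rows A
      rows≡ = trans (sym (Vec.tabulate-∘ (row-of cc) _)) (Vec.tabulate-cong row-of≡)

      class-total-row : ∀ t i → sum F (λ j → indicator (cls j) t (A i j)) ≡ total (coeffs cc t) *ᶠ A i (rep-of t)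
      class-total-row t i = class-total scalar cls (λ t → A i (rep-of t)) (column≡ i) t

      total≢0 : ∀ t → ¬ ClassSumsToZero F A cls t → total (coeffs cc t) ≢ 0#
      total≢0 t ≢0 σ≡0 = ≢0 λ i → trans (class-total-row t i) (*ᶠ-0ˡ σ≡0)

      -- The class sum is the total times the representative column, and that column is nonzero by
      -- non-degeneracy.
      total≡0 : ∀ t → ClassSumsToZero F A cls t → total (coeffs cc t) ≡ 0#
      total≡0 t sums-to-zero with total (coeffs cc t) ≟ᶠ 0#
      ... | yes σ≡0 = σ≡0
      ... | no σ≢0 = contradiction column≡0 (proj₂ nondeg (rep-of t))
        where
        σ = total (coeffs cc t)
        column≡0 : ∀ i → A i (rep-of t) ≡ 0#
        column≡0 i = begin
          A i (rep-of t)  ≡⟨ *ᶠ-identityˡ _ ⟨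
          1# *ᶠ A i (rep-of t)  ≡⟨ cong (_*ᶠ A i (rep-of t)) (trans (*ᶠ-comm (σ ⁻¹) σ) (inverse σ σ≢0)) ⟨
          (σ ⁻¹) *ᶠ σ *ᶠ A i (rep-of t)  ≡⟨ *ᶠ-assoc (σ ⁻¹) σ _ ⟩
          (σ ⁻¹) *ᶠ (σ *ᶠ A i (rep-of t))  ≡⟨ *ᶠ-0ʳ (trans (sym (class-total-row t i)) (sums-to-zero i)) ⟩
          0#  ∎
          where open ≡-Reasoning

      -- The constant tuple (z , ... , z) solves a balanced system, and its class values are the
      -- multiples of z by the class totals.
      diagonal-solves : ∀ {n} (z : V n) → Solves ws (Vec.tabulate λ t → total (coeffs cc t) · z)
      diagonal-solves z = VAllₚ.tabulate⁺ λ i → begin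
        comb (w i) (Vec.tabulate λ t → total (coeffs cc t) · z)  ≡⟨ cong (comb (w i)) (Vec.tabulate-cong (class-sum-replicate cc z)) ⟨
        comb (w i) (Vec.tabulate (class-sum cc (Vec.replicate k z)))  ≡⟨ ClassSystem.comb-row-of cc ws cc (w i) (Vec.replicate k z) ⟨
        comb (row-of cc (w i)) (Vec.replicate k z)  ≡⟨ cong (λ r → comb r (Vec.replicate k z)) (row-of≡ i) ⟩
        comb (Vec.tabulate (A i)) (Vec.replicate k z)  ≡⟨ comb-replicate (A i) z ⟩
        sum F (A i) · z  ≡⟨ cong (_· z) (balanced i) ⟩
        0# · z  ≡⟨ ·-zeroˡ z ⟩
        𝟎  ∎
        where
        open ≡-Reasoning
        w : Fin m → V ℓ
        w i = Vec.tabulate λ t → A i (rep-of t)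

      from-classes : ∃ (SystemSupersaturated cc ws) → ∃ MatrixSupersaturated
      from-classes (e , supersat) = e , λ {n} {D} S 2≤D dense → subst
        (λ R → ∣ V n ∣ ^ k ≤ D ^ e * (∣ V n ∣ ^ m * ∑ λ x → ∏ (λ j → 𝟙 (lookup x j ∈? S)) * 𝟙 (solves? R x)))
        rows≡ (supersat S 2≤D dense)

      nonzero-classes : (∀ t → ¬ ClassSumsToZero F A cls t) → ℓ ≡ suc m → ∃ MatrixSupersaturated
      nonzero-classes ≢0 ℓ≡ = from-classes (supersaturated-nonzero-classes cc ws ℓ≡
        (λ t → supersaturated (coeffs cc t) (coeffs-nonzero scalar cls scalar≢0 t) (total≢0 t (≢0 t)))
        (λ t → total≢0 t (≢0 t)) diagonal-solves)

      zero-classes : (∀ t → ClassSumsToZero F A cls t) → ∃ MatrixSupersaturated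
      zero-classes ≡0 = from-classes (supersaturated-zero-classes cc ws hd tl coeffs≡ cancel hd≢0
        λ t → supersaturated (tl t) (tl-nonzero t) λ τ≡0 → hd≢0 t (trans (sym (+ᶠ-identityʳ _)) (trans (cong (hd t +ᶠ_) (sym τ≡0)) (cancel t))))
        where
        nonempty : ∀ t → ∃ λ hd → ∃ λ tl → coeffs cc t ≡ hd ∷ tl
        nonempty t = coeffs-nonempty scalar cls (rep-of t) (cls-rep-of t)
        hd : Fin ℓ → 𝔽
        hd t = proj₁ (nonempty t)
        tl : Fin ℓ → List 𝔽
        tl t = proj₁ (proj₂ (nonempty t))
        coeffs≡ : ∀ t → coeffs cc t ≡ hd t ∷ tl t
        coeffs≡ t = proj₂ (proj₂ (nonempty t))
        cancel : ∀ t → hd t +ᶠ total (tl t) ≡ 0#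
        cancel t = trans (cong total (sym (coeffs≡ t))) (total≡0 t (≡0 t))
        all-nonzero : ∀ t → All (_≢ 0#) (hd t ∷ tl t)
        all-nonzero t = subst (All (_≢ 0#)) (coeffs≡ t) (coeffs-nonzero scalar cls scalar≢0 t)
        hd≢0 : ∀ t → hd t ≢ 0#
        hd≢0 t = All.head (all-nonzero t)
        tl-nonzero : ∀ t → All (_≢ 0#) (tl t)
        tl-nonzero t = All.tail (all-nonzero t)

theoremB : (F : FiniteField) → (m k : ℕ) → (A : Matrix F m k) →
    TypeRC F A → NonDegenerate F A → Irreducible F A →
    (ℓ : ℕ) → (cls : Fin k → Fin ℓ) → ClassLabelling F A ℓ cls →
    (((∀ t → ¬ ClassSumsToZero F A cls t) × ℓ ≡ suc m)
    ⊎ (∀ t → ClassSumsToZero F A cls t)) →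
    Temperate F A
theoremB F m k A (balanced , _) nondeg _ ℓ cls labelling cases = temperate A nondeg (supersat cases)
  where
  open OverField F
  supersat : ((∀ t → ¬ ClassSumsToZero F A cls t) × ℓ ≡ suc m) ⊎ (∀ t → ClassSumsToZero F A cls t) → ∃ (MatrixSupersaturated A)
  supersat (inj₁ (≢0 , ℓ≡)) = nonzero-classes A cls balanced nondeg labelling ≢0 ℓ≡
  supersat (inj₂ ≡0)        = zero-classes A cls balanced nondeg labelling ≡0
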